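{- Let $\ell\geq s\geq r\geq 3$ be integers. Then for all sufficiently large $n$, $$\mathrm{ex}_r(n,K_s^{(r)},K_{\ell+1}^r)=\mathcal{N}(K_s^{(r)},\mathcal{T}_r(n,\ell)).$$
   Context: An $r$-graph is a hypergraph all of whose hyperedges have exactly $r$ vertices. $K_s^{(r)}$ is the complete $r$-graph on $s$ vertices. For a graph $F$, the $r$-expansion $F^r$ is the $r$-graph obtained from $F$ by adding $r-2$ new vertices to each edge of $F$, all new vertices distinct from each other and from $V(F)$; $K_{\ell+1}^r$ is the $r$-expansion of the complete graph $K_{\ell+1}$. $\mathcal{T}_r(n,\ell)$ is the complete balanced $\ell$-partite $r$-graph on $n$ vertices: the vertex set is partitioned into $\ell$ parts of sizes differing by at most one, and the hyperedges are all $r$-sets meeting each part in at most one vertex. $\mathcal{N}(\mathcal{G}_1,\mathcal{G}_2)$ is the number of copies of $\mathcal{G}_1$ in $\mathcal{G}_2$. $\mathrm{ex}_r(n,\mathcal{H},\mathcal{F})$ is the maximum number of copies of $\mathcal{H}$ in an $n$-vertex $r$-graph containing no copy of $\mathcal{F}$. -}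

module Defs where

open import Data.Nat using (ℕ; zero; suc; _%_; _≟_; _<_)
open import Data.Bool using (true; false)
open import Data.Fin as F using (Fin; toℕ)
open import Data.Fin.Subset using (Subset; _⊆_; ∣_∣; _∈_; _∉_; inside; outside)
open import Data.Fin.Subset.Properties using (_∈?_; _⊆?_)
open import Data.Fin.Properties using (all?)
open import Data.Vec using ([]; _∷_)
open import Data.List using (List; []; _∷_; map; _++_; filter; length)
open import Data.List.Relation.Unary.All using (All)
import Data.List.Relation.Unary.All as All
open import Data.Product using (Σ; _×_; ∃; ∃-syntax)
open import Relation.Nullary using (¬_; Dec)
open import Relation.Nullary.Decidable using (_×-dec_; _→-dec_; ¬?)
open import Relation.Unary using (Decidable)
open import Relation.Binary.PropositionalEquality using (_≡_; _≢_)
open import Function.Definitions using (Injective)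

allSubsets : (n : ℕ) → List (Subset n)
allSubsets zero = [] ∷ []
allSubsets (suc n) = map (outside ∷_) (allSubsets n) ++ map (inside ∷_) (allSubsets n)

record RGraph (r n : ℕ) : Set₁ where
  field
    Edge    : Subset n → Set
    Edge?   : Decidable Edge
    uniform : ∀ e → Edge e → ∣ e ∣ ≡ r
open RGraph public

SpansClique : ∀ {r n} → RGraph r n → Subset n → Set
SpansClique {r} {n} G S = All (λ e → e ⊆ S → ∣ e ∣ ≡ r → Edge G e) (allSubsets n)

spansClique? : ∀ {r n} (G : RGraph r n) → Decidable (SpansClique G)
spansClique? {r} {n} G S =
  All.all? (λ e → (e ⊆? S) →-dec ((∣ e ∣ ≟ r) →-dec Edge? G e)) (allSubsets n)

-- N(K_s^{(r)}, G): the number of copies of K_s^{(r)} in G.  Since s ≥ r,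
-- K_s^{(r)} has no isolated vertices, and a copy of the complete r-graph
-- is determined by its vertex set: an s-set all of whose r-subsets are edges.
copiesK : ∀ {r n} → (s : ℕ) → RGraph r n → ℕ
copiesK {r} {n} s G =
  length (filter (λ S → (∣ S ∣ ≟ s) ×-dec spansClique? G S) (allSubsets n))

-- G contains a copy of the expansion K_m^r (m = ℓ+1): an injective image f of
-- the core vertices Fin m, and for every pair i < j an edge E i j of G containing
-- f i and f j, whose remaining r-2 vertices avoid the image of f and all the
-- other edges E k l (so all the added vertices are distinct from each other
-- and from the core).
ContainsExpansion : ∀ {r n} → RGraph r n → (m : ℕ) → Set
ContainsExpansion {r} {n} G m =
  Σ (Fin m → Fin n) λ f → Injective _≡_ _≡_ f ×
  Σ (Fin m → Fin m → Subset n) λ E →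
    ∀ (i j : Fin m) → i F.< j →
      Edge G (E i j) × f i ∈ E i j × f j ∈ E i j ×
      (∀ v → v ∈ E i j → v ≢ f i → v ≢ f j →
         (∀ k → v ≢ f k) ×
         (∀ k l → k F.< l → ¬ (k ≡ i × l ≡ j) → v ∉ E k l))

-- Balanced ℓ-partition of Fin n: vertex v lies in part (toℕ v mod ℓ).
-- The part sizes differ by at most one.
part : ℕ → ∀ {n} → Fin n → ℕ
part zero v = 0
part (suc k) v = toℕ v % suc k

TuranEdge : (r n ℓ : ℕ) → Subset n → Set
TuranEdge r n ℓ e =
  ∣ e ∣ ≡ r × (∀ u v → u ∈ e → v ∈ e → u ≢ v → part ℓ u ≢ part ℓ v)

turanEdge? : (r n ℓ : ℕ) → Decidable (TuranEdge r n ℓ)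
turanEdge? r n ℓ e =
  (∣ e ∣ ≟ r) ×-dec
  all? (λ u → all? (λ v →
    (u ∈? e) →-dec ((v ∈? e) →-dec (¬? (u F.≟ v) →-dec ¬? (part ℓ u ≟ part ℓ v)))))

turan : (r n ℓ : ℕ) → RGraph r n
turan r n ℓ = record
  { Edge = TuranEdge r n ℓ
  ; Edge? = turanEdge? r n ℓ
  ; uniform = λ e p → Data.Product.proj₁ p
  }

{-# OPTIONS --safe #-}
module Submission where

-- Call a pair of vertices heavy when it is the kernel of a sunflower of k edges, k a
-- large constant. Petals can be chosen greedily, so K_{ℓ+1} with all pairs heavy gives
-- the expansion, and even one pair may be light provided some edge contains it. The
-- edges through a light pair are covered by O(1) further vertices, so only O(m^{s-1})
-- copies of K_s^{(r)} on m vertices contain a light pair.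
--
-- Vertices in fewer copies than the minimum degree of the Turán graph may be deleted:
-- each deletion raises the excess over the Turán number, and the excess of a small
-- graph is bounded. In a graph of large minimum degree, Zykov's theorem shows that all
-- but few vertices have about (1 − 1/ℓ)m heavy neighbours. The heavy graph is
-- K_{ℓ+1}-free, so the vertices split according to which vertex of a heavy K_ℓ they are
-- not joined to, and this splits almost all vertices into ℓ almost completely joined
-- classes. The minimum degree then attaches each remaining vertex to one of the
-- classes, and an edge with two vertices in the same class would create the expansion.
-- So every copy is transversal to an ℓ-partition, and Zykov's theorem finishes the proof.

open import Defs
open import Data.Nat
open import Data.Nat.Properties
open import Data.Nat.DivMod using (m/n*n≤m; m/n≤m; m*n/n≡m; /-monoˡ-≤; m≡m%n+[m/n]*n; m%n<n; m<n⇒m%n≡m; [m+kn]%n≡m%n)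
open import Data.Nat.Tactic.RingSolver using (solve-∀)
open import Data.Bool using (true; false; if_then_else_)
open import Data.Fin as Fin using (Fin; zero; suc; toℕ; fromℕ<)
open import Data.Fin.Properties as Fin using (¬∀⟶∃¬; pigeonhole; fromℕ<-injective)
open import Data.Fin.Subset as Sub using (Subset; ∣_∣; ⁅_⁆; _∪_; ⊥; inside; outside)
open import Data.Fin.Subset.Properties using (_∈?_; ∪-identityˡ; ∪-comm; ∪-assoc; x∈p∪q⁺; x∈p∪q⁻; x∈⁅x⁆; x∈⁅y⁆⇒x≡y; ∉⊥; ∣⊥∣≡0; p⊆q⇒∣p∣≤∣q∣)
open import Data.Vec using ([]; _∷_; here; there)
open import Data.List using (List; []; _∷_; length; filter; map; _++_; allFin; upTo; take; concatMap; cartesianProduct; lookup)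
open import Data.List.Properties using (length-filter; length-map; length-++; length-tabulate; length-take; length-upTo; map-tabulate; filter-all)
open import Data.List.Membership.Propositional using (_∈_; find; lose)
open import Data.List.Membership.Propositional.Properties using (∈-filter⁺; ∈-filter⁻; ∈-∃++; ∈-map⁺; ∈-map⁻; ∈-++⁺ˡ; ∈-++⁺ʳ; ∈-concatMap⁺; ∈-cartesianProduct⁺; ∈-lookup; ∈-allFin; ∈-upTo⁺; ∈-upTo⁻)
open import Data.List.Relation.Unary.Any using (Any; here; there; any?)
open import Data.List.Relation.Unary.All as All using (All; []; _∷_; all?)
import Data.List.Relation.Unary.All.Properties as All
open import Data.List.Relation.Unary.AllPairs as AllPairs using (AllPairs; []; _∷_; allPairs?)
import Data.List.Relation.Unary.AllPairs.Properties as AllPairs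
open import Data.List.Relation.Unary.Unique.Propositional using (Unique)
open import Data.List.Relation.Unary.Unique.Propositional.Properties using (filter⁺; take⁺; allFin⁺; upTo⁺)
open import Data.List.Relation.Binary.Sublist.Propositional as Sublist using (_⊆_; []; _∷ʳ_; _∷_)
open import Data.List.Relation.Binary.Permutation.Propositional using (_↭_; refl; prep; swap; trans; ↭-sym)
open import Data.List.Relation.Binary.Permutation.Propositional.Properties using (↭-length; shift; All-resp-↭; ∈-resp-↭)
open import Data.Product using (Σ; _×_; _,_; proj₁; proj₂; ∃; ∃₂; uncurry)
open import Data.Product.Properties using (≡-dec)
open import Data.Sum as Sum using (_⊎_; inj₁; inj₂)
open import Function using (_∘_; const; id)
open import Relation.Nullary using (¬_; Dec; yes; no; does; contradiction)
open import Relation.Nullary.Decidable using (¬?; _×-dec_; _⊎-dec_; _→-dec_)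
open import Relation.Unary using (Decidable)
import Relation.Binary as B
open import Relation.Binary using (tri<; tri≈; tri>)
open import Relation.Binary.PropositionalEquality as ≡ using (_≡_; _≢_; cong; cong₂; subst; sym)

-- The hypergraph `G` stays fixed: deleting vertices only shrinks the list `L` over which copies are
-- counted. Heaviness is decided once, with one constant `k`, and a light pair has at most `k * r`
-- covering vertices in whatever list remains.
--
-- Degrees count copies, whereas the structure needs numbers of neighbours. `DegreeBound` is the
-- bridge: in the link of a vertex, a Turán graph with one part fewer, each further vertex creates a
-- fixed fraction of m^(s+1) cliques, so losing e·m^(s+1) copies costs only O(e) neighbours.
--
-- Bad copies number O(m^(s+2)), that is O(m) units of m^(s+1). A scale y with y·y ≥ C·m balances
-- this: at most y vertices lie in more than y units of bad copies. All later errors are linear in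
-- y, and y may be a small fraction of m.
--
-- Zykov's theorem for the heavy graph bounds only copies without light pairs. That the expansion
-- tolerates one light pair is what makes every copy transversal and the final bound exact.
--
-- In the code ℓ is `2 + l` and the cliques counted have `3 + s` vertices.

private variable
  A : Set
  n : ℕ

-- Sums over lists and over sublists of given length

∑ : List A → (A → ℕ) → ℕ
∑ []       f = 0
∑ (x ∷ xs) f = f x + ∑ xs f

module _ {P : Set} where
  ind : Dec P → ℕ
  ind d = if does d then 1 else 0

  ind≤1 : (d : Dec P) → ind d ≤ 1
  ind≤1 (yes _) = ≤-refl
  ind≤1 (no _)  = z≤n

  ind-yes : (d : Dec P) → P → ind d ≡ 1
  ind-yes (yes _) p = ≡.refl
  ind-yes (no ¬p) p = contradiction p ¬p

  ind-no : (d : Dec P) → ¬ P → ind d ≡ 0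
  ind-no (yes p) ¬p = contradiction p ¬p
  ind-no (no _)  ¬p = ≡.refl

  ind-elim : (d : Dec P) {k : ℕ} → (P → 1 ≤ k) → ind d ≤ k
  ind-elim (yes p) h = h p
  ind-elim (no _)  h = z≤n

ind-⇔ : {P Q : Set} (d : Dec P) (e : Dec Q) → (P → Q) → (Q → P) → ind d ≡ ind e
ind-⇔ (yes p) e f g = sym (ind-yes e (f p))
ind-⇔ (no ¬p) e f g = sym (ind-no e (¬p ∘ g))

ind-absorb : {P Q : Set} (d : Dec P) (e : Dec Q) → (P → Q) → ind e * ind d ≡ ind d
ind-absorb (yes p) e f = ≡.trans (*-identityʳ _) (ind-yes e (f p))
ind-absorb (no  _) e f = *-zeroʳ (ind e)

count : {P : A → Set} → Decidable P → List A → ℕ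
count P? xs = ∑ xs (ind ∘ P?)

∑-mono : {f g : A → ℕ} (xs : List A) → (∀ {x} → x ∈ xs → f x ≤ g x) → ∑ xs f ≤ ∑ xs g
∑-mono []       h = z≤n
∑-mono (x ∷ xs) h = +-mono-≤ (h (here ≡.refl)) (∑-mono xs (h ∘ there))

∑-cong : {f g : A → ℕ} (xs : List A) → (∀ {x} → x ∈ xs → f x ≡ g x) → ∑ xs f ≡ ∑ xs g
∑-cong []       h = ≡.refl
∑-cong (x ∷ xs) h = cong₂ _+_ (h (here ≡.refl)) (∑-cong xs (h ∘ there))

+-interchange : ∀ a b c d → (a + b) + (c + d) ≡ (a + c) + (b + d)
+-interchange a b c d = begin
  (a + b) + (c + d) ≡⟨ +-assoc a b (c + d) ⟩
  a + (b + (c + d)) ≡⟨ cong (a +_) (+-comm b (c + d)) ⟩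
  a + ((c + d) + b) ≡⟨ cong (a +_) (+-assoc c d b) ⟩
  a + (c + (d + b)) ≡⟨ +-assoc a c (d + b) ⟨
  (a + c) + (d + b) ≡⟨ cong (a + c +_) (+-comm d b) ⟩
  (a + c) + (b + d) ∎
  where open ≡.≡-Reasoning

∑-+ : (xs : List A) (f g : A → ℕ) → ∑ xs (λ x → f x + g x) ≡ ∑ xs f + ∑ xs g
∑-+ []       f g = ≡.refl
∑-+ (x ∷ xs) f g = ≡.trans (cong (f x + g x +_) (∑-+ xs f g)) (+-interchange (f x) (g x) (∑ xs f) (∑ xs g))

∑-const : (xs : List A) (c : ℕ) → ∑ xs (const c) ≡ length xs * c
∑-const []       c = ≡.refl
∑-const (x ∷ xs) c = cong (c +_) (∑-const xs c)

∑-*ʳ : (xs : List A) (f : A → ℕ) (c : ℕ) → ∑ xs (λ x → f x * c) ≡ ∑ xs f * c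
∑-*ʳ []       f c = ≡.refl
∑-*ʳ (x ∷ xs) f c = ≡.trans (cong (f x * c +_) (∑-*ʳ xs f c)) (sym (*-distribʳ-+ c (f x) (∑ xs f)))

∑-swap : {B : Set} (xs : List A) (ys : List B) (f : A → B → ℕ) →
  ∑ xs (λ x → ∑ ys (f x)) ≡ ∑ ys (λ y → ∑ xs (λ x → f x y))
∑-swap []       ys f = sym (≡.trans (∑-const ys 0) (*-zeroʳ (length ys)))
∑-swap (x ∷ xs) ys f = ≡.trans (cong (∑ ys (f x) +_) (∑-swap xs ys f))
                               (sym (∑-+ ys (f x) (λ y → ∑ xs (λ x′ → f x′ y))))

∑-∈ : {xs : List A} {x : A} (f : A → ℕ) → x ∈ xs → f x ≤ ∑ xs f
∑-∈ {xs = _ ∷ xs} f (here ≡.refl) = m≤m+n _ _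
∑-∈ {xs = y ∷ xs} f (there p)     = ≤-trans (∑-∈ f p) (m≤n+m _ (f y))

∑-↭ : {xs ys : List A} (f : A → ℕ) → xs ↭ ys → ∑ xs f ≡ ∑ ys f
∑-↭ f refl        = ≡.refl
∑-↭ f (prep x p)  = cong (f x +_) (∑-↭ f p)
∑-↭ f (swap {xs = xs} {ys} x y p) = begin
  f x + (f y + ∑ xs f) ≡⟨ +-assoc (f x) (f y) _ ⟨
  f x + f y + ∑ xs f   ≡⟨ cong₂ _+_ (+-comm (f x) (f y)) (∑-↭ f p) ⟩
  f y + f x + ∑ ys f   ≡⟨ +-assoc (f y) (f x) _ ⟩
  f y + (f x + ∑ ys f) ∎
  where open ≡.≡-Reasoning
∑-↭ f (trans p q) = ≡.trans (∑-↭ f p) (∑-↭ f q)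

∑-map : {B : Set} (g : A → B) (xs : List A) (f : B → ℕ) → ∑ (map g xs) f ≡ ∑ xs (f ∘ g)
∑-map g []       f = ≡.refl
∑-map g (x ∷ xs) f = cong (f (g x) +_) (∑-map g xs f)

module _ {P : A → Set} (P? : Decidable P) where

  length-filter≡count : ∀ xs → length (filter P? xs) ≡ count P? xs
  length-filter≡count []       = ≡.refl
  length-filter≡count (x ∷ xs) with P? x
  ... | yes _ = cong suc (length-filter≡count xs)
  ... | no  _ = length-filter≡count xs

  ∑-filter : ∀ xs (f : A → ℕ) → ∑ (filter P? xs) f ≡ ∑ xs (λ x → ind (P? x) * f x)
  ∑-filter []       f = ≡.refl
  ∑-filter (x ∷ xs) f with P? x
  ... | yes _ = cong₂ _+_ (sym (+-identityʳ (f x))) (∑-filter xs f)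
  ... | no  _ = ∑-filter xs f

  count-filter≤ : ∀ {Q : A → Set} (Q? : Decidable Q) xs → count Q? (filter P? xs) ≤ count Q? xs
  count-filter≤ Q? xs = ≤-trans (≤-reflexive (∑-filter xs (ind ∘ Q?)))
    (∑-mono xs λ {x} _ → ≤-trans (*-monoˡ-≤ (ind (Q? x)) (ind≤1 (P? x))) (≤-reflexive (*-identityˡ _)))

  count-compl : ∀ xs → count P? xs + count (¬? ∘ P?) xs ≡ length xs
  count-compl []       = ≡.refl
  count-compl (x ∷ xs) with P? x
  ... | yes _ = cong suc (count-compl xs)
  ... | no  _ = ≡.trans (+-suc _ _) (cong suc (count-compl xs))

  count-all : ∀ xs → (∀ {x} → x ∈ xs → P x) → count P? xs ≡ length xs
  count-all xs h = ≡.trans (∑-cong xs λ {x} x∈ → ind-yes (P? x) (h x∈)) (≡.trans (∑-const xs 1) (*-identityʳ _))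

  count<length⇒∃ : ∀ xs → count P? xs < length xs → ∃ λ x → x ∈ xs × ¬ P x
  count<length⇒∃ xs lt with any? (¬? ∘ P?) xs
  ... | yes a = let x , x∈ , ¬p = find a in x , x∈ , ¬p
  ... | no ¬a = contradiction (count-all xs λ {x} x∈ → all x∈) (<⇒≢ lt)
    where
    all : ∀ {x} → x ∈ xs → P x
    all {x} x∈ with P? x
    ... | yes p = p
    ... | no ¬p = contradiction (lose x∈ ¬p) ¬a

∈⇒↭ : {x : A} {xs : List A} → x ∈ xs → ∃ λ ys → xs ↭ x ∷ ys
∈⇒↭ x∈ with ∈-∃++ x∈
... | as , bs , ≡.refl = as ++ bs , shift _ as bs

-- Sets are represented as sublists because splitting on the head is deletion of a vertex: the sets
-- avoiding `v`, plus the sets through `v`.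
subsum : ℕ → List A → (List A → ℕ) → ℕ
subsum zero    L       f = f []
subsum (suc s) []      f = 0
subsum (suc s) (v ∷ L) f = subsum (suc s) L f + subsum s L (λ S → f (v ∷ S))

subsum-mono : ∀ s (L : List A) {f g : List A → ℕ} →
  (∀ {S} → S ⊆ L → length S ≡ s → f S ≤ g S) → subsum s L f ≤ subsum s L g
subsum-mono zero    L       h = h (Sublist.minimum L) ≡.refl
subsum-mono (suc s) []      h = z≤n
subsum-mono (suc s) (v ∷ L) h = +-mono-≤
  (subsum-mono (suc s) L (λ p → h (v ∷ʳ p)))
  (subsum-mono s L (λ p eq → h (≡.refl ∷ p) (cong suc eq)))

subsum-cong : ∀ s (L : List A) {f g : List A → ℕ} →
  (∀ {S} → S ⊆ L → length S ≡ s → f S ≡ g S) → subsum s L f ≡ subsum s L g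
subsum-cong s L h = ≤-antisym
  (subsum-mono s L λ p q → ≤-reflexive (h p q)) (subsum-mono s L λ p q → ≤-reflexive (sym (h p q)))

subsum-+ : ∀ s (L : List A) (f g : List A → ℕ) →
  subsum s L (λ S → f S + g S) ≡ subsum s L f + subsum s L g
subsum-+ zero    L       f g = ≡.refl
subsum-+ (suc s) []      f g = ≡.refl
subsum-+ (suc s) (v ∷ L) f g = ≡.trans
  (cong₂ _+_ (subsum-+ (suc s) L f g) (subsum-+ s L (f ∘ (v ∷_)) (g ∘ (v ∷_))))
  (+-interchange (subsum (suc s) L f) _ _ _)

subsum-*ˡ : ∀ s (L : List A) (c : ℕ) (f : List A → ℕ) →
  subsum s L (λ S → c * f S) ≡ c * subsum s L f
subsum-*ˡ zero    L       c f = ≡.refl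
subsum-*ˡ (suc s) []      c f = sym (*-zeroʳ c)
subsum-*ˡ (suc s) (v ∷ L) c f = ≡.trans
  (cong₂ _+_ (subsum-*ˡ (suc s) L c f) (subsum-*ˡ s L c (f ∘ (v ∷_))))
  (sym (*-distribˡ-+ c _ _))

-- Lets any chosen vertex be moved to the front of the list and split off.
subsum-↭ : ∀ s {L L′ : List A} {f : List A → ℕ} → (∀ {S S′} → S ↭ S′ → f S ≡ f S′) →
  L ↭ L′ → subsum s L f ≡ subsum s L′ f
subsum-↭ zero    inv p          = ≡.refl
subsum-↭ (suc s) inv refl       = ≡.refl
subsum-↭ (suc s) inv (prep x p) = cong₂ _+_ (subsum-↭ (suc s) inv p) (subsum-↭ s (inv ∘ prep x) p)
-- With a single element to choose, no sublist contains both `x` and `y`.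
subsum-↭ (suc zero) {f = f} inv (swap {xs = xs} {ys} x y p) = begin
  subsum 1 xs f + f (y ∷ []) + f (x ∷ [])   ≡⟨ +-assoc (subsum 1 xs f) _ _ ⟩
  subsum 1 xs f + (f (y ∷ []) + f (x ∷ [])) ≡⟨ cong₂ _+_ (subsum-↭ 1 inv p) (+-comm (f (y ∷ [])) _) ⟩
  subsum 1 ys f + (f (x ∷ []) + f (y ∷ [])) ≡⟨ +-assoc (subsum 1 ys f) _ _ ⟨
  subsum 1 ys f + f (x ∷ []) + f (y ∷ [])   ∎
  where open ≡.≡-Reasoning
subsum-↭ (suc (suc s)) {f = f} inv (swap {xs = xs} {ys} x y p) = begin
  (a xs + b y xs) + (b x xs + c x y xs) ≡⟨ +-interchange (a xs) _ _ _ ⟩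
  (a xs + b x xs) + (b y xs + c x y xs) ≡⟨ cong₂ _+_
       (cong₂ _+_ (subsum-↭ (suc (suc s)) inv p) (subsum-↭ (suc s) (inv ∘ prep x) p))
       (cong₂ _+_ (subsum-↭ (suc s) (inv ∘ prep y) p)
         (≡.trans (subsum-↭ s (inv ∘ prep x ∘ prep y) p)
                  (subsum-cong s ys λ _ _ → inv (swap x y refl)))) ⟩
  (a ys + b x ys) + (b y ys + c y x ys) ∎
  where
  open ≡.≡-Reasoning
  a = λ L → subsum (suc (suc s)) L f
  b = λ u L → subsum (suc s) L (f ∘ (u ∷_))
  c = λ u w L → subsum s L (λ S → f (u ∷ w ∷ S))
subsum-↭ (suc s) inv (trans p q) = ≡.trans (subsum-↭ (suc s) inv p) (subsum-↭ (suc s) inv q)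

subsum-1≤^ : ∀ s (L : List A) → subsum s L (const 1) ≤ length L ^ s
subsum-1≤^ zero    L       = ≤-refl
subsum-1≤^ (suc s) []      = z≤n
subsum-1≤^ (suc s) (v ∷ L) = begin
  subsum (suc s) L (const 1) + subsum s L (const 1) ≤⟨ +-mono-≤ (subsum-1≤^ (suc s) L) (subsum-1≤^ s L) ⟩
  m * m ^ s + m ^ s                                 ≡⟨ +-comm (m * m ^ s) _ ⟩
  suc m * m ^ s                                     ≤⟨ *-monoʳ-≤ (suc m) (^-monoˡ-≤ s (n≤1+n m)) ⟩
  suc m * suc m ^ s                                 ∎
  where
  open ≤-Reasoning
  m = length L

module _ {P : A → Set} (P? : Decidable P) where

  subsum-filter : ∀ s L (f : List A → ℕ) →
    subsum s (filter P? L) f ≡ subsum s L (λ S → ind (all? P? S) * f S)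
  subsum-filter zero    L       f = sym (+-identityʳ _)
  subsum-filter (suc s) []      f = ≡.refl
  subsum-filter (suc s) (v ∷ L) f with P? v
  ... | yes p = cong₂ _+_ (subsum-filter (suc s) L f) (subsum-filter s L (f ∘ (v ∷_)))
  ... | no ¬p = ≡.trans (subsum-filter (suc s) L f) (≡.trans (sym (+-identityʳ _))
        (cong (subsum (suc s) L (λ S → ind (all? P? S) * f S) +_) (sym (subsum-*ˡ s L 0 (λ _ → 0)))))

picks : List A → List (A × List A)
picks []      = []
picks (v ∷ L) = (v , L) ∷ map (λ (u , M) → u , v ∷ M) (picks L)

∑-picks-fst : (L : List A) (f : A → ℕ) → ∑ (picks L) (f ∘ proj₁) ≡ ∑ L f
∑-picks-fst []      f = ≡.refl
∑-picks-fst (v ∷ L) f = cong (f v +_) (≡.trans (∑-map _ (picks L) (f ∘ proj₁)) (∑-picks-fst L f))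

length-picks : (L : List A) → length (picks L) ≡ length L
length-picks L = ≡.trans (≡.trans (sym (*-identityʳ _)) (sym (∑-const (picks L) 1)))
  (≡.trans (∑-picks-fst L (const 1)) (≡.trans (∑-const L 1) (*-identityʳ _)))

picks-↭ : {L M : List A} {u : A} → (u , M) ∈ picks L → L ↭ u ∷ M
picks-↭ {L = v ∷ L} (here ≡.refl) = refl
picks-↭ {L = v ∷ L} (there p) with ∈-map⁻ _ p
... | (u , M) , q , ≡.refl = trans (prep v (picks-↭ q)) (swap v u refl)

∈-picks : {L : List A} {u : A} → u ∈ L → ∃ λ M → (u , M) ∈ picks L
∈-picks {L = v ∷ L} (here ≡.refl) = L , here ≡.refl
∈-picks {L = v ∷ L} (there p) = let M , q = ∈-picks p in
  v ∷ M , there (∈-map⁺ _ q)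

-- Double counting of pairs (S, u) with u ∈ S.
subsum-picks : ∀ s (L : List A) (h : A → List A → ℕ) →
  subsum (suc s) L (λ S → ∑ (picks S) (uncurry h)) ≡ ∑ (picks L) (λ (u , M) → subsum s M (h u))
subsum-picks s []      h = ≡.refl
subsum-picks s (v ∷ L) h = begin
  subsum (suc s) L H + subsum s L (λ S → h v S + ∑ (map (λ (u , M) → u , v ∷ M) (picks S)) (uncurry h))
    ≡⟨ cong₂ _+_ (subsum-picks s L h) (≡.trans (subsum-+ s L _ _) (cong (subsum s L (h v) +_)
         (≡.trans (subsum-cong s L λ {S} _ _ → ∑-map _ (picks S) (uncurry h)) (lem s)))) ⟩
  R1 + (subsum s L (h v) + R2 s)
    ≡⟨ ≡.trans (sym (+-assoc R1 _ _)) (≡.trans (cong (_+ R2 s) (+-comm R1 _)) (+-assoc (subsum s L (h v)) R1 _)) ⟩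
  subsum s L (h v) + (R1 + R2 s)
    ≡⟨ cong (subsum s L (h v) +_) (≡.trans (lem₂ s) (sym (∑-map _ (picks L) (λ (u , M) → subsum s M (h u))))) ⟩
  subsum s L (h v) + ∑ (map (λ (u , M) → u , v ∷ M) (picks L)) (λ (u , M) → subsum s M (h u)) ∎
  where
  open ≡.≡-Reasoning
  H  = λ S → ∑ (picks S) (uncurry h)
  R1 = ∑ (picks L) (λ (u , M) → subsum s M (h u))
  R2 : ℕ → ℕ
  R2 zero    = 0
  R2 (suc s) = ∑ (picks L) (λ (u , M) → subsum s M (λ S → h u (v ∷ S)))
  lem : ∀ s → subsum s L (λ S → ∑ (picks S) (λ (u , M) → h u (v ∷ M))) ≡ R2 s
  lem zero    = ≡.refl
  lem (suc s) = subsum-picks s L (λ u M → h u (v ∷ M))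
  lem₂ : ∀ s → ∑ (picks L) (λ (u , M) → subsum s M (h u)) + R2 s ≡ ∑ (picks L) (λ (u , M) → subsum s (v ∷ M) (h u))
  lem₂ zero    = +-identityʳ _
  lem₂ (suc s) = sym (∑-+ (picks L) _ _)

AllPairs-resp-↭ : {R : A → A → Set} → (∀ {x y} → R x y → R y x) →
  {xs ys : List A} → xs ↭ ys → AllPairs R xs → AllPairs R ys
AllPairs-resp-↭ s refl        ps                       = ps
AllPairs-resp-↭ s (prep x p)  (q ∷ ps)                 = All-resp-↭ p q ∷ AllPairs-resp-↭ s p ps
AllPairs-resp-↭ s (swap x y p) ((xy ∷ qx) ∷ qy ∷ ps)   =
  (s xy ∷ All-resp-↭ p qy) ∷ All-resp-↭ p qx ∷ AllPairs-resp-↭ s p ps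
AllPairs-resp-↭ s (trans p q) ps                       = AllPairs-resp-↭ s q (AllPairs-resp-↭ s p ps)

Unique-resp-↭ : {xs ys : List A} → xs ↭ ys → Unique xs → Unique ys
Unique-resp-↭ = AllPairs-resp-↭ (_∘ sym)

count≤1 : {P : A → Set} (P? : Decidable P) (xs : List A) →
  AllPairs (λ x y → ¬ (P x × P y)) xs → count P? xs ≤ 1
count≤1 P? []       []         = z≤n
count≤1 P? (x ∷ xs) (h ∷ hs) with P? x
... | no  _ = count≤1 P? xs hs
... | yes p = ≤-reflexive (cong suc (≡.trans
        (∑-cong xs λ {y} y∈ → ind-no (P? y) λ q → All.lookup h y∈ (p , q))
        (≡.trans (∑-const xs 0) (*-zeroʳ (length xs)))))

count>0⇒∃ : {P : A → Set} (P? : Decidable P) (xs : List A) → 0 < count P? xs → ∃ λ x → x ∈ xs × P x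
count>0⇒∃ P? (x ∷ xs) lt with P? x
... | yes p = x , here ≡.refl , p
... | no  _ = let y , y∈ , p = count>0⇒∃ P? xs lt in y , there y∈ , p

∈⇒count>0 : {P : A → Set} (P? : Decidable P) {xs : List A} {x : A} → x ∈ xs → P x → 0 < count P? xs
∈⇒count>0 P? {xs} {x} x∈ p = ≤-trans (≤-reflexive (sym (ind-yes (P? x) p))) (∑-∈ (ind ∘ P?) x∈)

∑-++ : (xs ys : List A) (f : A → ℕ) → ∑ (xs ++ ys) f ≡ ∑ xs f + ∑ ys f
∑-++ []       ys f = ≡.refl
∑-++ (x ∷ xs) ys f = ≡.trans (cong (f x +_) (∑-++ xs ys f)) (sym (+-assoc (f x) (∑ xs f) (∑ ys f)))

subsum-map : {B : Set} (g : A → B) → ∀ s (L : List A) (f : List B → ℕ) →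
  subsum s (map g L) f ≡ subsum s L (f ∘ map g)
subsum-map g zero    L       f = ≡.refl
subsum-map g (suc s) []      f = ≡.refl
subsum-map g (suc s) (v ∷ L) f = cong₂ _+_ (subsum-map g (suc s) L f) (subsum-map g s L (f ∘ (g v ∷_)))

1≤ind : {P : Set} (d : Dec P) → P → 1 ≤ ind d
1≤ind d p = ≤-reflexive (sym (ind-yes d p))

count-mono : {P Q : A → Set} (P? : Decidable P) (Q? : Decidable Q) (L : List A) →
  (∀ {u} → u ∈ L → P u → Q u) → count P? L ≤ count Q? L
count-mono P? Q? L h = ∑-mono L λ {u} u∈ → ind-elim (P? u) (1≤ind (Q? u) ∘ h u∈)

count-⊎ : {P Q R : A → Set} (P? : Decidable P) (Q? : Decidable Q) (R? : Decidable R) (L : List A) →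
  (∀ {u} → u ∈ L → P u → Q u ⊎ R u) → count P? L ≤ count Q? L + count R? L
count-⊎ P? Q? R? L h = ≤-trans
  (∑-mono L λ {u} u∈ → ind-elim (P? u) λ p → split u (h u∈ p))
  (≤-reflexive (∑-+ L (ind ∘ Q?) (ind ∘ R?)))
  where
  split : ∀ u → _ ⊎ _ → 1 ≤ ind (Q? u) + ind (R? u)
  split u (inj₁ q) = ≤-trans (1≤ind (Q? u) q) (m≤m+n _ _)
  split u (inj₂ r) = ≤-trans (1≤ind (R? u) r) (m≤n+m _ _)

count-disjoint : {P Q R : A → Set} (P? : Decidable P) (Q? : Decidable Q) (R? : Decidable R) (L : List A) →
  (∀ {u} → u ∈ L → P u → R u) → (∀ {u} → u ∈ L → Q u → R u) → (∀ {u} → u ∈ L → P u → ¬ Q u) →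
  count P? L + count Q? L ≤ count R? L
count-disjoint P? Q? R? L hp hq dis = ≤-trans (≤-reflexive (sym (∑-+ L (ind ∘ P?) (ind ∘ Q?))))
  (∑-mono L λ {u} u∈ → pt u∈ (P? u) (Q? u))
  where
  pt : ∀ {u} → u ∈ L → (p : Dec _) (q : Dec _) → ind p + ind q ≤ ind (R? u)
  pt {u} u∈ (yes p) (yes q) = contradiction q (dis u∈ p)
  pt {u} u∈ (yes p) (no _)  = 1≤ind (R? u) (hp u∈ p)
  pt {u} u∈ (no _)  (yes q) = 1≤ind (R? u) (hq u∈ q)
  pt {u} u∈ (no _)  (no _)  = z≤n

count-filter-mono : {P Q R : A → Set} (P? : Decidable P) (Q? : Decidable Q) (R? : Decidable R) (L : List A) →
  (∀ {u} → P u → Q u → R u) → count Q? (filter P? L) ≤ count R? L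
count-filter-mono P? Q? R? L h = ≤-trans
  (≤-reflexive (∑-filter P? L (ind ∘ Q?)))
  (∑-mono L λ {u} _ → pt u (P? u) (Q? u))
  where
  pt : ∀ u → (p : Dec _) (q : Dec _) → ind p * ind q ≤ ind (R? u)
  pt u (yes p) (yes q) = 1≤ind (R? u) (h p q)
  pt u (yes p) (no _)  = z≤n
  pt u (no _)  _       = z≤n

unique⇒AllPairs : {R : A → A → Set} (xs : List A) → Unique xs →
  (∀ {x y} → x ∈ xs → y ∈ xs → x ≢ y → R x y) → AllPairs R xs
unique⇒AllPairs []       []       h = []
unique⇒AllPairs (x ∷ xs) (x∉ ∷ u) h =
  All.tabulate (λ y∈ → h (here ≡.refl) (there y∈) (All.lookup x∉ y∈)) ∷
  unique⇒AllPairs xs u (λ p q → h (there p) (there q))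

-- Cliques in graphs without large cliques

-- The number of s-cliques of the ℓ-partite Turán graph on n vertices: the
-- (n+1)-st vertex is joined to all but ⌊n/ℓ⌋ of the others, and these span
-- an (ℓ-1)-partite Turán graph.
τ : ℕ → ℕ → ℕ → ℕ
τ ℓ       zero    n       = 1
τ zero    (suc s) n       = 0
τ (suc ℓ) (suc s) zero    = 0
τ (suc ℓ) (suc s) (suc n) = τ (suc ℓ) (suc s) n + τ ℓ s (n ∸ n / suc ℓ)

τ-mono : ∀ ℓ s {m n} → m ≤ n → τ ℓ s m ≤ τ ℓ s n
τ-mono ℓ s m≤n = go (≤⇒≤′ m≤n)
  where
  step : ∀ ℓ s n → τ ℓ s n ≤ τ ℓ s (suc n)
  step ℓ       zero    n = ≤-refl
  step zero    (suc s) n = ≤-refl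
  step (suc ℓ) (suc s) n = m≤m+n _ _
  go : ∀ {m n} → m ≤′ n → τ ℓ s m ≤ τ ℓ s n
  go (≤′-reflexive ≡.refl) = ≤-refl
  go (≤′-step p) = ≤-trans (go p) (step ℓ s _)

half≤ : ∀ {ℓ} x → 1 ≤ ℓ → x ≤ 2 * (x ∸ x / suc ℓ)
half≤ {ℓ} x 1≤ℓ = begin
  x                      ≡⟨ m+n∸n≡m x (2 * q) ⟨
  x + 2 * q ∸ 2 * q      ≤⟨ ∸-monoˡ-≤ (2 * q) (+-monoʳ-≤ x 2q≤x) ⟩
  x + x ∸ 2 * q          ≡⟨ cong (λ z → x + z ∸ 2 * q) (+-identityʳ x) ⟨
  2 * x ∸ 2 * q          ≡⟨ *-distribˡ-∸ 2 x q ⟨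
  2 * (x ∸ q)            ∎
  where
  open ≤-Reasoning
  q = x / suc ℓ
  2q≤x : 2 * q ≤ x
  2q≤x = ≤-trans (*-monoˡ-≤ q (s≤s 1≤ℓ)) (≤-trans (≤-reflexive (*-comm (suc ℓ) q)) (m/n*n≤m x (suc ℓ)))

mutual
  -- Each of the last `Y` vertices brings at least Y^s cliques. Of the factor 4, one 2 covers the
  -- halving in `τ-gain` and the other leaves room for these `Y` vertices.
  τ-lower : ∀ ℓ s Y x → s ≤ ℓ → 4 ^ s * Y ≤ x → Y ^ s ≤ τ ℓ s x
  τ-lower ℓ       zero    Y x _       _ = ≤-refl
  τ-lower (suc ℓ) (suc s) Y x (s≤s h) le = begin
    Y * Y ^ s                                ≤⟨ m≤n+m _ _ ⟩
    τ (suc ℓ) (suc s) (x ∸ Y) + Y * Y ^ s    ≤⟨ τ-gain ℓ s Y (x ∸ Y) Y h le′ ⟩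
    τ (suc ℓ) (suc s) (x ∸ Y + Y)
      ≡⟨ cong (τ (suc ℓ) (suc s)) (m∸n+n≡m (≤-trans (m≤n*m Y (4 ^ suc s) {{m^n≢0 4 (suc s)}}) le)) ⟩
    τ (suc ℓ) (suc s) x                      ∎
    where
    open ≤-Reasoning
    c = 4 ^ s * Y
    Y≤c : Y ≤ c
    Y≤c = m≤n*m Y (4 ^ s) {{m^n≢0 4 s}}
    le′ : 2 * c ≤ x ∸ Y
    le′ = m+n≤o⇒m≤o∸n (2 * c) (begin
      2 * c + Y       ≤⟨ +-monoʳ-≤ (2 * c) (≤-trans Y≤c (m≤m+n c _)) ⟩
      2 * c + 2 * c   ≡⟨ *-distribʳ-+ c 2 2 ⟨
      4 * c           ≡⟨ *-assoc 4 (4 ^ s) Y ⟨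
      4 ^ suc s * Y   ≤⟨ le ⟩
      x               ∎)

  -- Each new vertex is joined to at least half of the earlier ones, hence to 4^s·Y of them, and
  -- `τ-lower` applies inside this neighbourhood.
  τ-gain : ∀ ℓ s Y x g → s ≤ ℓ → 2 * (4 ^ s * Y) ≤ x →
    τ (suc ℓ) (suc s) x + g * Y ^ s ≤ τ (suc ℓ) (suc s) (x + g)
  τ-gain ℓ s Y x zero    h le = ≤-reflexive (≡.trans (+-identityʳ _) (cong (τ (suc ℓ) (suc s)) (sym (+-identityʳ x))))
  τ-gain ℓ s Y x (suc g) h le = begin
    τ (suc ℓ) (suc s) x + (Y ^ s + g * Y ^ s)
      ≡⟨ cong (τ (suc ℓ) (suc s) x +_) (+-comm (Y ^ s) _) ⟩
    τ (suc ℓ) (suc s) x + (g * Y ^ s + Y ^ s)              ≡⟨ +-assoc (τ (suc ℓ) (suc s) x) _ _ ⟨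
    τ (suc ℓ) (suc s) x + g * Y ^ s + Y ^ s
      ≤⟨ +-mono-≤ (τ-gain ℓ s Y x g h le) (inc ℓ s h le) ⟩
    τ (suc ℓ) (suc s) (suc (x + g))                        ≡⟨ cong (τ (suc ℓ) (suc s)) (+-suc x g) ⟨
    τ (suc ℓ) (suc s) (x + suc g)                          ∎
    where
    open ≤-Reasoning
    inc : ∀ ℓ s → s ≤ ℓ → 2 * (4 ^ s * Y) ≤ x → Y ^ s ≤ τ ℓ s (x + g ∸ (x + g) / suc ℓ)
    -- With a single part the halving fails, but then `s` is zero and only the empty clique is
    -- counted.
    inc zero    zero    _ _  = ≤-refl
    inc (suc ℓ) s       h le = τ-lower (suc ℓ) s Y _ h
      (*-cancelˡ-≤ 2 (≤-trans le (≤-trans (m≤m+n x g) (half≤ (x + g) (s≤s z≤n)))))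

module CliqueCounting {E : A → A → Set} (E? : B.Decidable E)
  (E-sym : ∀ {u v} → E u v → E v u) (E-irrefl : ∀ {u} → ¬ E u u) where

  -- A listed vertex counts among its own non-neighbours, so in a complete multipartite graph this
  -- is the size of its part.
  non-nbrs : A → List A → ℕ
  non-nbrs u = count (¬? ∘ E? u)

  CliqueFree : ℕ → List A → Set
  CliqueFree ℓ L = ∀ S → All (_∈ L) S → AllPairs E S → length S ≢ suc ℓ

  length-nbrs : ∀ u L → length (filter (E? u) L) + non-nbrs u L ≡ length L
  length-nbrs u L = ≡.trans (cong (_+ non-nbrs u L) (length-filter≡count (E? u) L)) (count-compl (E? u) L)

  -- Each choice discards at most `t` candidates, the chosen vertex included, so `k` choices leave a
  -- candidate for the last one.
  greedy-clique : ∀ k t L → (∀ {v} → v ∈ L → non-nbrs v L ≤ t) → k * t < length L →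
    ∃ λ S → All (_∈ L) S × AllPairs E S × length S ≡ suc k
  greedy-clique k       t []      h ()
  greedy-clique zero    t (v ∷ L) h lt = v ∷ [] , here ≡.refl ∷ [] , [] ∷ [] , ≡.refl
  greedy-clique (suc k) t M@(v ∷ L) h lt =
    let S , S⊆ , cl , eq = greedy-clique k t N h′ lt′ in
    v ∷ S , here ≡.refl ∷ All.map (proj₁ ∘ ∈-filter⁻ (E? v)) S⊆ ,
    All.map (proj₂ ∘ ∈-filter⁻ (E? v) {xs = M}) S⊆ ∷ cl , cong suc eq
    where
    N = filter (E? v) M
    h′ : ∀ {u} → u ∈ N → non-nbrs u N ≤ t
    h′ {u} u∈ = ≤-trans (count-filter≤ (E? v) (¬? ∘ E? u) M) (h (proj₁ (∈-filter⁻ (E? v) u∈)))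
    lt′ : k * t < length N
    lt′ = +-cancelˡ-< t (k * t) (length N) (begin-strict
      t + k * t                   <⟨ lt ⟩
      length M                    ≡⟨ length-nbrs v M ⟨
      length N + non-nbrs v M     ≤⟨ +-monoʳ-≤ (length N) (h (here ≡.refl)) ⟩
      length N + t                ≡⟨ +-comm (length N) t ⟩
      t + length N                ∎)
      where open ≤-Reasoning

  -- Otherwise `greedy-clique` yields ℓ + 2 vertices, because (ℓ + 1)·⌊n/(ℓ + 1)⌋ < n + 1.
  low-degree : ∀ ℓ n L → CliqueFree (suc ℓ) L → length L ≡ suc n →
    ∃ λ v → v ∈ L × n / suc ℓ < non-nbrs v L
  low-degree ℓ n L free eq with any? (λ v → n / suc ℓ <? non-nbrs v L) L
  ... | yes a = find a
  ... | no ¬a = contradiction eq′ (free S S⊆ cl)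
    where
    all : ∀ {v} → v ∈ L → non-nbrs v L ≤ n / suc ℓ
    all v∈ = ≮⇒≥ λ lt → ¬a (lose v∈ lt)
    cliq = greedy-clique (suc ℓ) (n / suc ℓ) L all
      (subst (suc ℓ * (n / suc ℓ) <_) (sym eq) (s≤s (≤-trans (≤-reflexive (*-comm (suc ℓ) _)) (m/n*n≤m n (suc ℓ)))))
    S   = proj₁ cliq
    S⊆  = proj₁ (proj₂ cliq)
    cl  = proj₁ (proj₂ (proj₂ cliq))
    eq′ = proj₂ (proj₂ (proj₂ cliq))

  isClique : List A → ℕ
  isClique S = ind (allPairs? E? S)

  isClique-↭ : ∀ {S S′} → S ↭ S′ → isClique S ≡ isClique S′
  isClique-↭ {S} {S′} p = ind-⇔ (allPairs? E? S) (allPairs? E? S′)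
    (AllPairs-resp-↭ E-sym p) (AllPairs-resp-↭ E-sym (↭-sym p))

  isClique-∷ : ∀ v S → isClique (v ∷ S) ≡ ind (all? (E? v) S) * isClique S
  isClique-∷ v S with all? (E? v) S
  ... | yes _ = sym (+-identityʳ _)
  ... | no  _ = ≡.refl

  subsum-clique-∷ : ∀ s v L → subsum s L (isClique ∘ (v ∷_)) ≡ subsum s (filter (E? v) L) isClique
  subsum-clique-∷ s v L = ≡.trans (subsum-cong s L λ {S} _ _ → isClique-∷ v S) (sym (subsum-filter (E? v) s L isClique))

  -- Deleting a vertex of low degree reproduces the recursion of `τ`: the cliques through it live in
  -- its neighbourhood, which is small and admits one clique vertex fewer.
  zykov′ : ∀ ℓ s n L → length L ≡ n → CliqueFree ℓ L → subsum s L isClique ≤ τ ℓ s n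
  zykov′ ℓ       zero    n       L       eq free = ≤-refl
  zykov′ zero    (suc s) n       []      eq free = z≤n
  zykov′ zero    (suc s) n       (v ∷ L) eq free = contradiction ≡.refl (free (v ∷ []) (here ≡.refl ∷ []) ([] ∷ []))
  zykov′ (suc ℓ) (suc s) zero    []      eq free = z≤n
  zykov′ (suc ℓ) (suc s) (suc n) L       eq free = begin
    subsum (suc s) L isClique
      ≡⟨ subsum-↭ (suc s) isClique-↭ L↭ ⟩
    subsum (suc s) L′ isClique + subsum s L′ (isClique ∘ (v ∷_))
      ≡⟨ cong (subsum (suc s) L′ isClique +_) (subsum-clique-∷ s v L′) ⟩
    subsum (suc s) L′ isClique + subsum s N isClique
      ≤⟨ +-mono-≤ (zykov′ (suc ℓ) (suc s) n L′ eq′ free′) (zykov′ ℓ s (length N) N ≡.refl freeN) ⟩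
    τ (suc ℓ) (suc s) n + τ ℓ s (length N)
      ≤⟨ +-monoʳ-≤ (τ (suc ℓ) (suc s) n) (τ-mono ℓ s N≤) ⟩
    τ (suc ℓ) (suc s) n + τ ℓ s (n ∸ n / suc ℓ) ∎
    where
    open ≤-Reasoning
    low = low-degree ℓ n L free eq
    v   = proj₁ low
    L′  = proj₁ (∈⇒↭ (proj₁ (proj₂ low)))
    L↭  = proj₂ (∈⇒↭ (proj₁ (proj₂ low)))
    N   = filter (E? v) L′
    eq′ : length L′ ≡ n
    eq′ = suc-injective (≡.trans (sym (↭-length L↭)) eq)
    free′ : CliqueFree (suc ℓ) L′
    free′ S S⊆ = free S (All.map (λ p → ∈-resp-↭ (↭-sym L↭) (there p)) S⊆)
    freeN : CliqueFree ℓ N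
    freeN S S⊆ cl eqS = free (v ∷ S)
      (proj₁ (proj₂ low) ∷ All.map (λ p → ∈-resp-↭ (↭-sym L↭) (there (proj₁ (∈-filter⁻ (E? v) p)))) S⊆)
      (All.map (λ p → proj₂ (∈-filter⁻ (E? v) {xs = L′} p)) S⊆ ∷ cl) (cong suc eqS)
    -- The strict inequality in `low-degree` pays for `v`, which counts itself in `L` and is gone
    -- from `L′`.
    nn : n / suc ℓ ≤ non-nbrs v L′
    nn = s≤s⁻¹ (≤-trans (proj₂ (proj₂ low)) (≤-reflexive (≡.trans (∑-↭ (ind ∘ ¬? ∘ E? v) L↭)
           (cong (_+ non-nbrs v L′) (ind-yes (¬? (E? v v)) E-irrefl)))))
    N≤ : length N ≤ n ∸ n / suc ℓ
    N≤ = m+n≤o⇒m≤o∸n (length N) (≤-trans (+-monoʳ-≤ (length N) nn)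
           (≤-reflexive (≡.trans (length-nbrs v L′) eq′)))

  zykov : ∀ ℓ s L → CliqueFree ℓ L → subsum s L isClique ≤ τ ℓ s (length L)
  zykov ℓ s L = zykov′ ℓ s (length L) L ≡.refl

-- Complete multipartite graphs

argmax : (f : A → ℕ) (x : A) (xs : List A) → ∃ λ m → m ∈ x ∷ xs × (∀ {y} → y ∈ x ∷ xs → f y ≤ f m)
argmax f x []       = x , here ≡.refl , λ { (here ≡.refl) → ≤-refl }
argmax f x (y ∷ ys) with argmax f y ys
... | m , m∈ , max with ≤-total (f x) (f m)
... | inj₁ le = m , there m∈ , λ { (here ≡.refl) → le ; (there p) → max p }
... | inj₂ ge = x , here ≡.refl , λ { (here ≡.refl) → ≤-refl ; (there p) → ≤-trans (max p) ge }

unique-⊆-length : (xs ks : List A) → Unique xs → All (_∈ ks) xs → length xs ≤ length ks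
unique-⊆-length []       ks u        h        = z≤n
unique-⊆-length (x ∷ xs) ks (x∉ ∷ u) (x∈ ∷ h) with ∈⇒↭ x∈
... | ks′ , p = ≤-trans (s≤s (unique-⊆-length xs ks′ u (All.tabulate inks′))) (≤-reflexive (sym (↭-length p)))
  where
  inks′ : ∀ {y} → y ∈ xs → y ∈ ks′
  inks′ y∈ with ∈-resp-↭ p (All.lookup h y∈)
  ... | here ≡.refl = contradiction ≡.refl (All.lookup x∉ y∈)
  ... | there q     = q

module Multipartite {C : Set} (_≟_ : B.DecidableEquality C) (c : A → C) where

  open CliqueCounting {E = λ u v → c u ≢ c v} (λ u v → ¬? (c u ≟ c v)) (λ u≢v → u≢v ∘ sym) (λ u≢u → u≢u ≡.refl) public

  colours⇒free : ∀ ks L → (∀ {u} → u ∈ L → c u ∈ ks) → CliqueFree (length ks) L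
  colours⇒free ks L h S S⊆ cl eq = 1+n≰n (begin
    suc (length ks)   ≡⟨ eq ⟨
    length S          ≡⟨ length-map c S ⟨
    length (map c S)  ≤⟨ unique-⊆-length (map c S) ks (AllPairs.map⁺ cl) (All.tabulate col) ⟩
    length ks         ∎)
    where
    open ≤-Reasoning
    col : ∀ {k} → k ∈ map c S → k ∈ ks
    col k∈ with ∈-map⁻ c k∈
    ... | u , u∈ , ≡.refl = h (All.lookup S⊆ u∈)

  size : C → List A → ℕ
  size k = count (λ u → c u ≟ k)

  ∑-size≤ : ∀ ks L → Unique ks → ∑ ks (λ k → size k L) ≤ length L
  ∑-size≤ ks L uks = begin
    ∑ ks (λ k → size k L)                  ≡⟨ ∑-swap ks L (λ k u → ind (c u ≟ k)) ⟩
    ∑ L (λ u → count (λ k → c u ≟ k) ks)   ≤⟨ ∑-mono L (λ {u} _ → count≤1 (λ k → c u ≟ k) ks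
                                                (AllPairs.map (λ { x≢y (≡.refl , ≡.refl) → x≢y ≡.refl }) uks)) ⟩
    ∑ L (const 1)                          ≡⟨ ≡.trans (∑-const L 1) (*-identityʳ _) ⟩
    length L                               ∎
    where open ≤-Reasoning

  -- The recursion of `τ` is met by deleting a vertex of a largest class: the rest stays balanced,
  -- and the neighbours of the vertex form a balanced colouring with one colour fewer.
  balanced-lower : ∀ n ks s L → length L ≡ n → Unique ks → (∀ {u} → u ∈ L → c u ∈ ks) →
    (∀ {i j} → i ∈ ks → j ∈ ks → size i L ≤ suc (size j L)) →
    τ (length ks) s n ≤ subsum s L isClique
  balanced-lower n       ks        zero    L       eq uks col bal = ≤-refl
  balanced-lower n       []        (suc s) L       eq uks col bal = z≤n
  balanced-lower zero    (_ ∷ _)   (suc s) L       eq uks col bal = z≤n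
  balanced-lower (suc n) ks@(k₀ ∷ ks₀) (suc s) L@(u₀ ∷ _) eq uks col bal = begin
    τ (suc ℓ) (suc s) n + τ ℓ s (n ∸ n / suc ℓ)
      ≤⟨ +-monoʳ-≤ (τ (suc ℓ) (suc s) n) (τ-mono ℓ s n-n/ℓ≤) ⟩
    τ (suc ℓ) (suc s) n + τ ℓ s (length N)
      ≡⟨ cong (λ l → τ (suc ℓ) (suc s) n + τ l s (length N)) (suc-injective (↭-length ks↭)) ⟩
    τ (suc ℓ) (suc s) n + τ (length ks′) s (length N)
      ≤⟨ +-mono-≤ (balanced-lower n ks (suc s) L′ eq′ uks col′ bal′)
                  (balanced-lower (length N) ks′ s N ≡.refl (AllPairs.tail uks↭) colN balN) ⟩
    subsum (suc s) L′ isClique + subsum s N isClique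
      ≡⟨ cong (subsum (suc s) L′ isClique +_) (subsum-clique-∷ s v L′) ⟨
    subsum (suc s) L′ isClique + subsum s L′ (isClique ∘ (v ∷_))
      ≡⟨ subsum-↭ (suc s) isClique-↭ L↭ ⟨
    subsum (suc s) L isClique ∎
    where
    open ≤-Reasoning
    ℓ   = length ks₀
    mx  = argmax (λ k → size k L) k₀ ks₀
    k   = proj₁ mx
    k∈  = proj₁ (proj₂ mx)
    max = λ {j} → proj₂ (proj₂ mx) {j}
    -- A largest class is nonempty because the class of `u₀` is.
    pv  = count>0⇒∃ (λ u → c u ≟ k) L (≤-trans (∈⇒count>0 (λ u → c u ≟ c u₀) {L} (here ≡.refl) ≡.refl) (max (col (here ≡.refl))))
    v   = proj₁ pv
    v∈  = proj₁ (proj₂ pv)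
    cv  : c v ≡ k
    cv  = proj₂ (proj₂ pv)
    L′  = proj₁ (∈⇒↭ v∈)
    L↭  = proj₂ (∈⇒↭ v∈)
    ks′ = proj₁ (∈⇒↭ k∈)
    ks↭ = proj₂ (∈⇒↭ k∈)
    N   = filter (λ u → ¬? (c v ≟ c u)) L′
    uks↭ = Unique-resp-↭ ks↭ uks
    eq′ : length L′ ≡ n
    eq′ = suc-injective (≡.trans (sym (↭-length L↭)) eq)
    col′ : ∀ {u} → u ∈ L′ → c u ∈ ks
    col′ u∈ = col (∈-resp-↭ (↭-sym L↭) (there u∈))
    size-k : size k L ≡ suc (size k L′)
    size-k = ≡.trans (∑-↭ _ L↭) (cong (_+ size k L′) (ind-yes (c v ≟ k) cv))
    size-j : ∀ {j} → j ≢ k → size j L ≡ size j L′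
    size-j {j} j≢k = ≡.trans (∑-↭ _ L↭) (cong (_+ size j L′) (ind-no (c v ≟ j) λ e → j≢k (≡.trans (sym e) cv)))
    bal′ : ∀ {i j} → i ∈ ks → j ∈ ks → size i L′ ≤ suc (size j L′)
    bal′ {i} {j} i∈ j∈ with i ≟ k | j ≟ k
    ... | yes ≡.refl | yes ≡.refl = n≤1+n _
    ... | yes ≡.refl | no j≢k = ≤-trans (n≤1+n _) (≤-trans (≤-reflexive (sym size-k)) (≤-trans (bal i∈ j∈) (≤-reflexive (cong suc (size-j j≢k)))))
    ... | no i≢k | yes ≡.refl = ≤-trans (≤-reflexive (sym (size-j i≢k))) (≤-trans (max i∈) (≤-reflexive size-k))
    ... | no i≢k | no j≢k = ≤-trans (≤-reflexive (sym (size-j i≢k))) (≤-trans (bal i∈ j∈) (≤-reflexive (cong suc (size-j j≢k))))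
    ks′⊆ : ∀ {j} → j ∈ ks′ → j ∈ ks × j ≢ k
    ks′⊆ j∈ = ∈-resp-↭ (↭-sym ks↭) (there j∈) , λ { ≡.refl → All.lookup (AllPairs.head uks↭) j∈ ≡.refl }
    colN : ∀ {u} → u ∈ N → c u ∈ ks′
    colN u∈N with ∈-filter⁻ (λ u → ¬? (c v ≟ c u)) {xs = L′} u∈N
    ... | u∈ , cv≢cu with ∈-resp-↭ ks↭ (col′ u∈)
    ... | here e  = contradiction (≡.trans cv (sym e)) cv≢cu
    ... | there p = p
    sizeN : ∀ {j} → j ≢ k → size j N ≡ size j L
    sizeN {j} j≢k = ≡.trans (∑-filter (λ u → ¬? (c v ≟ c u)) L′ _) (≡.trans (∑-cong L′ λ {u} _ → pt u) (sym (size-j j≢k)))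
      where
      pt : ∀ u → ind (¬? (c v ≟ c u)) * ind (c u ≟ j) ≡ ind (c u ≟ j)
      pt u = ind-absorb (c u ≟ j) (¬? (c v ≟ c u)) λ e e′ → j≢k (≡.trans (sym e) (≡.trans (sym e′) cv))
    balN : ∀ {i j} → i ∈ ks′ → j ∈ ks′ → size i N ≤ suc (size j N)
    balN i∈ j∈ = ≤-trans (≤-reflexive (sizeN (proj₂ (ks′⊆ i∈)))) (≤-trans (bal (proj₁ (ks′⊆ i∈)) (proj₁ (ks′⊆ j∈)))
      (≤-reflexive (cong suc (sym (sizeN (proj₂ (ks′⊆ j∈)))))))
    q = size k L′
    -- By balance every other class has at least `q` vertices, so (q + 1) + ℓ·q ≤ n + 1.
    qℓ≤n : q * suc ℓ ≤ n
    qℓ≤n = s≤s⁻¹ (begin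
      suc (q * suc ℓ)                           ≡⟨ cong suc (*-suc q ℓ) ⟩
      suc q + q * ℓ                             ≡⟨ cong (suc q +_) (*-comm q ℓ) ⟩
      suc q + ℓ * q
        ≡⟨ cong₂ (λ x y → x + y * q) (sym size-k) (suc-injective (↭-length ks↭)) ⟩
      size k L + length ks′ * q                 ≡⟨ cong (size k L +_) (∑-const ks′ q) ⟨
      size k L + ∑ ks′ (const q)                ≤⟨ +-monoʳ-≤ (size k L) (∑-mono ks′ λ j∈ →
                                                     s≤s⁻¹ (≤-trans (≤-reflexive (sym size-k)) (bal k∈ (proj₁ (ks′⊆ j∈))))) ⟩
      size k L + ∑ ks′ (λ j → size j L)         ≡⟨ ∑-↭ (λ j → size j L) ks↭ ⟨
      ∑ ks (λ j → size j L)                     ≤⟨ ∑-size≤ ks L uks ⟩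
      length L                                  ≡⟨ eq ⟩
      suc n                                     ∎)
    q≤ : q ≤ n / suc ℓ
    q≤ = ≤-trans (≤-reflexive (sym (m*n/n≡m q (suc ℓ)))) (/-monoˡ-≤ (suc ℓ) qℓ≤n)
    nnv : non-nbrs v L′ ≡ q
    nnv = ∑-cong L′ λ {u} _ → ind-⇔ (¬? (¬? (c v ≟ c u))) (c u ≟ k)
      (λ nn → pt u nn) (λ e ne → ne (≡.trans cv (sym e)))
      where
      pt : ∀ u → ¬ (c v ≢ c u) → c u ≡ k
      pt u nn with c v ≟ c u
      ... | yes e = ≡.trans (sym e) cv
      ... | no ne = contradiction ne nn
    n-n/ℓ≤ : n ∸ n / suc ℓ ≤ length N
    n-n/ℓ≤ = ≤-trans (∸-monoʳ-≤ n q≤) (≤-reflexive (≡.trans (cong (_∸ q)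
      (≡.trans (sym eq′) (≡.trans (sym (length-nbrs v L′)) (cong (length N +_) nnv)))) (m+n∸n≡m (length N) q)))

-- Subsets as lists, and the Turán hypergraph

toSub : List (Fin n) → Subset n
toSub []      = ⊥
toSub (v ∷ S) = ⁅ v ⁆ ∪ toSub S

∈-toSub⁺ : {v : Fin n} {S : List (Fin n)} → v ∈ S → v Sub.∈ toSub S
∈-toSub⁺ (here ≡.refl) = x∈p∪q⁺ (inj₁ (x∈⁅x⁆ _))
∈-toSub⁺ (there p)     = x∈p∪q⁺ (inj₂ (∈-toSub⁺ p))

∈-toSub⁻ : {v : Fin n} (S : List (Fin n)) → v Sub.∈ toSub S → v ∈ S
∈-toSub⁻ []      p = contradiction p ∉⊥
∈-toSub⁻ (u ∷ S) p with x∈p∪q⁻ ⁅ u ⁆ (toSub S) p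
... | inj₁ q = here (x∈⁅y⁆⇒x≡y u q)
... | inj₂ q = there (∈-toSub⁻ S q)

toSub-↭ : {S S′ : List (Fin n)} → S ↭ S′ → toSub S ≡ toSub S′
toSub-↭ refl        = ≡.refl
toSub-↭ (prep x p)  = cong (⁅ x ⁆ ∪_) (toSub-↭ p)
toSub-↭ (swap {xs = xs} {ys} x y p) = begin
  ⁅ x ⁆ ∪ (⁅ y ⁆ ∪ toSub xs) ≡⟨ ∪-assoc ⁅ x ⁆ ⁅ y ⁆ _ ⟨
  (⁅ x ⁆ ∪ ⁅ y ⁆) ∪ toSub xs ≡⟨ cong₂ _∪_ (∪-comm ⁅ x ⁆ ⁅ y ⁆) (toSub-↭ p) ⟩
  (⁅ y ⁆ ∪ ⁅ x ⁆) ∪ toSub ys ≡⟨ ∪-assoc ⁅ y ⁆ ⁅ x ⁆ _ ⟩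
  ⁅ y ⁆ ∪ (⁅ x ⁆ ∪ toSub ys) ∎
  where open ≡.≡-Reasoning
toSub-↭ (trans p q) = ≡.trans (toSub-↭ p) (toSub-↭ q)

∣⁅x⁆∪p∣ : (x : Fin n) (p : Subset n) → x Sub.∉ p → ∣ ⁅ x ⁆ ∪ p ∣ ≡ suc ∣ p ∣
∣⁅x⁆∪p∣ zero    (outside ∷ p) x∉ = cong (suc ∘ ∣_∣) (∪-identityˡ p)
∣⁅x⁆∪p∣ zero    (inside  ∷ p) x∉ = contradiction here x∉
∣⁅x⁆∪p∣ (suc x) (outside ∷ p) x∉ = ∣⁅x⁆∪p∣ x p (x∉ ∘ there)
∣⁅x⁆∪p∣ (suc x) (inside  ∷ p) x∉ = cong suc (∣⁅x⁆∪p∣ x p (x∉ ∘ there))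

∣toSub∣ : (S : List (Fin n)) → Unique S → ∣ toSub S ∣ ≡ length S
∣toSub∣ {n} []      u        = ∣⊥∣≡0 n
∣toSub∣     (v ∷ S) (v∉ ∷ u) = ≡.trans
  (∣⁅x⁆∪p∣ v (toSub S) (λ p → All.lookup v∉ (∈-toSub⁻ S p) ≡.refl)) (cong suc (∣toSub∣ S u))

allFin-suc : ∀ n → allFin (suc n) ≡ zero ∷ map suc (allFin n)
allFin-suc n = cong (zero ∷_) (sym (map-tabulate id suc))

toSub-map-suc : (S : List (Fin n)) → toSub (map suc S) ≡ outside ∷ toSub S
toSub-map-suc []      = ≡.refl
toSub-map-suc (v ∷ S) = cong (⁅ suc v ⁆ ∪_) (toSub-map-suc S)

count-∈ : (e : Subset n) → count (_∈? e) (allFin n) ≡ ∣ e ∣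
count-∈ {zero}  []      = ≡.refl
count-∈ {suc n} (b ∷ e) = ≡.trans (cong (count (_∈? (b ∷ e))) (allFin-suc n)) (≡.trans
  (cong (ind (zero ∈? (b ∷ e)) +_) (≡.trans (∑-map suc (allFin n) _) (≡.trans
    (∑-cong (allFin n) λ {u} _ → ind-⇔ (suc u ∈? (b ∷ e)) (u ∈? e) (λ { (there p) → p }) there)
    (count-∈ e))))
  (head b))
  where
  head : ∀ b → ind (zero ∈? (b ∷ e)) + ∣ e ∣ ≡ ∣ b ∷ e ∣
  head true  = ≡.refl
  head false = ≡.refl

-- Translates the enumeration by characteristic vectors used in `copiesK` into sums over sublists,
-- where vertices can be split off.
count-subsets : ∀ n s {P : Subset n → Set} (P? : Decidable P) →
  length (filter (λ S → (∣ S ∣ ≟ s) ×-dec P? S) (allSubsets n)) ≡ subsum s (allFin n) (λ S → ind (P? (toSub S)))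
count-subsets n s P? = ≡.trans (length-filter≡count (λ S → (∣ S ∣ ≟ s) ×-dec P? S) (allSubsets n)) (go n s P?)
  where
  open ≡.≡-Reasoning
  go : ∀ n s {P : Subset n → Set} (P? : Decidable P) →
    count (λ S → (∣ S ∣ ≟ s) ×-dec P? S) (allSubsets n) ≡ subsum s (allFin n) (λ S → ind (P? (toSub S)))
  go zero zero    P? = +-identityʳ _
  go zero (suc s) P? = ≡.refl
  go (suc n) s {P} P? = begin
    count Q? (map (outside ∷_) (allSubsets n) ++ map (inside ∷_) (allSubsets n))
      ≡⟨ ∑-++ (map (outside ∷_) (allSubsets n)) _ (ind ∘ Q?) ⟩
    count Q? (map (outside ∷_) (allSubsets n)) + count Q? (map (inside ∷_) (allSubsets n))
      ≡⟨ cong₂ _+_ (≡.trans (∑-map (outside ∷_) (allSubsets n) (ind ∘ Q?)) (go n s (P? ∘ (outside ∷_))))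
                   (∑-map (inside ∷_) (allSubsets n) (ind ∘ Q?)) ⟩
    subsum s (allFin n) (λ S → ind (P? (outside ∷ toSub S))) + ∑ (allSubsets n) (ind ∘ Q? ∘ (inside ∷_))
      ≡⟨ ins s ⟩
    subsum s (zero ∷ map suc (allFin n)) (λ S → ind (P? (toSub S)))
      ≡⟨ cong (λ L → subsum s L (λ S → ind (P? (toSub S)))) (allFin-suc n) ⟨
    subsum s (allFin (suc n)) (λ S → ind (P? (toSub S))) ∎
    where
    Q? = λ S → (∣ S ∣ ≟ s) ×-dec P? S
    ins : ∀ s → subsum s (allFin n) (λ S → ind (P? (outside ∷ toSub S)))
                + ∑ (allSubsets n) (λ S → ind ((∣ inside ∷ S ∣ ≟ s) ×-dec P? (inside ∷ S)))
              ≡ subsum s (zero ∷ map suc (allFin n)) (λ S → ind (P? (toSub S)))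
    ins zero    = ≡.trans (cong (ind (P? (outside ∷ ⊥)) +_) (≡.trans (∑-const (allSubsets n) 0) (*-zeroʳ (length (allSubsets n))))) (+-identityʳ _)
    ins (suc s) = cong₂ _+_
      (sym (≡.trans (subsum-map suc (suc s) (allFin n) _) (subsum-cong (suc s) (allFin n)
        λ {S} _ _ → cong (ind ∘ P?) (toSub-map-suc S))))
      (≡.trans (∑-cong (allSubsets n) λ {S} _ → ind-⇔ ((suc ∣ S ∣ ≟ suc s) ×-dec P? (inside ∷ S)) ((∣ S ∣ ≟ s) ×-dec P? (inside ∷ S))
                  (λ (e , p) → suc-injective e , p) (λ (e , p) → cong suc e , p))
        (≡.trans (go n s (P? ∘ (inside ∷_)))
        (sym (≡.trans (subsum-map suc s (allFin n) _) (subsum-cong s (allFin n)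
          λ {S} _ _ → cong (ind ∘ P?) (≡.trans (cong (⁅ zero ⁆ ∪_) (toSub-map-suc S)) (cong (inside ∷_) (∪-identityˡ (toSub S)))))))))

∑-allFin-suc : ∀ n (f : ℕ → ℕ) → ∑ (allFin (suc n)) (f ∘ toℕ) ≡ ∑ (allFin n) (f ∘ toℕ) + f n
∑-allFin-suc n f = ≡.trans (first n f) (last n f)
  where
  first : ∀ n f → ∑ (allFin (suc n)) (f ∘ toℕ) ≡ f 0 + ∑ (allFin n) (f ∘ suc ∘ toℕ)
  first n f = ≡.trans (cong (λ L → ∑ L (f ∘ toℕ)) (allFin-suc n)) (cong (f 0 +_) (∑-map suc (allFin n) (f ∘ toℕ)))
  last : ∀ n f → f 0 + ∑ (allFin n) (f ∘ suc ∘ toℕ) ≡ ∑ (allFin n) (f ∘ toℕ) + f n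
  last zero    f = +-identityʳ _
  last (suc n) f = begin
    f 0 + ∑ (allFin (suc n)) (f ∘ suc ∘ toℕ)
      ≡⟨ cong (f 0 +_) (≡.trans (first n (f ∘ suc)) (last n (f ∘ suc))) ⟩
    f 0 + (∑ (allFin n) (f ∘ suc ∘ toℕ) + f (suc n))    ≡⟨ +-assoc (f 0) _ _ ⟨
    f 0 + ∑ (allFin n) (f ∘ suc ∘ toℕ) + f (suc n)      ≡⟨ cong (_+ f (suc n)) (first n f) ⟨
    ∑ (allFin (suc n)) (f ∘ toℕ) + f (suc n)            ∎
    where open ≡.≡-Reasoning

-- The new vertex has residue `ρ`, exactly the class at which the indicator changes when `ρ` grows;
-- once `ρ` reaches `suc k`, a new round begins.
residue-count : ∀ k n → ∃₂ λ q ρ → ρ < suc k × n ≡ ρ + q * suc k ×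
  (∀ i → i < suc k → count (λ (u : Fin n) → toℕ u % suc k ≟ i) (allFin n) ≡ q + ind (i <? ρ))
residue-count k zero = 0 , 0 , z<s , ≡.refl , λ i _ → ≡.refl
residue-count k (suc n) with residue-count k n
... | q , ρ , ρ<ℓ , n≡ , R = next (suc ρ <? suc k)
  where
  n% : n % suc k ≡ ρ
  n% = ≡.trans (cong (_% suc k) n≡) (≡.trans ([m+kn]%n≡m%n ρ q (suc k)) (m<n⇒m%n≡m ρ<ℓ))
  tri : ∀ i → ind (i <? ρ) + ind (ρ ≟ i) ≡ ind (i <? suc ρ)
  tri i with <-cmp i ρ
  ... | tri< a b c = ≡.trans (cong₂ _+_ (ind-yes (i <? ρ) a) (ind-no (ρ ≟ i) (b ∘ sym))) (sym (ind-yes (i <? suc ρ) (m<n⇒m<1+n a)))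
  ... | tri≈ a b c = ≡.trans (cong₂ _+_ (ind-no (i <? ρ) a) (ind-yes (ρ ≟ i) (sym b))) (sym (ind-yes (i <? suc ρ) (s≤s (≤-reflexive b))))
  ... | tri> a b c = ≡.trans (cong₂ _+_ (ind-no (i <? ρ) a) (ind-no (ρ ≟ i) (b ∘ sym))) (sym (ind-no (i <? suc ρ) (λ lt → <⇒≱ c (s≤s⁻¹ lt))))
  step : ∀ i → i < suc k → count (λ (u : Fin (suc n)) → toℕ u % suc k ≟ i) (allFin (suc n)) ≡ q + ind (i <? suc ρ)
  step i i< = ≡.trans (∑-allFin-suc n (λ x → ind (x % suc k ≟ i))) (≡.trans
    (cong₂ _+_ (R i i<) (cong (λ x → ind (x ≟ i)) n%)) (≡.trans (+-assoc q _ _) (cong (q +_) (tri i))))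
  next : Dec (suc ρ < suc k) → _
  next (yes lt) = q , suc ρ , lt , cong suc n≡ , step
  next (no ¬lt) = suc q , 0 , z<s , ≡.trans (cong suc n≡) (cong (_+ q * suc k) sucρ) , λ i i< → ≡.trans (step i i<)
      (≡.trans (cong (q +_) (ind-yes (i <? suc ρ) (subst (i <_) (sym sucρ) i<))) (≡.trans (+-comm q 1) (sym (+-identityʳ _))))
    where
    sucρ : suc ρ ≡ suc k
    sucρ = ≤-antisym ρ<ℓ (≮⇒≥ ¬lt)

residue-balanced : ∀ k n i j → i < suc k → j < suc k →
  count (λ (u : Fin n) → toℕ u % suc k ≟ i) (allFin n) ≤ suc (count (λ (u : Fin n) → toℕ u % suc k ≟ j) (allFin n))
residue-balanced k n i j i< j< with residue-count k n
... | q , ρ , _ , _ , R = begin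
  count (λ (u : Fin n) → toℕ u % suc k ≟ i) (allFin n)          ≡⟨ R i i< ⟩
  q + ind (i <? ρ)            ≤⟨ +-monoʳ-≤ q (ind≤1 (i <? ρ)) ⟩
  q + 1                       ≡⟨ +-comm q 1 ⟩
  suc q                       ≤⟨ s≤s (m≤m+n q _) ⟩
  suc (q + ind (j <? ρ))      ≡⟨ cong suc (R j j<) ⟨
  suc (count (λ (u : Fin n) → toℕ u % suc k ≟ j) (allFin n))    ∎
  where open ≤-Reasoning

-- A set meeting each part at most once spans a copy, since its r-subsets inherit this property;
-- such sets are the cliques of a balanced multipartite graph.
turan-lower : ∀ r n k s → τ (suc k) s n ≤ copiesK s (turan r n (suc k))
turan-lower r n k s = begin
  τ (suc k) s n                               ≡⟨ cong (λ l → τ l s n) (length-upTo (suc k)) ⟨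
  τ (length (upTo (suc k))) s n
    ≤⟨ balanced-lower n (upTo (suc k)) s (allFin n) (length-tabulate id) (upTo⁺ (suc k))
                                                   (λ {u} _ → ∈-upTo⁺ (m%n<n (toℕ u) (suc k)))
                                                   (λ i∈ j∈ → residue-balanced k n _ _ (∈-upTo⁻ i∈) (∈-upTo⁻ j∈)) ⟩
  subsum s (allFin n) isClique
    ≤⟨ subsum-mono s (allFin n) (λ {S} _ _ → ind-elim (allPairs? (λ u v → ¬? (part (suc k) u ≟ part (suc k) v)) S)
                                                   λ cl → ≤-reflexive (sym (ind-yes (spansClique? T (toSub S)) (spans S cl)))) ⟩
  subsum s (allFin n) (λ S → ind (spansClique? T (toSub S)))  ≡⟨ count-subsets n s (spansClique? T) ⟨
  copiesK s T                                 ∎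
  where
  open ≤-Reasoning
  open Multipartite _≟_ (part (suc k) {n})
  T = turan r n (suc k)
  pair : ∀ {u v} (S : List (Fin n)) → AllPairs (λ u v → part (suc k) u ≢ part (suc k) v) S → u ∈ S → v ∈ S → u ≢ v → part (suc k) u ≢ part (suc k) v
  pair (w ∷ S) (h ∷ hs) (here ≡.refl) (here ≡.refl) u≢v = contradiction ≡.refl u≢v
  pair (w ∷ S) (h ∷ hs) (here ≡.refl) (there q)     u≢v = All.lookup h q
  pair (w ∷ S) (h ∷ hs) (there p)     (here ≡.refl) u≢v = All.lookup h p ∘ sym
  pair (w ∷ S) (h ∷ hs) (there p)     (there q)     u≢v = pair S hs p q u≢v
  spans : ∀ S → AllPairs (λ u v → part (suc k) u ≢ part (suc k) v) S → SpansClique T (toSub S)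
  spans S cl = All.tabulate λ _ e⊆ ∣e∣ → ∣e∣ , λ u v u∈ v∈ → pair S cl (∈-toSub⁻ S (e⊆ u∈)) (∈-toSub⁻ S (e⊆ v∈))

-- There is one core vertex more than parts, so two of them share a part, and no edge contains both.
turan-free : ∀ r n k → ¬ ContainsExpansion (turan r n (suc k)) (suc (suc k))
turan-free r n k (f , inj , E , h) =
  let i , j , i<j , gi≡gj = pigeonhole (n<1+n (suc k)) (λ i → fromℕ< (m%n<n (toℕ (f i)) (suc k)))
      (_ , diff) , fi∈ , fj∈ , _ = h i j i<j
  in diff (f i) (f j) fi∈ fj∈ (λ e → Fin.<⇒≢ i<j (inj e)) (fromℕ<-injective _ _ (m%n<n (toℕ (f i)) (suc k)) (m%n<n (toℕ (f j)) (suc k)) gi≡gj)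

-- Heavy pairs and expansions

count-∈≤ : ∀ {n} (e : Subset n) (L : List (Fin n)) → Unique L → count (_∈? e) L ≤ ∣ e ∣
count-∈≤ e L uL = begin
  count (_∈? e) L   ≡⟨ length-filter≡count (_∈? e) L ⟨
  length M          ≡⟨ ∣toSub∣ M (filter⁺ (_∈? e) uL) ⟨
  ∣ toSub M ∣       ≤⟨ p⊆q⇒∣p∣≤∣q∣ (λ v∈ → proj₂ (∈-filter⁻ (_∈? e) {xs = L} (∈-toSub⁻ M v∈))) ⟩
  ∣ e ∣             ∎
  where
  open ≤-Reasoning
  M = filter (_∈? e) L

∈-allSubsets : ∀ {n} (e : Subset n) → e ∈ allSubsets n
∈-allSubsets {zero}  [] = here ≡.refl
∈-allSubsets {suc n} (true ∷ e)   = ∈-++⁺ʳ (map (false ∷_) (allSubsets n)) (∈-map⁺ _ (∈-allSubsets e))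
∈-allSubsets {suc n} (false ∷ e)  = ∈-++⁺ˡ (∈-map⁺ _ (∈-allSubsets e))

length-cartesianProduct : {A B : Set} (xs : List A) (ys : List B) →
  length (cartesianProduct xs ys) ≡ length xs * length ys
length-cartesianProduct []       ys = ≡.refl
length-cartesianProduct (x ∷ xs) ys = ≡.trans (length-++ (map (x ,_) ys))
  (cong₂ _+_ (length-map (x ,_) ys) (length-cartesianProduct xs ys))

lookup-injective : {A : Set} (xs : List A) → Unique xs → ∀ i j → lookup xs i ≡ lookup xs j → i ≡ j
lookup-injective (x ∷ xs) (h ∷ u) zero    zero    eq = ≡.refl
lookup-injective (x ∷ xs) (h ∷ u) zero    (suc j) eq = contradiction eq (All.lookup h (∈-lookup j))
lookup-injective (x ∷ xs) (h ∷ u) (suc i) zero    eq = contradiction (sym eq) (All.lookup h (∈-lookup i))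
lookup-injective (x ∷ xs) (h ∷ u) (suc i) (suc j) eq = cong suc (lookup-injective xs u i j eq)

AllPairs-lookup : {A : Set} {R : A → A → Set} (xs : List A) → AllPairs R xs →
  ∀ i j → i Fin.< j → R (lookup xs i) (lookup xs j)
AllPairs-lookup (x ∷ xs) (h ∷ hs) zero    (suc j) _         = All.lookup h (∈-lookup j)
AllPairs-lookup (x ∷ xs) (h ∷ hs) (suc i) (suc j) (s≤s i<j) = AllPairs-lookup xs hs i j i<j

module Kernel {r n} (G : RGraph r n) (k : ℕ) where

  V = Fin n

  Through : V → V → Subset n → Set
  Through a b e = Edge G e × a Sub.∈ e × b Sub.∈ e

  Disj : V → V → Subset n → Subset n → Set
  Disj a b e e′ = ∀ v → v Sub.∈ e → v Sub.∈ e′ → v ≡ a ⊎ v ≡ b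

  through? : ∀ a b → Decidable (Through a b)
  through? a b e = Edge? G e ×-dec (a ∈? e) ×-dec (b ∈? e)

  at? : ∀ a b (e e′ : Subset n) v → Dec (v Sub.∈ e → v Sub.∈ e′ → v ≡ a ⊎ v ≡ b)
  at? a b e e′ v = (v ∈? e) →-dec ((v ∈? e′) →-dec ((v Fin.≟ a) ⊎-dec (v Fin.≟ b)))

  disj? : ∀ a b (e : Subset n) → Decidable (Disj a b e)
  disj? a b e e′ = Fin.all? (at? a b e e′)

  add : ∀ a b (e : Subset n) (M : List (Subset n)) → Dec (Through a b e × All (Disj a b e) M) → List (Subset n)
  add a b e M (yes _) = e ∷ M
  add a b e M (no  _) = M

  -- A maximal family of edges through a and b that are disjoint elsewhere.
  sunflower : V → V → List (Subset n) → List (Subset n)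
  sunflower a b []       = []
  sunflower a b (e ∷ es) = add a b e M (through? a b e ×-dec all? (disj? a b e) M)
    where M = sunflower a b es

  sunflower-through : ∀ a b es → All (Through a b) (sunflower a b es)
  sunflower-through a b []       = []
  sunflower-through a b (e ∷ es) with through? a b e ×-dec all? (disj? a b e) (sunflower a b es)
  ... | yes (t , _) = t ∷ sunflower-through a b es
  ... | no  _       = sunflower-through a b es

  sunflower-disj : ∀ a b es → AllPairs (Disj a b) (sunflower a b es)
  sunflower-disj a b []       = []
  sunflower-disj a b (e ∷ es) with through? a b e ×-dec all? (disj? a b e) (sunflower a b es)
  ... | yes (_ , d) = d ∷ sunflower-disj a b es
  ... | no  _       = sunflower-disj a b es

  sunflower-maximal : ∀ a b es {e} → e ∈ es → Through a b e →
    e ∈ sunflower a b es ⊎ Any (λ e′ → ¬ Disj a b e e′) (sunflower a b es)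
  sunflower-maximal a b (e ∷ es) e∈ t with through? a b e ×-dec all? (disj? a b e) (sunflower a b es)
  sunflower-maximal a b (e ∷ es) (here ≡.refl) t | yes _ = inj₁ (here ≡.refl)
  sunflower-maximal a b (e ∷ es) (there e∈)    t | yes _ = Sum.map there there (sunflower-maximal a b es e∈ t)
  sunflower-maximal a b (e ∷ es) (there e∈)    t | no  _ = sunflower-maximal a b es e∈ t
  sunflower-maximal a b (e ∷ es) (here ≡.refl) t | no ¬p with any? (¬? ∘ disj? a b e) (sunflower a b es)
  ... | yes p = inj₂ p
  ... | no ¬q = contradiction (t , All.tabulate (λ {e′} e′∈ → stable e′ e′∈)) ¬p
    where
    stable : ∀ e′ → e′ ∈ sunflower a b es → Disj a b e e′
    stable e′ e′∈ with disj? a b e e′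
    ... | yes d = d
    ... | no ¬d = contradiction (lose e′∈ ¬d) ¬q

  petals : V → V → List (Subset n)
  petals a b = sunflower a b (allSubsets n)

  -- Heaviness. Both orders of the kernel are allowed so that the relation is symmetric by
  -- construction.
  _~_ : V → V → Set
  a ~ b = a ≢ b × (k ≤ length (petals a b) ⊎ k ≤ length (petals b a))

  abstract
    _~?_ : B.Decidable _~_
    a ~? b = ¬? (a Fin.≟ b) ×-dec ((k ≤? length (petals a b)) ⊎-dec (k ≤? length (petals b a)))

  ~-sym : ∀ {a b} → a ~ b → b ~ a
  ~-sym (a≢b , h) = a≢b ∘ sym , Sum.swap h

  ~-irrefl : ∀ {a} → ¬ (a ~ a)
  ~-irrefl (a≢a , _) = a≢a ≡.refl

  Cover : V → V → V → Set
  Cover a b c = c ≢ a × c ≢ b × Any (c Sub.∈_) (petals a b)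

  abstract
    cover? : ∀ a b → Decidable (Cover a b)
    cover? a b c = ¬? (c Fin.≟ a) ×-dec ¬? (c Fin.≟ b) ×-dec any? (c ∈?_) (petals a b)

  -- A light pair has fewer than `k` petals, each with `r` vertices.
  count-cover : ∀ a b L → Unique L → a ≢ b → ¬ (a ~ b) → count (cover? a b) L ≤ k * r
  count-cover a b L uL a≢b a≁b = begin
    count (cover? a b) L                       ≤⟨ ∑-mono L (λ {c} _ → ind-elim (cover? a b c) λ (_ , _ , p) →
                                                    let e , e∈ , c∈ = find p in ∈⇒count>0 (c ∈?_) e∈ c∈) ⟩
    ∑ L (λ c → count (c ∈?_) M)                ≡⟨ ∑-swap L M (λ c e → ind (c ∈? e)) ⟩
    ∑ M (λ e → count (_∈? e) L)                ≤⟨ ∑-mono M (λ {e} e∈ → ≤-trans (count-∈≤ e L uL)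
                                                    (≤-reflexive (uniform G e (proj₁ (All.lookup (sunflower-through a b (allSubsets n)) e∈))))) ⟩
    ∑ M (const r)                              ≡⟨ ∑-const M r ⟩
    length M * r                               ≤⟨ *-monoˡ-≤ r (<⇒≤ (≰⇒> λ k≤ → a≁b (a≢b , inj₁ k≤))) ⟩
    k * r                                      ∎
    where
    open ≤-Reasoning
    M = petals a b

  -- By maximality the edge meets some petal outside the kernel. If it is itself a petal, `3 ≤ r`
  -- provides a vertex besides `a` and `b`.
  light-cover : ∀ {a b e} → 3 ≤ r → Through a b e → ∃ λ c → c Sub.∈ e × Cover a b c
  light-cover {a} {b} {e} 3≤r t with sunflower-maximal a b (allSubsets n) (∈-allSubsets e) t
  ... | inj₂ p = let e′ , e′∈ , ¬d = find p
                     v , ¬at = ¬∀⟶∃¬ n _ (at? a b e e′) ¬d in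
                 meet v e′ e′∈ ¬at (v ∈? e) (v ∈? e′)
    where
    meet : ∀ v e′ → e′ ∈ petals a b → ¬ (v Sub.∈ e → v Sub.∈ e′ → v ≡ a ⊎ v ≡ b) →
      Dec (v Sub.∈ e) → Dec (v Sub.∈ e′) → ∃ λ c → c Sub.∈ e × Cover a b c
    meet v e′ e′∈ ¬at (yes v∈) (yes v∈′) = v , v∈ , (λ p → ¬at λ _ _ → inj₁ p) , (λ p → ¬at λ _ _ → inj₂ p) , lose e′∈ v∈′
    meet v e′ e′∈ ¬at (no v∉) _          = contradiction (λ v∈ → contradiction v∈ v∉) ¬at
    meet v e′ e′∈ ¬at _ (no v∉)          = contradiction (λ _ v∈ → contradiction v∈ v∉) ¬at
  ... | inj₁ e∈ = third
    where
    L = filter (_∈? e) (allFin n)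
    bound : count (λ v → (v Fin.≟ a) ⊎-dec (v Fin.≟ b)) L < length L
    bound = begin-strict
      count (λ v → (v Fin.≟ a) ⊎-dec (v Fin.≟ b)) L
        ≤⟨ count-filter≤ (_∈? e) (λ v → (v Fin.≟ a) ⊎-dec (v Fin.≟ b)) (allFin n) ⟩
      count (λ v → (v Fin.≟ a) ⊎-dec (v Fin.≟ b)) (allFin n)
        ≤⟨ ∑-mono (allFin n) (λ {v} _ → ind-elim ((v Fin.≟ a) ⊎-dec (v Fin.≟ b))
             λ { (inj₁ p) → ≤-trans (≤-reflexive (sym (ind-yes (v Fin.≟ a) p))) (m≤m+n _ _)
               ; (inj₂ p) → ≤-trans (≤-reflexive (sym (ind-yes (v Fin.≟ b) p))) (m≤n+m _ _) }) ⟩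
      ∑ (allFin n) (λ v → ind (v Fin.≟ a) + ind (v Fin.≟ b))   ≡⟨ ∑-+ (allFin n) _ _ ⟩
      count (Fin._≟ a) (allFin n) + count (Fin._≟ b) (allFin n) ≤⟨ +-mono-≤ (once a) (once b) ⟩
      2             <⟨ 3≤r ⟩
      r             ≡⟨ uniform G e (proj₁ t) ⟨
      ∣ e ∣         ≡⟨ count-∈ e ⟨
      count (_∈? e) (allFin n) ≡⟨ length-filter≡count (_∈? e) (allFin n) ⟨
      length L      ∎
      where
      open ≤-Reasoning
      once : ∀ a → count (Fin._≟ a) (allFin n) ≤ 1
      once a = count≤1 (Fin._≟ a) (allFin n) (AllPairs.map (λ { x≢y (≡.refl , ≡.refl) → x≢y ≡.refl }) (allFin⁺ n))
    third : ∃ λ c → c Sub.∈ e × Cover a b c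
    third = let c , c∈ , ¬p = count<length⇒∃ (λ v → (v Fin.≟ a) ⊎-dec (v Fin.≟ b)) L bound
                c∈e = proj₂ (∈-filter⁻ (_∈? e) {xs = allFin n} c∈)
            in c , c∈e , ¬p ∘ inj₁ , ¬p ∘ inj₂ , lose e∈ c∈e

  -- Petals are disjoint outside the kernel, so each forbidden vertex spoils at most one of the `k`
  -- petals.
  avoiding : ∀ {a b} → a ~ b → ∀ F → length F < k → All (λ f → f ≢ a × f ≢ b) F →
    ∃ λ e → Through a b e × All (Sub._∉ e) F
  avoiding (a≢b , inj₁ h) F lt av = one h F lt av
    where
    one : ∀ {a b} → k ≤ length (petals a b) → ∀ F → length F < k → All (λ f → f ≢ a × f ≢ b) F →
      ∃ λ e → Through a b e × All (Sub._∉ e) F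
    one {a} {b} h F lt av =
      let e , e∈ , ¬p = count<length⇒∃ (λ e → any? (_∈? e) F) (petals a b) (begin-strict
            count (λ e → any? (_∈? e) F) (petals a b)
              ≤⟨ ∑-mono (petals a b) (λ {e} _ → ind-elim (any? (_∈? e) F) λ p →
                   let f , f∈ , f∈e = find p in ∈⇒count>0 (_∈? e) f∈ f∈e) ⟩
            ∑ (petals a b) (λ e → count (_∈? e) F)   ≡⟨ ∑-swap (petals a b) F (λ e f → ind (f ∈? e)) ⟩
            ∑ F (λ f → count (f ∈?_) (petals a b))   ≤⟨ ∑-mono F (λ {f} f∈ → count≤1 (f ∈?_) (petals a b)
                 (AllPairs.map (λ d (p , q) → let f≢a , f≢b = All.lookup av f∈ in Sum.[ f≢a , f≢b ] (d f p q)) (sunflower-disj a b (allSubsets n)))) ⟩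
            ∑ F (const 1)                            ≡⟨ ≡.trans (∑-const F 1) (*-identityʳ _) ⟩
            length F                                 <⟨ lt ⟩
            k                                        ≤⟨ h ⟩
            length (petals a b)                      ∎)
      in e , All.lookup (sunflower-through a b (allSubsets n)) e∈ , All.tabulate λ f∈ f∈e → ¬p (lose f∈ f∈e)
      where open ≤-Reasoning
  avoiding {a} {b} (a≢b , inj₂ h) F lt av =
    let e , (ed , b∈ , a∈) , nf = avoiding {b} {a} (a≢b ∘ sym , inj₁ h) F lt (All.map (λ (p , q) → q , p) av)
    in e , (ed , a∈ , b∈) , nf

  module _ {m} (f : Fin m → V) (f-inj : ∀ i j → f i ≡ f j → i ≡ j) where

    -- The pairs in `D` have received their edges. Disjointness is stated as meeting in core
    -- vertices only, which together with `core` gives the condition of `ContainsExpansion`.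
    record Partial (D : List (Fin m × Fin m)) (E : Fin m → Fin m → Subset n) : Set where
      field
        edge : ∀ {i j} → (i , j) ∈ D → Through (f i) (f j) (E i j)
        core : ∀ {i j} → (i , j) ∈ D → ∀ t → f t Sub.∈ E i j → t ≡ i ⊎ t ≡ j
        disj : ∀ {i j i′ j′} → (i , j) ∈ D → (i′ , j′) ∈ D → (i , j) ≢ (i′ , j′) →
               ∀ v → v Sub.∈ E i j → v Sub.∈ E i′ j′ → ∃ λ t → v ≡ f t
    open Partial

    _≟ₚ_ : B.DecidableEquality (Fin m × Fin m)
    _≟ₚ_ = ≡-dec Fin._≟_ Fin._≟_

    -- The new edge is chosen to avoid, apart from its two ends, all `m` core vertices and the at
    -- most `length D * r` vertices of earlier edges.
    extend : ∀ {D E} → Partial D E → ∀ i j → f i ~ f j → m + length D * r < k →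
      ∃ λ E′ → Partial ((i , j) ∷ D) E′
    extend {D} {E} P i j i~j small with any? ((i , j) ≟ₚ_) D
    ... | yes ij∈ = E , record
      { edge = edge P ∘ old ; core = core P ∘ old ; disj = λ p q → disj P (old p) (old q) }
      where
      old : ∀ {p} → p ∈ (i , j) ∷ D → p ∈ D
      old (here ≡.refl) = ij∈
      old (there p)     = p
    ... | no ij∉ = E′ , record { edge = edge′ ; core = core′ ; disj = disj′ }
      where
      els : Fin m × Fin m → List V
      els (a , b) = filter (_∈? E a b) (allFin n)
      U = map f (allFin m) ++ concatMap els D
      F = filter (λ v → ¬? (v Fin.≟ f i) ×-dec ¬? (v Fin.≟ f j)) U
      els≤ : ∀ D′ → (∀ {p} → p ∈ D′ → p ∈ D) → length (concatMap els D′) ≤ length D′ * r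
      els≤ []             h = z≤n
      els≤ ((a , b) ∷ D′) h = begin
        length (els (a , b) ++ concatMap els D′)           ≡⟨ length-++ (els (a , b)) ⟩
        length (els (a , b)) + length (concatMap els D′)
          ≤⟨ +-mono-≤ (≤-reflexive (≡.trans (length-filter≡count (_∈? E a b) (allFin n))
             (≡.trans (count-∈ (E a b)) (uniform G _ (proj₁ (edge P (h (here ≡.refl)))))))) (els≤ D′ (h ∘ there)) ⟩
        r + length D′ * r                                  ∎
        where open ≤-Reasoning
      F<k : length F < k
      F<k = begin-strict
        length F                                          ≤⟨ length-filter _ U ⟩
        length U                                          ≡⟨ length-++ (map f (allFin m)) ⟩
        length (map f (allFin m)) + length (concatMap els D)
          ≤⟨ +-mono-≤ (≤-reflexive (≡.trans (length-map f (allFin m)) (length-tabulate id))) (els≤ D id) ⟩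
        m + length D * r                                  <⟨ small ⟩
        k                                                 ∎
        where open ≤-Reasoning
      av = avoiding i~j F F<k (All.tabulate λ v∈ → proj₂ (∈-filter⁻ (λ v → ¬? (v Fin.≟ f i) ×-dec ¬? (v Fin.≟ f j)) {xs = U} v∈))
      e = proj₁ av
      hit : ∀ {v} → v ∈ U → v Sub.∈ e → v ≡ f i ⊎ v ≡ f j
      hit {v} v∈U v∈e with v Fin.≟ f i | v Fin.≟ f j
      ... | yes p | _     = inj₁ p
      ... | no _  | yes q = inj₂ q
      ... | no p  | no q  = contradiction v∈e (All.lookup (proj₂ (proj₂ av)) (∈-filter⁺ _ v∈U (p , q)))
      E′ : Fin m → Fin m → Subset n
      E′ a b with (a , b) ≟ₚ (i , j)
      ... | yes _ = e
      ... | no  _ = E a b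
      E′-new : E′ i j ≡ e
      E′-new with (i , j) ≟ₚ (i , j)
      ... | yes _ = ≡.refl
      ... | no ¬p = contradiction ≡.refl ¬p
      E′-old : ∀ {a b} → (a , b) ∈ D → E′ a b ≡ E a b
      E′-old {a} {b} ab∈ with (a , b) ≟ₚ (i , j)
      ... | yes ≡.refl = contradiction ab∈ ij∉
      ... | no _       = ≡.refl
      edge′ : ∀ {a b} → (a , b) ∈ (i , j) ∷ D → Through (f a) (f b) (E′ a b)
      edge′ (here ≡.refl) rewrite E′-new      = proj₁ (proj₂ av)
      edge′ (there ab∈)   rewrite E′-old ab∈  = edge P ab∈
      core′ : ∀ {a b} → (a , b) ∈ (i , j) ∷ D → ∀ t → f t Sub.∈ E′ a b → t ≡ a ⊎ t ≡ b
      core′ (here ≡.refl) t ft∈ rewrite E′-new     =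
        Sum.map (f-inj t i) (f-inj t j) (hit (∈-++⁺ˡ (∈-map⁺ f (∈-allFin t))) ft∈)
      core′ (there ab∈)   t ft∈ rewrite E′-old ab∈ = core P ab∈ t ft∈
      new-old : ∀ {a b} → (a , b) ∈ D → ∀ v → v Sub.∈ e → v Sub.∈ E a b → ∃ λ t → v ≡ f t
      new-old {a} {b} ab∈ v v∈e v∈E = Sum.[ (λ p → i , p) , (λ p → j , p) ]′
        (hit (∈-++⁺ʳ (map f (allFin m)) (∈-concatMap⁺ els (lose ab∈ (∈-filter⁺ (_∈? E a b) (∈-allFin v) v∈E)))) v∈e)
      disj′ : ∀ {a b a′ b′} → (a , b) ∈ (i , j) ∷ D → (a′ , b′) ∈ (i , j) ∷ D → (a , b) ≢ (a′ , b′) →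
        ∀ v → v Sub.∈ E′ a b → v Sub.∈ E′ a′ b′ → ∃ λ t → v ≡ f t
      disj′ (here ≡.refl) (here ≡.refl) ne = contradiction ≡.refl ne
      disj′ (here ≡.refl) (there q) ne v p₁ p₂ rewrite E′-new | E′-old q = new-old q v p₁ p₂
      disj′ (there q) (here ≡.refl) ne v p₁ p₂ rewrite E′-new | E′-old q = new-old q v p₂ p₁
      disj′ (there p) (there q) ne v p₁ p₂ rewrite E′-old p | E′-old q = disj P p q ne v p₁ p₂

    -- A pair moves from `Q` to `D` or is dropped, so the sum of the two lengths never grows and one
    -- bound on `k` serves every step.
    extend-all : ∀ Q {D E} → Partial D E → (∀ i j → i Fin.< j → (i , j) ∈ D ⊎ f i ~ f j) →
      m + (length D + length Q) * r < k →
      ∃₂ λ D′ E′ → Partial D′ E′ × (∀ {p} → p ∈ D → p ∈ D′) × (∀ {i j} → (i , j) ∈ Q → i Fin.< j → (i , j) ∈ D′)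
    extend-all []            {D} {E} P h small = D , E , P , id , λ ()
    extend-all ((i , j) ∷ Q) {D} {E} P h small with i Fin.<? j
    ... | no i≮j =
      let D′ , E′ , P′ , D⊆ , Q⊆ = extend-all Q P h (≤-<-trans (+-monoʳ-≤ m (*-monoˡ-≤ r (+-monoʳ-≤ (length D) (n≤1+n _)))) small)
      in D′ , E′ , P′ , D⊆ , λ { (here ≡.refl) lt → contradiction lt i≮j ; (there p) lt → Q⊆ p lt }
    ... | yes i<j with h i j i<j
    ... | inj₁ ij∈ =
      let D′ , E′ , P′ , D⊆ , Q⊆ = extend-all Q P h (≤-<-trans (+-monoʳ-≤ m (*-monoˡ-≤ r (+-monoʳ-≤ (length D) (n≤1+n _)))) small)
      in D′ , E′ , P′ , D⊆ , λ { (here ≡.refl) lt → D⊆ ij∈ ; (there p) lt → Q⊆ p lt }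
    ... | inj₂ i~j =
      let E₁ , P₁ = extend P i j i~j (≤-<-trans (+-monoʳ-≤ m (*-monoˡ-≤ r (m≤m+n (length D) _))) small)
          D′ , E′ , P′ , D⊆ , Q⊆ = extend-all Q P₁ (λ a b lt → Sum.map₁ there (h a b lt))
            (subst (λ x → m + x * r < k) (+-suc (length D) (length Q)) small)
      in D′ , E′ , P′ , D⊆ ∘ there , λ { (here ≡.refl) lt → D⊆ (here ≡.refl) ; (there p) lt → Q⊆ p lt }

    complete : ∀ {D E} → Partial D E → (∀ i j → i Fin.< j → (i , j) ∈ D ⊎ f i ~ f j) →
      m + (length D + m * m) * r < k → ContainsExpansion G m
    complete {D} {E} P h small =
      let D′ , E′ , P′ , D⊆ , Q⊆ = extend-all Q P h (subst (λ x → m + (length D + x) * r < k) (sym lenQ) small)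
          done = λ {i} {j} (lt : i Fin.< j) → Q⊆ (∈-cartesianProduct⁺ (∈-allFin i) (∈-allFin j)) lt
      in f , (λ {i} {j} → f-inj i j) , E′ , λ i j i<j →
        let ed , fi∈ , fj∈ = edge P′ (done i<j)
            notcore = λ v v∈ v≢i v≢j t (v≡ : v ≡ f t) → Sum.[ (λ { ≡.refl → v≢i v≡ }) , (λ { ≡.refl → v≢j v≡ }) ]
                        (core P′ (done i<j) t (subst (Sub._∈ E′ i j) v≡ v∈))
        in ed , fi∈ , fj∈ , λ v v∈ v≢i v≢j → notcore v v∈ v≢i v≢j ,
           λ a b a<b ne v∈′ → let t , v≡ = disj P′ (done i<j) (done a<b) (λ { ≡.refl → ne (≡.refl , ≡.refl) }) v v∈ v∈′
                              in notcore v v∈ v≢i v≢j t v≡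
      where
      Q = cartesianProduct (allFin m) (allFin m)
      lenQ : length Q ≡ m * m
      lenQ = ≡.trans (length-cartesianProduct (allFin m) (allFin m)) (cong₂ _*_ (length-tabulate {n = m} id) (length-tabulate {n = m} id))

  ~⇒≢ : ∀ {a b} → a ~ b → a ≢ b
  ~⇒≢ = proj₁

  -- The given edge `e` is placed first, for the one pair that may be light; it accounts for the
  -- `suc` in `suc (m * m)`. Every other pair is heavy and receives a petal.
  expansion : ∀ {u v} xs {e} → u ≢ v → All (u ~_) xs → All (v ~_) xs → AllPairs _~_ xs →
    Through u v e → All (Sub._∉ e) xs → (let m = 2 + length xs) → m + suc (m * m) * r < k →
    ContainsExpansion G m
  expansion {u} {v} xs {e} u≢v ux vx xx t av small =
    complete f f-inj start pairs small
    where
    f = lookup (u ∷ v ∷ xs)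
    f-inj : ∀ i j → f i ≡ f j → i ≡ j
    f-inj = lookup-injective (u ∷ v ∷ xs) ((u≢v ∷ All.map ~⇒≢ ux) ∷ All.map ~⇒≢ vx ∷ AllPairs.map ~⇒≢ xx)
    start : Partial f f-inj ((zero , suc zero) ∷ []) (λ _ _ → e)
    start = record
      { edge = λ { (here ≡.refl) → t }
      ; core = λ { (here ≡.refl) zero _ → inj₁ ≡.refl
                 ; (here ≡.refl) (suc zero) _ → inj₂ ≡.refl
                 ; (here ≡.refl) (suc (suc l)) p → contradiction p (All.lookup av (∈-lookup l)) }
      ; disj = λ { (here ≡.refl) (here ≡.refl) ne → contradiction ≡.refl ne } }
    pairs : ∀ i j → i Fin.< j → (i , j) ∈ (zero , suc zero) ∷ [] ⊎ f i ~ f j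
    pairs zero          (suc zero)    _ = inj₁ (here ≡.refl)
    pairs zero          (suc (suc j)) _ = inj₂ (All.lookup ux (∈-lookup j))
    pairs (suc zero)    (suc zero)    (s≤s ())
    pairs (suc zero)    (suc (suc j)) _ = inj₂ (All.lookup vx (∈-lookup j))
    pairs (suc (suc i)) (suc zero)    (s≤s ())
    pairs (suc (suc i)) (suc (suc j)) (s≤s (s≤s lt)) = inj₂ (AllPairs-lookup xs xx i j lt)

-- Estimates

m<[1+m/n]*n : ∀ m n .{{_ : NonZero n}} → m < suc (m / n) * n
m<[1+m/n]*n m n = begin-strict
  m                     ≡⟨ m≡m%n+[m/n]*n m n ⟩
  m % n + m / n * n     <⟨ +-monoˡ-< (m / n * n) (m%n<n m n) ⟩
  n + m / n * n         ∎
  where open ≤-Reasoning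

m*n≤o⇒m≤o/n : ∀ m n o .{{_ : NonZero n}} → m * n ≤ o → m ≤ o / n
m*n≤o⇒m≤o/n m n o h = ≤-trans (≤-reflexive (sym (m*n/n≡m m n))) (/-monoˡ-≤ n h)

^-distribʳ-* : ∀ k m n → (m * n) ^ k ≡ m ^ k * n ^ k
^-distribʳ-* zero    m n = ≡.refl
^-distribʳ-* (suc k) m n = ≡.trans (cong (m * n *_) (^-distribʳ-* k m n)) (shuffle m n (m ^ k) (n ^ k))
  where
  shuffle : ∀ a b c d → a * b * (c * d) ≡ a * c * (b * d)
  shuffle = solve-∀

-- `lowerScale s` is the threshold of `τ-gain` for exponent `suc s`, and one further Y makes room
-- for the gained vertices. In the factor 4, one 2 comes from D ≥ m₀/2 and one from rounding Y.
-- Since m ≤ `upperScale s`·Y, the power m^(s+1) is at most `loss s`·Y^(s+1).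
lowerScale upperScale loss : ℕ → ℕ
lowerScale s = 2 * 4 ^ suc s
upperScale s = 4 * suc (lowerScale s)
loss s = upperScale s ^ suc s

-- Losing more than e·α neighbours costs more than e·m^(s+1) cliques.
DegreeBound : (l s α β : ℕ) → Set
DegreeBound l s α β = ∀ m₀ d e → β * suc (e * α) ≤ suc m₀ →
  τ (suc l) (2 + s) (m₀ ∸ m₀ / (2 + l)) ≤ τ (suc l) (2 + s) d + e * suc m₀ ^ suc s →
  m₀ ∸ m₀ / (2 + l) ≤ d + e * α

-- If `d` fell short by g = e·α + 1 or more, the last `g` vertices below `D` would gain at least
-- g·Y^(s+1) cliques by `τ-gain`, while the permitted loss is at most (g - 1)·Y^(s+1).
degree-bound : ∀ l s → suc s ≤ l → DegreeBound l s (loss s) (upperScale s)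
degree-bound l s s≤l m₀ d e big h = ≮⇒≥ λ lt → 1+n≰n (*-cancelʳ-≤ (suc (e * loss s)) (e * loss s) (Y ^ suc s) {{m^n≢0 Y (suc s) {{>-nonZero Y>0}}}} (bad lt))
  where
  open ≤-Reasoning
  D = m₀ ∸ m₀ / suc (suc l)
  P = 2 * suc (lowerScale s)
  Y = m₀ / P
  g = suc (e * loss s)
  B≡ : upperScale s ≡ 2 * P
  B≡ = *-assoc 2 2 (suc (lowerScale s))
  g≤Y : g ≤ Y
  g≤Y = m*n≤o⇒m≤o/n g P m₀ (s≤s⁻¹ (begin
    suc (g * P)      ≤⟨ +-monoˡ-≤ (g * P) (s≤s (z≤n {P ∸ 1 + e * loss s * P})) ⟩
    g * P + g * P    ≡⟨ cong (g * P +_) (+-identityʳ _) ⟨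
    2 * (g * P)      ≡⟨ cong (2 *_) (*-comm g P) ⟩
    2 * (P * g)      ≡⟨ *-assoc 2 P g ⟨
    2 * P * g        ≡⟨ cong (_* g) B≡ ⟨
    upperScale s * g          ≤⟨ big ⟩
    suc m₀           ∎))
  Y>0 : 0 < Y
  Y>0 = ≤-trans (s≤s z≤n) g≤Y
  m≤BY : suc m₀ ≤ upperScale s * Y
  m≤BY = begin
    suc m₀           ≤⟨ m<[1+m/n]*n m₀ P ⟩
    suc Y * P        ≤⟨ *-monoˡ-≤ P (+-monoˡ-≤ Y Y>0) ⟩
    (Y + Y) * P      ≡⟨ cong (λ x → (Y + x) * P) (+-identityʳ Y) ⟨
    2 * Y * P        ≡⟨ *-assoc 2 Y P ⟩
    2 * (Y * P)      ≡⟨ cong (2 *_) (*-comm Y P) ⟩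
    2 * (P * Y)      ≡⟨ *-assoc 2 P Y ⟨
    2 * P * Y        ≡⟨ cong (_* Y) B≡ ⟨
    upperScale s * Y          ∎
  QY≤D : suc (lowerScale s) * Y ≤ D
  QY≤D = *-cancelˡ-≤ 2 (begin
    2 * (suc (lowerScale s) * Y)  ≡⟨ *-assoc 2 (suc (lowerScale s)) Y ⟨
    P * Y                ≡⟨ *-comm P Y ⟩
    Y * P                ≤⟨ m/n*n≤m m₀ P ⟩
    m₀                   ≤⟨ half≤ m₀ (s≤s z≤n) ⟩
    2 * D                ∎)
  bad : d + e * loss s < D → g * Y ^ suc s ≤ e * loss s * Y ^ suc s
  bad lt = +-cancelˡ-≤ (T x) _ _ (begin
    T x + g * Y ^ suc s            ≤⟨ τ-gain l (suc s) Y x g s≤l QY≤x ⟩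
    T (x + g)                      ≡⟨ cong T x+g≡D ⟩
    T D                            ≤⟨ h ⟩
    T d + e * suc m₀ ^ suc s
      ≤⟨ +-mono-≤ (τ-mono (suc l) (suc (suc s)) d≤x) (*-monoʳ-≤ e (^-monoˡ-≤ (suc s) m≤BY)) ⟩
    T x + e * (upperScale s * Y) ^ suc s
      ≡⟨ cong (λ w → T x + e * w) (^-distribʳ-* (suc s) (upperScale s) Y) ⟩
    T x + e * (loss s * Y ^ suc s)    ≡⟨ cong (T x +_) (*-assoc e (loss s) _) ⟨
    T x + e * loss s * Y ^ suc s      ∎)
    where
    T = τ (suc l) (suc (suc s))
    x = D ∸ g
    d+g≤D : d + g ≤ D
    d+g≤D = ≤-trans (≤-reflexive (+-suc d (e * loss s))) lt
    d≤x : d ≤ x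
    d≤x = m+n≤o⇒m≤o∸n d d+g≤D
    x+g≡D : x + g ≡ D
    x+g≡D = m∸n+n≡m (≤-trans (m≤n+m g d) d+g≤D)
    QY≤x : 2 * (4 ^ suc s * Y) ≤ x
    QY≤x = m+n≤o⇒m≤o∸n _ (begin
      2 * (4 ^ suc s * Y) + g   ≡⟨ cong (_+ g) (*-assoc 2 (4 ^ suc s) Y) ⟨
      lowerScale s * Y + g               ≤⟨ +-monoʳ-≤ (lowerScale s * Y) g≤Y ⟩
      lowerScale s * Y + Y               ≡⟨ +-comm (lowerScale s * Y) Y ⟩
      suc (lowerScale s) * Y             ≤⟨ QY≤D ⟩
      D                         ∎)

Linear : (ℕ → ℕ) → Set
Linear f = ∃ λ K → ∀ y → 1 ≤ y → f y ≤ K * y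

lin-const : ∀ c → Linear (const c)
lin-const c = c , λ y 1≤y → ≤-trans (≤-reflexive (sym (*-identityʳ c))) (*-monoʳ-≤ c 1≤y)

lin-id : Linear id
lin-id = 1 , λ y _ → ≤-reflexive (sym (*-identityˡ y))

lin-+ : ∀ {f g} → Linear f → Linear g → Linear (λ y → f y + g y)
lin-+ (K , p) (M , q) = K + M , λ y h → ≤-trans (+-mono-≤ (p y h) (q y h)) (≤-reflexive (sym (*-distribʳ-+ y K M)))

lin-*ˡ : ∀ {f} c → Linear f → Linear (λ y → c * f y)
lin-*ˡ c (K , p) = c * K , λ y h → ≤-trans (*-monoʳ-≤ c (p y h)) (≤-reflexive (sym (*-assoc c K y)))

lin-*ʳ : ∀ {f} c → Linear f → Linear (λ y → f y * c)
lin-*ʳ {f} c L = let K , p = lin-*ˡ c L in K , λ y h → ≤-trans (≤-reflexive (*-comm (f y) c)) (p y h)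

-- Take y to be a fixed small fraction of m₀: then `f y` stays below m₀, while y·y is quadratic in
-- m₀ and eventually exceeds any multiple of it.
intermediate-scale : ∀ {f} → Linear f → ∀ c → ∃ λ N → ∀ m₀ → N ≤ m₀ →
  ∃ λ y → 1 ≤ y × f y ≤ m₀ × c * suc m₀ ≤ y * y
intermediate-scale {f} (K , p) c = suc (2 * (c * K′)) * K′ , λ m₀ big →
  let y   = m₀ / K′
      y≥  : suc (2 * (c * K′)) ≤ y
      y≥  = m*n≤o⇒m≤o/n _ K′ m₀ big
      1≤y = ≤-trans (s≤s z≤n) y≥
  in y , 1≤y ,
     ≤-trans (p y 1≤y) (≤-trans (*-monoˡ-≤ y (n≤1+n K)) (≤-trans (≤-reflexive (*-comm K′ y)) (m/n*n≤m m₀ K′))) ,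
     (begin
       c * suc m₀               ≤⟨ *-monoʳ-≤ c (m<[1+m/n]*n m₀ K′) ⟩
       c * (suc y * K′)         ≤⟨ *-monoʳ-≤ c (*-monoˡ-≤ K′ (+-monoˡ-≤ y 1≤y)) ⟩
       c * ((y + y) * K′)       ≡⟨ shuffle c y K′ ⟩
       2 * (c * K′) * y         ≤⟨ *-monoˡ-≤ y (<⇒≤ y≥) ⟩
       y * y                    ∎)
  where
  open ≤-Reasoning
  K′ = suc K
  shuffle : ∀ c y k → c * ((y + y) * k) ≡ 2 * (c * k) * y
  shuffle = solve-∀

-- Tuples contained in copies

∈-tail : {x y : A} {xs : List A} → x ∈ y ∷ xs → x ≢ y → x ∈ xs
∈-tail (here e)  ne = contradiction e ne
∈-tail (there p) ne = p

picks-length : {L M : List A} {u : A} → (u , M) ∈ picks L → length M ≤ length L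
picks-length p = ≤-trans (n≤1+n _) (≤-reflexive (sym (↭-length (picks-↭ p))))

∈-picks-tail : {L M : List A} {u v : A} → (u , M) ∈ picks L → v ∈ L → v ≢ u → v ∈ M
∈-picks-tail p v∈ v≢u = ∈-tail (∈-resp-↭ (picks-↭ p) v∈) v≢u

picks-unique : {L M : List A} {u : A} → Unique L → (u , M) ∈ picks L → Unique M
picks-unique uL p = AllPairs.tail (Unique-resp-↭ (picks-↭ p) uL)

subsum-picks≤ : ∀ s (L : List A) (h : A → List A → ℕ) c →
  (∀ {u M} → (u , M) ∈ picks L → subsum s M (h u) ≤ c) →
  subsum (suc s) L (λ S → ∑ (picks S) (uncurry h)) ≤ length L * c
subsum-picks≤ s L h c le = begin
  subsum (suc s) L (λ S → ∑ (picks S) (uncurry h))     ≡⟨ subsum-picks s L h ⟩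
  ∑ (picks L) (λ (u , M) → subsum s M (h u))           ≤⟨ ∑-mono (picks L) le ⟩
  ∑ (picks L) (const c)                                ≡⟨ ∑-const (picks L) c ⟩
  length (picks L) * c                                 ≡⟨ cong (_* c) (length-picks L) ⟩
  length L * c                                         ∎
  where open ≤-Reasoning

subsum-∑≤ : ∀ s (L : List A) (f : A → ℕ) → subsum (suc s) L (λ S → ∑ S f) ≤ ∑ L f * length L ^ s
subsum-∑≤ s L f = begin
  subsum (suc s) L (λ S → ∑ S f)
    ≡⟨ subsum-cong (suc s) L (λ {S} _ _ → ∑-picks-fst S f) ⟨
  subsum (suc s) L (λ S → ∑ (picks S) (f ∘ proj₁))          ≡⟨ subsum-picks s L (λ u _ → f u) ⟩
  ∑ (picks L) (λ (u , M) → subsum s M (λ _ → f u))          ≤⟨ ∑-mono (picks L) (λ {(u , M)} p → begin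
      subsum s M (λ _ → f u)          ≡⟨ subsum-cong s M (λ _ _ → *-identityʳ (f u)) ⟨
      subsum s M (λ _ → f u * 1)      ≡⟨ subsum-*ˡ s M (f u) (const 1) ⟩
      f u * subsum s M (const 1)
        ≤⟨ *-monoʳ-≤ (f u) (≤-trans (subsum-1≤^ s M) (^-monoˡ-≤ s (picks-length p))) ⟩
      f u * length L ^ s              ∎) ⟩
  ∑ (picks L) (λ (u , M) → f u * length L ^ s)              ≡⟨ ∑-picks-fst L (λ u → f u * length L ^ s) ⟩
  ∑ L (λ u → f u * length L ^ s)                            ≡⟨ ∑-*ʳ L f (length L ^ s) ⟩
  ∑ L f * length L ^ s                                      ∎
  where open ≤-Reasoning

subsum-pairs≤ : ∀ s (L : List A) (g : A → A → ℕ) c → (∀ {u M} → (u , M) ∈ picks L → ∑ M (g u) ≤ c) →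
  subsum (suc (suc s)) L (λ S → ∑ (picks S) (λ (u , M) → ∑ M (g u))) ≤ length L * (c * length L ^ s)
subsum-pairs≤ s L g c le = subsum-picks≤ (suc s) L (λ u M → ∑ M (g u)) _ λ {u} {M} p →
  ≤-trans (subsum-∑≤ s M (g u)) (*-mono-≤ (le p) (^-monoˡ-≤ s (picks-length p)))

-- Choose the marked triple first, its first two elements freely and the third in at most `c` ways,
-- and then the other `s` elements freely.
subsum-triples≤ : ∀ s (L : List A) (g : A → A → A → ℕ) c → Unique L → (∀ {u v M} → Unique M → ∑ M (g u v) ≤ c) →
  subsum (suc (suc (suc s))) L (λ S → ∑ (picks S) (λ (u , M) → ∑ (picks M) (λ (v , N) → ∑ N (g u v))))
    ≤ length L * (length L * (c * length L ^ s))
subsum-triples≤ s L g c uL le = subsum-picks≤ (suc (suc s)) L (λ u M → ∑ (picks M) (λ (v , N) → ∑ N (g u v))) _ λ {u} {M} p →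
  ≤-trans (subsum-pairs≤ s M (g u) c (λ q → le (picks-unique (picks-unique uL p) q)))
    (*-mono-≤ (picks-length p) (*-monoʳ-≤ c (^-monoˡ-≤ s (picks-length p))))

∑-picks-inv : (S : List A) (f : List A → ℕ) → (∀ {S S′} → S ↭ S′ → f S ≡ f S′) →
  ∑ (picks S) (λ (v , M) → f (v ∷ M)) ≡ length S * f S
∑-picks-inv S f inv = ≡.trans (∑-cong (picks S) λ p → inv (↭-sym (picks-↭ p)))
  (≡.trans (∑-const (picks S) (f S)) (cong (_* f S) (length-picks S)))

¬AllPairs⇒∃ : {R : A → A → Set} (R? : B.Decidable R) (xs : List A) → ¬ AllPairs R xs →
  ∃ λ u → ∃₂ λ M v → (u , M) ∈ picks xs × v ∈ M × ¬ R u v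
¬AllPairs⇒∃ R? []       h = contradiction [] h
¬AllPairs⇒∃ R? (x ∷ xs) h with any? (¬? ∘ R? x) xs
... | yes p = let v , v∈ , ¬r = find p in x , xs , v , here ≡.refl , v∈ , ¬r
... | no ¬p with ¬AllPairs⇒∃ R? xs (λ q → h (All.tabulate (stable _) ∷ q))
  where
  stable : ∀ v → v ∈ xs → _
  stable v v∈ with R? x v
  ... | yes r = r
  ... | no ¬r = contradiction (lose v∈ ¬r) ¬p
... | u , M , v , p , v∈ , ¬r = u , x ∷ M , v , there (∈-map⁺ _ p) , there v∈ , ¬r

module Removal {A : Set} (_≟_ : B.DecidableEquality A) where

  infixl 6 _∖_
  _∖_ : List A → A → List A
  L ∖ v = filter (λ u → ¬? (u ≟ v)) L

  ∖-fresh : ∀ v L → All (v ≢_) L → (v ∷ L) ∖ v ≡ L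
  ∖-fresh v L v∉ with v ≟ v
  ... | yes _ = filter-all _ (All.map (_∘ sym) v∉)
  ... | no ne = contradiction ≡.refl ne

  ∖-∷ : ∀ {u v} L → u ≢ v → (u ∷ L) ∖ v ≡ u ∷ (L ∖ v)
  ∖-∷ {u} {v} L u≢v with u ≟ v
  ... | yes e = contradiction e u≢v
  ... | no _  = ≡.refl

  ∖-↭ : ∀ {v L} → Unique L → v ∈ L → L ↭ v ∷ (L ∖ v)
  ∖-↭ {v} {_ ∷ L} (v∉ ∷ uL) (here ≡.refl) = subst (λ M → v ∷ L ↭ v ∷ M) (sym (∖-fresh v L v∉)) refl
  ∖-↭ {v} {u ∷ L} (u∉ ∷ uL) (there v∈) = subst (λ M → u ∷ L ↭ v ∷ M) (sym (∖-∷ L (All.lookup u∉ v∈)))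
    (trans (prep u (∖-↭ uL v∈)) (swap u v refl))

  ∑-∖ : ∀ L → Unique L → (g : A → List A → ℕ) → ∑ L (λ v → g v (L ∖ v)) ≡ ∑ (picks L) (uncurry g)
  ∑-∖ []      _         g = ≡.refl
  ∑-∖ (u ∷ L) (u∉ ∷ uL) g = cong₂ _+_ (cong (g u) (∖-fresh u L u∉)) (≡.trans
    (∑-cong L λ {v} v∈ → cong (g v) (∖-∷ L (All.lookup u∉ v∈)))
    (≡.trans (∑-∖ L uL (λ v M → g v (u ∷ M))) (sym (∑-map _ (picks L) (uncurry g)))))

module Transversal {E : A → A → Set} (E? : B.Decidable E) where

  -- Fixing a vertex of the first list removes at most `z` vertices from each later one, so lists
  -- with more than t·z vertices survive all choices.
  greedy-transversal : ∀ t (As : List (List A)) z → length As ≡ t →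
    AllPairs (λ X Y → ∀ {w} → w ∈ X → count (¬? ∘ E? w) Y ≤ z) As →
    All (λ X → t * z < length X) As →
    ∃ λ ys → AllPairs E ys × length ys ≡ t × All (λ y → Any (y ∈_) As) ys
  greedy-transversal zero    []             z len _        _           = [] , [] , ≡.refl , []
  greedy-transversal (suc t) ([] ∷ As)      z len _        (() ∷ _)
  greedy-transversal (suc t) ((x ∷ X) ∷ As) z len (h ∷ hs) (_ ∷ sizes) =
    let ys , cl , len′ , mem = greedy-transversal t Bs z (≡.trans (length-map nbrs As) (suc-injective len)) pairs sizes′ in
    x ∷ ys , All.map (λ y∈ → proj₂ (back y∈)) mem ∷ cl , cong suc len′ ,
    here (here ≡.refl) ∷ All.map (λ y∈ → there (proj₁ (back y∈))) mem
    where
    nbrs = filter (E? x)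
    Bs   = map nbrs As
    back : ∀ {y Xs} → Any (y ∈_) (map nbrs Xs) → Any (y ∈_) Xs × E x y
    back {y} {Y ∷ Xs} (here p)  = let y∈ , e = ∈-filter⁻ (E? x) p in here y∈ , e
    back {y} {Y ∷ Xs} (there p) = let a , e = back {y} {Xs} p in there a , e
    pairs : AllPairs (λ X Y → ∀ {w} → w ∈ X → count (¬? ∘ E? w) Y ≤ z) Bs
    pairs = go hs
      where
      go : ∀ {Xs} → AllPairs (λ X Y → ∀ {w} → w ∈ X → count (¬? ∘ E? w) Y ≤ z) Xs →
        AllPairs (λ X Y → ∀ {w} → w ∈ X → count (¬? ∘ E? w) Y ≤ z) (map nbrs Xs)
      go []       = []
      go (q ∷ qs) = All.map⁺ (All.map (λ {Y} f {w} w∈ → ≤-trans (count-filter≤ (E? x) (¬? ∘ E? w) Y)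
        (f (proj₁ (∈-filter⁻ (E? x) w∈)))) q) ∷ go qs
    sizes′ : All (λ Y → t * z < length Y) Bs
    sizes′ = All.map⁺ (All.zipWith (λ {Y} (f , lt) → smaller Y (f (here ≡.refl)) lt) (h , sizes))
      where
      smaller : ∀ Y → count (¬? ∘ E? x) Y ≤ z → z + t * z < length Y → t * z < length (nbrs Y)
      smaller Y le lt = +-cancelˡ-< z _ _ (begin-strict
        z + t * z                       <⟨ lt ⟩
        length Y                                ≡⟨ count-compl (E? x) Y ⟨
        count (E? x) Y + count (¬? ∘ E? x) Y    ≤⟨ +-monoʳ-≤ (count (E? x) Y) le ⟩
        count (E? x) Y + z                      ≡⟨ +-comm _ z ⟩
        z + count (E? x) Y                      ≡⟨ cong (z +_) (length-filter≡count (E? x) Y) ⟨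
        z + length (nbrs Y)                     ∎)
        where open ≤-Reasoning

Unique-⊆ : {A : Set} {S L : List A} → S ⊆ L → Unique L → Unique S
Unique-⊆ []         []       = []
Unique-⊆ (y ∷ʳ p)   (_ ∷ u)  = Unique-⊆ p u
Unique-⊆ (≡.refl ∷ p) (h ∷ u) =
  All.tabulate (λ y∈ → All.lookup h (Sublist.lookup p y∈)) ∷ Unique-⊆ p u

∈-take : {A : Set} {x : A} → ∀ k (xs : List A) → x ∈ take k xs → x ∈ xs
∈-take (suc k) (y ∷ xs) (here e)  = here e
∈-take (suc k) (y ∷ xs) (there p) = there (∈-take k xs p)

-- Copies and light pairs in an expansion-free hypergraph

module Extremal {r n} (G : RGraph r n) (l s k : ℕ) (3≤r : 3 ≤ r) (r≤s : r ≤ 3 + s)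
  (k-big : 3 + l + suc ((3 + l) * (3 + l)) * r < k)
  (free : ¬ ContainsExpansion G (3 + l)) where

  open Kernel G k public
  open CliqueCounting _~?_ ~-sym ~-irrefl public
  open Removal (Fin._≟_ {n}) public

  no-core : ∀ {u v} xs {e} → length xs ≡ suc l → u ≢ v → All (u ~_) xs → All (v ~_) xs →
    AllPairs _~_ xs → Through u v e → ¬ All (Sub._∉ e) xs
  no-core xs len u≢v ux vx xx t av = free (subst (λ x → ContainsExpansion G (2 + x)) len
    (expansion xs u≢v ux vx xx t av (subst (λ x → 2 + x + suc ((2 + x) * (2 + x)) * r < k) (sym len) k-big)))

  -- For two vertices of a heavy clique on ℓ + 1 vertices, `avoiding` finds an edge through them
  -- that misses the others, which `no-core` forbids.
  ~-free : ∀ L → CliqueFree (2 + l) L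
  ~-free L (u ∷ v ∷ xs) _ ((uv ∷ ux) ∷ vx ∷ xx) eq =
    let e , t , av = avoiding uv xs
          (≤-<-trans (≤-trans (≤-reflexive len) (≤-trans (m≤n+m (suc l) 2) (m≤m+n _ _))) k-big)
          (All.tabulate λ f∈ → (λ { ≡.refl → ~-irrefl (All.lookup ux f∈) }) , (λ { ≡.refl → ~-irrefl (All.lookup vx f∈) }))
    in no-core xs len (~⇒≢ uv) ux vx xx t av
    where
    len : length xs ≡ suc l
    len = suc-injective (suc-injective eq)

  IsCopy : List V → Set
  IsCopy S = SpansClique G (toSub S)

  abstract
    isCopy? : Decidable IsCopy
    isCopy? S = spansClique? G (toSub S)

  abstract
    -- List the copy with `a` and `b` in front; its first `r` entries form an edge.
    copy-edge : ∀ {S a b} → Unique S → length S ≡ 3 + s → IsCopy S → a ∈ S → b ∈ S → a ≢ b →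
      ∃ λ e → Through a b e × (∀ {v} → v Sub.∈ e → v ∈ S)
    copy-edge {S} {a} {b} uS len cp a∈ b∈ a≢b = e , (edge , ∈-toSub⁺ (proj₁ ab) , ∈-toSub⁺ (proj₂ ab)) , e⊆
      where
      p₁ : ∃ λ ys → S ↭ a ∷ ys
      p₁ = ∈⇒↭ a∈
      p₂ : ∃ λ ys → proj₁ p₁ ↭ b ∷ ys
      p₂ = ∈⇒↭ (∈-tail (∈-resp-↭ (proj₂ p₁) b∈) (a≢b ∘ sym))
      S₂ : List V
      S₂ = proj₁ p₂
      S↭ : S ↭ a ∷ b ∷ S₂
      S↭ = trans (proj₂ p₁) (prep a (proj₂ p₂))
      xs : List V
      xs = take r (a ∷ b ∷ S₂)
      e : Subset n
      e = toSub xs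
      first-two : ∀ r → 2 ≤ r → a ∈ take r (a ∷ b ∷ S₂) × b ∈ take r (a ∷ b ∷ S₂)
      first-two (suc (suc r)) _ = here ≡.refl , there (here ≡.refl)
      first-two (suc zero) (s≤s ())
      ab : a ∈ xs × b ∈ xs
      ab = first-two r (<⇒≤ 3≤r)
      e⊆ : ∀ {v} → v Sub.∈ e → v ∈ S
      e⊆ v∈ = ∈-resp-↭ (↭-sym S↭) (∈-take r _ (∈-toSub⁻ xs v∈))
      ∣e∣ : ∣ e ∣ ≡ r
      ∣e∣ = ≡.trans (∣toSub∣ xs (take⁺ r (Unique-resp-↭ S↭ uS))) (≡.trans (length-take r (a ∷ b ∷ S₂))
        (m≤n⇒m⊓n≡m (≤-trans r≤s (≤-reflexive (≡.trans (sym len) (↭-length S↭))))))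
      edge : Edge G e
      edge = All.lookup cp (∈-allSubsets e) (λ v∈ → ∈-toSub⁺ (e⊆ v∈)) ∣e∣

  -- Lightness is part of the relation, so that the number of `c` is bounded uniformly in `a` and
  -- `b`: for a heavy pair there are none.
  LightCover : V → V → V → Set
  LightCover a b c = (a ≢ b × ¬ (a ~ b)) × Cover a b c

  abstract
    lightCover? : ∀ a b → Decidable (LightCover a b)
    lightCover? a b c = (¬? (a Fin.≟ b) ×-dec ¬? (a ~? b)) ×-dec cover? a b c

  count-lightCover : ∀ a b {M} → Unique M → count (lightCover? a b) M ≤ k * r
  count-lightCover a b {M} uM with ¬? (a Fin.≟ b) ×-dec ¬? (a ~? b)
  ... | yes (a≢b , a≁b) = ≤-trans
        (∑-mono M λ {c} _ → ind-elim (lightCover? a b c) λ p → ≤-reflexive (sym (ind-yes (cover? a b c) (proj₂ p))))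
        (count-cover a b M uM a≢b a≁b)
  ... | no ¬p = ≤-trans (≤-reflexive (≡.trans (∑-cong M λ {c} _ → ind-no (lightCover? a b c) (¬p ∘ proj₁))
        (≡.trans (∑-const M 0) (*-zeroʳ (length M))))) z≤n

  copy-cover : ∀ {S a b} → Unique S → length S ≡ 3 + s → IsCopy S → a ∈ S → b ∈ S → a ≢ b → ¬ (a ~ b) →
    ∃ λ c → c ∈ S × LightCover a b c
  copy-cover uS len cp a∈ b∈ a≢b a≁b =
    let e , t , e⊆ = copy-edge uS len cp a∈ b∈ a≢b
        c , c∈ , cov = light-cover 3≤r t
    in c , e⊆ c∈ , (a≢b , a≁b) , cov

  IsBad : List V → Set
  IsBad S = IsCopy S × ¬ AllPairs _~_ S

  abstract
    isBad? : Decidable IsBad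
    isBad? S = isCopy? S ×-dec ¬? (allPairs? _~?_ S)

  copy-↭ : ∀ {S S′} → S ↭ S′ → IsCopy S → IsCopy S′
  copy-↭ p = subst (SpansClique G) (toSub-↭ p)

  isCopy-↭ : ∀ {S S′} → S ↭ S′ → ind (isCopy? S) ≡ ind (isCopy? S′)
  isCopy-↭ {S} {S′} p = ind-⇔ (isCopy? S) (isCopy? S′) (copy-↭ p) (copy-↭ (↭-sym p))

  isBad-↭ : ∀ {S S′} → S ↭ S′ → ind (isBad? S) ≡ ind (isBad? S′)
  isBad-↭ {S} {S′} p = ind-⇔ (isBad? S) (isBad? S′)
    (λ (c , b) → copy-↭ p c , b ∘ AllPairs-resp-↭ ~-sym (↭-sym p))
    (λ (c , b) → copy-↭ (↭-sym p) c , b ∘ AllPairs-resp-↭ ~-sym p)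

  copy≤clique+bad : ∀ S → ind (isCopy? S) ≤ isClique S + ind (isBad? S)
  copy≤clique+bad S = ind-elim (isCopy? S) λ c → go c (allPairs? _~?_ S)
    where
    go : IsCopy S → (d : Dec (AllPairs _~_ S)) → 1 ≤ isClique S + ind (isBad? S)
    go c (yes q) = ≤-trans (≤-reflexive (sym (ind-yes (allPairs? _~?_ S) q))) (m≤m+n _ _)
    go c (no ¬q) = ≤-trans (≤-reflexive (sym (ind-yes (isBad? S) (c , ¬q)))) (m≤n+m _ _)

  -- A bad copy contains a light pair, hence an edge through it, hence a vertex of its cover. The
  -- third vertex then has `k * r` choices instead of `length L`, which saves one power.
  bad-total : ∀ L → Unique L →
    subsum (3 + s) L (λ S → ind (isBad? S)) ≤ length L * (length L * (k * r * length L ^ s))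
  bad-total L uL = ≤-trans
    (subsum-mono (3 + s) L λ {S} S⊆ len → ind-elim (isBad? S) λ (cp , ¬cl) → witness S (Unique-⊆ S⊆ uL) len cp ¬cl)
    (subsum-triples≤ s L (λ a b c → ind (lightCover? a b c)) (k * r) uL λ {u} {v} → count-lightCover u v)
    where
    witness : ∀ S → Unique S → length S ≡ 3 + s → IsCopy S → ¬ AllPairs _~_ S →
      1 ≤ ∑ (picks S) (λ (a , M) → ∑ (picks M) (λ (b , N) → count (lightCover? a b) N))
    witness S uS len cp ¬cl =
      let a , M , b , a∈ , b∈ , a≁b = ¬AllPairs⇒∃ _~?_ S ¬cl
          uM     = Unique-resp-↭ (picks-↭ a∈) uS
          a≢b    = All.lookup (AllPairs.head uM) b∈
          N , b∈′ = ∈-picks b∈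
          M↭     = ↭-sym (picks-↭ a∈)
          c , c∈ , lc@(_ , c≢a , c≢b , _) = copy-cover uS len cp (∈-resp-↭ M↭ (here ≡.refl)) (∈-resp-↭ M↭ (there b∈)) a≢b a≁b
          c∈N    = ∈-picks-tail b∈′ (∈-picks-tail a∈ c∈ c≢a) c≢b
      in ≤-trans (∈⇒count>0 (lightCover? a b) c∈N lc)
           (≤-trans (∑-∈ (λ (b , N) → count (lightCover? a b) N) b∈′)
                    (∑-∈ (λ (a , M) → ∑ (picks M) (λ (b , N) → count (lightCover? a b) N)) a∈))

  lightPair-witness : ∀ {x S u} → Unique (x ∷ S) → length S ≡ 2 + s → IsCopy (x ∷ S) → u ∈ S → ¬ (x ~ u) →
    1 ≤ ∑ (picks S) (λ (u , M) → count (lightCover? x u) M)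
  lightPair-witness {x} {S} {u} uS len cp u∈ x≁u =
    let x≢u = All.lookup (AllPairs.head uS) u∈
        c , c∈ , lc@(_ , c≢x , c≢u , _) = copy-cover uS (cong suc len) cp (here ≡.refl) (there u∈) x≢u x≁u
        M , u∈′ = ∈-picks u∈
        c∈M = ∈-picks-tail u∈′ (∈-tail c∈ c≢x) c≢u
    in ≤-trans (∈⇒count>0 (lightCover? x u) c∈M lc) (∑-∈ (λ (u , M) → count (lightCover? x u) M) u∈′)

  -- One end of the light pair is fixed to be `x`, so there is one power of the length fewer than in
  -- `bad-total`.
  lightPairs-at : ∀ x L → Unique L →
    subsum (2 + s) L (λ S → ∑ (picks S) (λ (u , M) → count (lightCover? x u) M)) ≤ length L * (k * r * length L ^ s)
  lightPairs-at x L uL = subsum-pairs≤ s L (λ u c → ind (lightCover? x u c)) (k * r)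
    λ {u} p → count-lightCover x u (picks-unique uL p)

  degree : List V → V → ℕ
  degree L v = subsum (2 + s) (L ∖ v) (λ S → ind (isCopy? (v ∷ S)))

  -- This is the increment of `τ (2 + l) (3 + s)` from `m₀` to `suc m₀`, hence the exact threshold
  -- for deleting a vertex.
  minDegree : ℕ → ℕ
  minDegree m₀ = τ (suc l) (2 + s) (m₀ ∸ m₀ / (2 + l))

-- When every part of the balanced partition has about p vertices: a class has at
-- least p − z₁ vertices, a vertex of a class misses at most z vertices of any other
-- class, at most e vertices are wasted in the degree of any vertex, and hence every
-- vertex misses at most z₂ vertices of each class but one.
module Scales (l α c : ℕ) where
  abstract
    z₁ z e z₂ : ℕ → ℕ
    z₁ y = y + suc l * (y * α) + (2 + l)
    z  y = y * α + z₁ y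
    e  y = c + ((2 + l) * z₁ y + (2 + l) * z y)
    z₂ y = e y * α + z₁ y

    z₁-def : ∀ y → z₁ y ≡ y + suc l * (y * α) + (2 + l)
    z₁-def y = ≡.refl

    z-def : ∀ y → z y ≡ y * α + z₁ y
    z-def y = ≡.refl

    e-def : ∀ y → e y ≡ c + ((2 + l) * z₁ y + (2 + l) * z y)
    e-def y = ≡.refl

    z₂-def : ∀ y → z₂ y ≡ e y * α + z₁ y
    z₂-def y = ≡.refl

    y≤e : ∀ y → y ≤ e y
    y≤e y = ≤-trans (m≤m+n y _) (≤-trans (m≤m+n _ (2 + l))
      (≤-trans (m≤n*m (z₁ y) (2 + l)) (≤-trans (m≤m+n _ ((2 + l) * z y)) (m≤n+m _ c))))

    z≤z₂ : ∀ y → z y ≤ z₂ y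
    z≤z₂ y = +-monoˡ-≤ (z₁ y) (*-monoˡ-≤ α (y≤e y))

    lin-z₁ : Linear z₁
    lin-z₁ = lin-+ (lin-+ lin-id (lin-*ˡ (suc l) (lin-*ʳ α lin-id))) (lin-const (2 + l))

    lin-z : Linear z
    lin-z = lin-+ (lin-*ʳ α lin-id) lin-z₁

    lin-e : Linear e
    lin-e = lin-+ (lin-const c) (lin-+ (lin-*ˡ (2 + l) lin-z₁) (lin-*ˡ (2 + l) lin-z))

    lin-z₂ : Linear z₂
    lin-z₂ = lin-+ (lin-*ʳ α lin-e) lin-z₁

-- Hypergraphs of large minimum degree

module Dense {r n} (G : RGraph r n) (l s k : ℕ) (3≤r : 3 ≤ r) (r≤s : r ≤ 3 + s)
  (k-big : 3 + l + suc ((3 + l) * (3 + l)) * r < k)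
  (free : ¬ ContainsExpansion G (3 + l))
  (α β : ℕ) (deg-bound : DegreeBound l s α β) where

  open Extremal G l s k 3≤r r≤s k-big free
  open Scales l α (k * r)

  module _ (L : List V) (uL : Unique L) (m₀ : ℕ) (len : length L ≡ suc m₀)
    (y : ℕ) (1≤y : 1 ≤ y) (y²-big : (3 + s) * (k * r) * suc m₀ ≤ y * y)
    (m-big : β * suc (e y * α) ≤ suc m₀)
    (p-big : z₁ y + (z₂ y + z₂ y) + r + (2 + l) * z y < suc (m₀ / (2 + l)))
    (deg : ∀ {v} → v ∈ L → minDegree m₀ ≤ degree L v) where

    -- In the Turán graph on `m` vertices, `p` is the size of a largest part and `D` the minimum
    -- degree. `M` is the unit in which lost copies at a vertex are measured.
    p D m M : ℕ
    p = suc (m₀ / (2 + l))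
    D = m₀ ∸ m₀ / (2 + l)
    m = suc m₀
    M = m ^ suc s

    D+p≡m : D + p ≡ m
    D+p≡m = ≡.trans (+-suc D _) (cong suc (m∸n+n≡m (m/n≤m m₀ (2 + l))))

    m≤pℓ : m ≤ p * (2 + l)
    m≤pℓ = m<[1+m/n]*n m₀ (2 + l)

    pℓ≤m₀+ℓ : p * (2 + l) ≤ m₀ + (2 + l)
    pℓ≤m₀+ℓ = ≤-trans (+-monoʳ-≤ (2 + l) (m/n*n≤m m₀ (2 + l))) (≤-reflexive (+-comm (2 + l) m₀))

    badAt : V → ℕ
    badAt v = subsum (2 + s) (L ∖ v) (λ S → ind (isBad? (v ∷ S)))

    Good : V → Set
    Good v = badAt v ≤ y * M

    abstract
      good? : Decidable Good
      good? v = badAt v ≤? y * M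

    -- Each bad copy is counted once at each of its 3 + s vertices, and `y²-big` absorbs the
    -- constants.
    ∑-badAt : ∑ L badAt ≤ y * y * M
    ∑-badAt = begin
      ∑ L badAt
        ≡⟨ ∑-∖ L uL (λ v K → subsum (2 + s) K (λ S → ind (isBad? (v ∷ S)))) ⟩
      ∑ (picks L) (λ (v , K) → subsum (2 + s) K (λ S → ind (isBad? (v ∷ S))))
        ≡⟨ subsum-picks (2 + s) L (λ v S → ind (isBad? (v ∷ S))) ⟨
      subsum (3 + s) L (λ S → ∑ (picks S) (λ (v , K) → ind (isBad? (v ∷ K))))
        ≡⟨ subsum-cong (3 + s) L (λ {S} _ len → ≡.trans
           (∑-picks-inv S (λ S → ind (isBad? S)) isBad-↭) (cong (_* ind (isBad? S)) len)) ⟩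
      subsum (3 + s) L (λ S → (3 + s) * ind (isBad? S))
        ≡⟨ subsum-*ˡ (3 + s) L (3 + s) (λ S → ind (isBad? S)) ⟩
      (3 + s) * subsum (3 + s) L (λ S → ind (isBad? S))
        ≤⟨ *-monoʳ-≤ (3 + s) (bad-total L uL) ⟩
      (3 + s) * (length L * (length L * (k * r * length L ^ s)))
        ≡⟨ cong (λ x → (3 + s) * (x * (x * (k * r * x ^ s)))) len ⟩
      (3 + s) * (m * (m * (k * r * m ^ s)))
        ≡⟨ shuffle (3 + s) m (k * r) (m ^ s) ⟩
      (3 + s) * (k * r) * m * (m * m ^ s)                                      ≤⟨ *-monoˡ-≤ M y²-big ⟩
      y * y * M                                                                ∎
      where
      open ≤-Reasoning
      shuffle : ∀ a b c d → a * (b * (b * (c * d))) ≡ a * c * b * (b * d)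
      shuffle = solve-∀

    -- Markov's inequality: each exceptional vertex uses more than `y * M` of the total `y * y * M`.
    few-bad : count (¬? ∘ good?) L ≤ y
    few-bad = *-cancelʳ-≤ _ y (y * M) {{m*n≢0 y M {{>-nonZero 1≤y}} {{m^n≢0 m (suc s)}}}} (begin
      count (¬? ∘ good?) L * (y * M)                ≡⟨ ∑-*ʳ L (ind ∘ ¬? ∘ good?) (y * M) ⟨
      ∑ L (λ v → ind (¬? (good? v)) * (y * M))      ≤⟨ ∑-mono L (λ {v} _ → pt v (good? v)) ⟩
      ∑ L badAt                                     ≤⟨ ∑-badAt ⟩
      y * y * M                                     ≡⟨ *-assoc y y M ⟩
      y * (y * M)                                   ∎)
      where
      open ≤-Reasoning
      pt : ∀ v (d : Dec (Good v)) → ind (¬? d) * (y * M) ≤ badAt v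
      pt v (yes _) = z≤n
      pt v (no ¬g) = ≤-trans (≤-reflexive (+-identityʳ _)) (<⇒≤ (≰⇒> ¬g))

    no-clique : ∀ S → AllPairs _~_ S → length S ≢ 3 + l
    no-clique S = ~-free S S (All.tabulate id)

    -- All but y·M copies at `v` are heavy cliques in its heavy neighbourhood, which has no heavy
    -- clique on ℓ vertices. Zykov's bound there and `deg-bound` make the neighbourhood large.
    good-nbrs : ∀ {v} → v ∈ L → Good v → non-nbrs v L ≤ p + y * α
    good-nbrs {v} v∈ gv = +-cancelˡ-≤ nb _ _ (begin
      nb + non-nbrs v L        ≡⟨ count-compl (v ~?_) L ⟩
      length L                 ≡⟨ len ⟩
      m                        ≡⟨ D+p≡m ⟨
      D + p                    ≤⟨ +-monoˡ-≤ p (deg-bound m₀ nb y h₁ enough) ⟩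
      nb + y * α + p           ≡⟨ +-assoc nb (y * α) p ⟩
      nb + (y * α + p)         ≡⟨ cong (nb +_) (+-comm (y * α) p) ⟩
      nb + (p + y * α)         ∎)
      where
      open ≤-Reasoning
      nb = count (v ~?_) L
      N  = filter (v ~?_) (L ∖ v)
      h₁ : β * suc (y * α) ≤ suc m₀
      h₁ = ≤-trans (*-monoʳ-≤ β (s≤s (*-monoˡ-≤ α (y≤e y)))) m-big
      freeN : CliqueFree (suc l) N
      freeN S S⊆ cl eq = no-clique (v ∷ S) (All.map (λ u∈ → proj₂ (∈-filter⁻ (v ~?_) {xs = L ∖ v} u∈)) S⊆ ∷ cl) (cong suc eq)
      N≤ : length N ≤ nb
      N≤ = ≤-trans (≤-reflexive (length-filter≡count (v ~?_) (L ∖ v))) (count-filter≤ (λ u → ¬? (u Fin.≟ v)) (v ~?_) L)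
      enough : τ (suc l) (2 + s) D ≤ τ (suc l) (2 + s) nb + y * M
      enough = begin
        τ (suc l) (2 + s) D                                                      ≤⟨ deg v∈ ⟩
        subsum (2 + s) (L ∖ v) (λ S → ind (isCopy? (v ∷ S)))
          ≤⟨ subsum-mono (2 + s) (L ∖ v) (λ {S} _ _ → copy≤clique+bad (v ∷ S)) ⟩
        subsum (2 + s) (L ∖ v) (λ S → isClique (v ∷ S) + ind (isBad? (v ∷ S)))
          ≡⟨ subsum-+ (2 + s) (L ∖ v) (λ S → isClique (v ∷ S)) (λ S → ind (isBad? (v ∷ S))) ⟩
        subsum (2 + s) (L ∖ v) (λ S → isClique (v ∷ S)) + badAt v
          ≡⟨ cong (_+ badAt v) (subsum-clique-∷ (2 + s) v (L ∖ v)) ⟩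
        subsum (2 + s) N isClique + badAt v
          ≤⟨ +-mono-≤ (≤-trans (zykov (suc l) (2 + s) N freeN) (τ-mono (suc l) (2 + s) N≤)) gv ⟩
        τ (suc l) (2 + s) nb + y * M                                             ∎

    abstract
      -- Good vertices miss few others, so the greedy choice reaches ℓ of them; `p` exceeding `z₁ y`
      -- leaves enough room.
      core-clique : ∃ λ S → All (_∈ filter good? L) S × AllPairs _~_ S × length S ≡ 2 + l
      core-clique = greedy-clique (suc l) (p + y * α) (filter good? L)
        (λ {v} v∈ → let v∈L , gv = ∈-filter⁻ good? v∈ in ≤-trans (count-filter≤ good? (¬? ∘ (v ~?_)) L) (good-nbrs v∈L gv))
        (+-cancelʳ-< y _ _ (begin-strict
          suc l * (p + y * α) + y                        <⟨ +-cancelʳ-< (2 + l) _ _ (begin-strict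
              suc l * (p + y * α) + y + (2 + l)
                ≡⟨ ≡.trans (shuffle (suc l) p (y * α) y (2 + l)) (cong (_+ suc l * p) (sym (z₁-def y))) ⟩
              z₁ y + suc l * p
                <⟨ +-monoˡ-< (suc l * p) (≤-<-trans (≤-trans (m≤m+n _ _) (≤-trans (m≤m+n _ _) (m≤m+n _ _))) p-big) ⟩
              p + suc l * p                        ≡⟨ *-comm (2 + l) p ⟩
              p * (2 + l)                          ≤⟨ pℓ≤m₀+ℓ ⟩
              m₀ + (2 + l)                         <⟨ +-monoˡ-< (2 + l) (n<1+n m₀) ⟩
              m + (2 + l)                          ∎) ⟩
          m                                              ≡⟨ len ⟨
          length L                                       ≡⟨ count-compl good? L ⟨
          count good? L + count (¬? ∘ good?) L
            ≤⟨ +-mono-≤ (≤-reflexive (sym (length-filter≡count good? L))) few-bad ⟩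
          length (filter good? L) + y                    ∎))
        where
        open ≤-Reasoning
        shuffle : ∀ a p t y b → a * (p + t) + y + b ≡ y + a * t + b + a * p
        shuffle = solve-∀

    xs : List V
    xs = proj₁ core-clique

    xs-clique : AllPairs _~_ xs
    xs-clique = proj₁ (proj₂ (proj₂ core-clique))

    xs-length : length xs ≡ 2 + l
    xs-length = proj₂ (proj₂ (proj₂ core-clique))

    xs-good : ∀ {x} → x ∈ xs → x ∈ L × Good x
    xs-good x∈ = ∈-filter⁻ good? (All.lookup (proj₁ (proj₂ core-clique)) x∈)

    xs-unique : Unique xs
    xs-unique = AllPairs.map ~⇒≢ xs-clique

    rest-length : ∀ {x} → x ∈ xs → length (xs ∖ x) ≡ suc l
    rest-length x∈ = suc-injective (≡.trans (sym (↭-length (∖-↭ xs-unique x∈))) xs-length)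

    rest-clique : ∀ {x} → x ∈ xs → AllPairs _~_ (xs ∖ x)
    rest-clique x∈ = AllPairs.tail (AllPairs-resp-↭ ~-sym (∖-↭ xs-unique x∈) xs-clique)

    ∈-rest⁻ : ∀ {x x′} → x′ ∈ xs ∖ x → x′ ∈ xs × x′ ≢ x
    ∈-rest⁻ {x} = ∈-filter⁻ (λ u → ¬? (u Fin.≟ x))

    -- The class of x: the good vertices attached to the core clique exactly as x is.
    InV : V → V → Set
    InV x u = Good u × ¬ (u ~ x) × All (λ x′ → x′ ≢ x → u ~ x′) xs

    abstract
      inV? : ∀ x → Decidable (InV x)
      inV? x u = good? u ×-dec ¬? (u ~? x) ×-dec all? (λ x′ → ¬? (x′ Fin.≟ x) →-dec (u ~? x′)) xs

    inV-rest : ∀ {x u} → InV x u → All (u ~_) (xs ∖ x)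
    inV-rest (_ , _ , h) = All.tabulate λ x′∈ → let x′∈xs , ne = ∈-rest⁻ x′∈ in All.lookup h x′∈xs ne

    -- A vertex joined to the rest of the core clique cannot be joined to `x` as well, since that
    -- would give a heavy clique on ℓ + 1 vertices.
    inV-intro : ∀ {x u} → x ∈ xs → Good u → All (u ~_) (xs ∖ x) → InV x u
    inV-intro {x} {u} x∈ gu h = gu ,
      (λ u~x → no-clique (u ∷ x ∷ (xs ∖ x)) ((u~x ∷ h) ∷ AllPairs-resp-↭ ~-sym (∖-↭ xs-unique x∈) xs-clique)
        (cong (2 +_) (rest-length x∈))) ,
      All.tabulate λ x′∈ ne → All.lookup h (∈-filter⁺ (λ u → ¬? (u Fin.≟ x)) x′∈ ne)

    inV-independent : ∀ {x u w} → x ∈ xs → InV x u → InV x w → ¬ (u ~ w)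
    inV-independent {x} {u} {w} x∈ hu hw u~w = no-clique (u ∷ w ∷ (xs ∖ x))
      ((u~w ∷ inV-rest hu) ∷ inV-rest hw ∷ rest-clique x∈) (cong (2 +_) (rest-length x∈))

    inV-disjoint : ∀ {x x′ u} → x′ ∈ xs → InV x u → InV x′ u → x ≡ x′
    inV-disjoint {x} {x′} x′∈ (_ , _ , h) (_ , ¬u~x′ , _) with x Fin.≟ x′
    ... | yes e = e
    ... | no ne = contradiction (All.lookup h x′∈ (ne ∘ sym)) ¬u~x′

    -- A vertex outside the class is one of at most `y` that are not good, or it misses one of the l
    -- + 1 other core vertices, each missed by at most p + y·α.
    class-lower : ∀ {x} → x ∈ xs → p ≤ count (inV? x) L + z₁ y
    class-lower {x} x∈ = +-cancelʳ-≤ (suc l * p) _ _ (begin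
      p + suc l * p                                             ≡⟨ *-comm (2 + l) p ⟩
      p * (2 + l)                                               ≤⟨ pℓ≤m₀+ℓ ⟩
      m₀ + (2 + l)
        ≤⟨ +-monoˡ-≤ (2 + l) (≤-trans (n≤1+n m₀) covered) ⟩
      cV + y + suc l * (p + y * α) + (2 + l)
        ≡⟨ ≡.trans (shuffle cV y (suc l) p (y * α) (2 + l)) (cong (λ w → cV + w + suc l * p) (sym (z₁-def y))) ⟩
      cV + z₁ y + suc l * p                                     ∎)
      where
      open ≤-Reasoning
      cV = count (inV? x) L
      shuffle : ∀ c y a p t b → c + y + a * (p + t) + b ≡ c + (y + a * t + b) + a * p
      shuffle = solve-∀
      pt : ∀ u (g : Dec (Good u)) (a : Dec (Any (λ x′ → ¬ (u ~ x′)) (xs ∖ x))) →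
        1 ≤ ind (inV? x u) + ind (¬? (good? u)) + count (λ x′ → ¬? (u ~? x′)) (xs ∖ x)
      pt u (no ¬g) _       = ≤-trans (≤-trans (1≤ind (¬? (good? u)) ¬g) (m≤n+m _ (ind (inV? x u)))) (m≤m+n _ _)
      pt u (yes g) (yes a) = let x′ , x′∈ , ne = find a in
        ≤-trans (∈⇒count>0 (λ x′ → ¬? (u ~? x′)) x′∈ ne) (m≤n+m _ _)
      pt u (yes g) (no ¬a) = ≤-trans (≤-trans (1≤ind (inV? x u) (inV-intro x∈ g (All.tabulate λ {x′} x′∈ → stable x′ x′∈))) (m≤m+n _ _)) (m≤m+n _ _)
        where
        stable : ∀ x′ → x′ ∈ xs ∖ x → u ~ x′
        stable x′ x′∈ with u ~? x′
        ... | yes h = h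
        ... | no ¬h = contradiction (lose x′∈ ¬h) ¬a
      covered : m ≤ cV + y + suc l * (p + y * α)
      covered = begin
        m                                                 ≡⟨ len ⟨
        length L                                          ≡⟨ ≡.trans (∑-const L 1) (*-identityʳ _) ⟨
        ∑ L (const 1)
          ≤⟨ ∑-mono L (λ {u} _ → pt u (good? u) (any? (λ x′ → ¬? (u ~? x′)) (xs ∖ x))) ⟩
        ∑ L (λ u → ind (inV? x u) + ind (¬? (good? u)) + count (λ x′ → ¬? (u ~? x′)) (xs ∖ x))
          ≡⟨ ≡.trans (∑-+ L _ _) (cong₂ _+_ (∑-+ L _ _) (∑-swap L (xs ∖ x) (λ u x′ → ind (¬? (u ~? x′))))) ⟩
        cV + count (¬? ∘ good?) L + ∑ (xs ∖ x) (λ x′ → count (λ u → ¬? (u ~? x′)) L)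
          ≤⟨ +-mono-≤ (+-monoʳ-≤ cV few-bad) (∑-mono (xs ∖ x) λ {x′} x′∈ →
               let x′∈L , gx′ = xs-good (proj₁ (∈-rest⁻ x′∈)) in
               ≤-trans (count-mono (λ u → ¬? (u ~? x′)) (¬? ∘ (x′ ~?_)) L (λ _ ne → ne ∘ ~-sym)) (good-nbrs x′∈L gx′)) ⟩
        cV + y + ∑ (xs ∖ x) (const (p + y * α))
          ≡⟨ cong (cV + y +_) (≡.trans (∑-const (xs ∖ x) _) (cong (_* (p + y * α)) (rest-length x∈))) ⟩
        cV + y + suc l * (p + y * α)                      ∎

    missed : V → V → ℕ
    missed u x = count (λ w → inV? x w ×-dec ¬? (u ~? w)) L

    -- A good vertex misses at most p + y·α vertices, and nearly `p` of these are used up by its own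
    -- class.
    class-missed : ∀ {x x′ u} → u ∈ L → x ∈ xs → x′ ∈ xs → x′ ≢ x → InV x u → missed u x′ ≤ z y
    class-missed {x} {x′} {u} u∈ x∈ x′∈ x′≢x hu = +-cancelʳ-≤ p _ _ (begin
      missed u x′ + p                              ≤⟨ +-monoʳ-≤ (missed u x′) (class-lower x∈) ⟩
      missed u x′ + (count (inV? x) L + z₁ y)      ≡⟨ +-assoc (missed u x′) _ _ ⟨
      missed u x′ + count (inV? x) L + z₁ y
        ≤⟨ +-monoˡ-≤ (z₁ y) (count-disjoint (λ w → inV? x′ w ×-dec ¬? (u ~? w)) (inV? x) (¬? ∘ (u ~?_)) L
                                                        (λ _ → proj₂) (λ _ → inV-independent x∈ hu)
                                                        (λ _ (h , _) h′ → x′≢x (inV-disjoint x∈ h h′))) ⟩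
      non-nbrs u L + z₁ y                          ≤⟨ +-monoˡ-≤ (z₁ y) (good-nbrs u∈ (proj₁ hu)) ⟩
      p + y * α + z₁ y
        ≡⟨ ≡.trans (+-assoc p _ _) (≡.trans (cong (p +_) (sym (z-def y))) (+-comm p (z y))) ⟩
      z y + p                                      ∎)
      where open ≤-Reasoning

    -- An approximate form of class membership that also makes sense for vertices that are not good.
    Fits : V → V → Set
    Fits x u = ∀ {x′} → x′ ∈ xs → x′ ≢ x → missed u x′ ≤ z₂ y

    inV-fits : ∀ {x u} → u ∈ L → x ∈ xs → InV x u → Fits x u
    inV-fits u∈ x∈ hu x′∈ ne = ≤-trans (class-missed u∈ x∈ x′∈ ne hu) (z≤z₂ y)

    abstract
      -- `Q` narrows the classes, so that the clique can be joined to prescribed vertices or kept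
      -- off a given edge.
      classes-transversal : ∀ {Q : V → V → Set} (Q? : ∀ x → Decidable (Q x)) → (∀ {x u} → Q x u → InV x u) →
        ∀ t ks → (∀ {x} → x ∈ ks → x ∈ xs) → Unique ks → length ks ≡ t →
        (∀ {x} → x ∈ ks → t * z y < length (filter (Q? x) L)) →
        ∃ λ ys → AllPairs _~_ ys × length ys ≡ t × All (λ w → ∃ λ x → Q x w) ys
      classes-transversal Q? Q⇒ t ks ks⊆ uks lks big =
        let ys , cl , leny , mem = greedy-transversal t (map class ks) (z y) (≡.trans (length-map class ks) lks)
              (AllPairs.map⁺ (unique⇒AllPairs ks uks λ {x} {x′} x∈ x′∈ ne {w} w∈ →
                let w∈L , qw = ∈-filter⁻ (Q? x) {xs = L} w∈ in
                ≤-trans (count-filter-mono (Q? x′) (¬? ∘ (w ~?_)) (λ u → inV? x′ u ×-dec ¬? (w ~? u)) L (λ q ne → Q⇒ q , ne))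
                  (class-missed w∈L (ks⊆ x∈) (ks⊆ x′∈) (ne ∘ sym) (Q⇒ qw))))
              (All.map⁺ (All.tabulate big))
        in ys , cl , leny , All.map (λ y∈ → let X , X∈ , w∈ = find y∈
                                                x , _ , X≡ = ∈-map⁻ class X∈
                                            in x , proj₂ (∈-filter⁻ (Q? x) {xs = L} (subst (_ ∈_) X≡ w∈))) mem
        where
        open Transversal _~?_
        class : V → List V
        class x = filter (Q? x) L

    -- Otherwise the other l + 1 classes contain a heavy clique joined to both `u` and `v` and
    -- disjoint from `e`. With `e` serving the possibly light pair, this is the forbidden expansion.
    separated : ∀ {x u v e} → x ∈ xs → Fits x u → Fits x v → u ≢ v → ¬ Through u v e
    separated {x} {u} {v} {e} x∈ fu fv u≢v t =
      let ys , cl , leny , mem = classes-transversal Q? proj₁ (suc l) (xs ∖ x) (proj₁ ∘ ∈-rest⁻)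
            (filter⁺ (λ u → ¬? (u Fin.≟ x)) xs-unique) (rest-length x∈) big
      in no-core ys leny u≢v (All.map (λ (_ , q) → proj₁ (proj₂ q)) mem) (All.map (λ (_ , q) → proj₁ (proj₂ (proj₂ q))) mem)
           cl t (All.map (λ (_ , q) → proj₂ (proj₂ (proj₂ q))) mem)
      where
      open ≤-Reasoning
      Q : V → V → Set
      Q x′ w = InV x′ w × u ~ w × v ~ w × w Sub.∉ e
      Q? : ∀ x′ → Decidable (Q x′)
      Q? x′ w = inV? x′ w ×-dec (u ~? w) ×-dec (v ~? w) ×-dec ¬? (w ∈? e)
      -- A class loses at most `z₂ y` vertices to each of `u` and `v` and `r` to the edge; `p-big`
      -- was chosen for this.
      big : ∀ {x′} → x′ ∈ xs ∖ x → suc l * z y < length (filter (Q? x′) L)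
      big {x′} x′∈ = ≤-<-trans (m≤n+m _ (z y)) (+-cancelˡ-< (z₁ y + (z₂ y + z₂ y) + r) _ _ (begin-strict
        z₁ y + (z₂ y + z₂ y) + r + (2 + l) * z y       <⟨ p-big ⟩
        p                                              ≤⟨ class-lower (proj₁ (∈-rest⁻ x′∈)) ⟩
        count (inV? x′) L + z₁ y
          ≤⟨ +-monoˡ-≤ (z₁ y) (∑-mono L (λ {w} _ → ind-elim (inV? x′ w) (λ h → pt w h (u ~? w) (v ~? w) (w ∈? e)))) ⟩
        ∑ L (λ w → ind (Q? x′ w) + (ind (inV? x′ w ×-dec ¬? (u ~? w)) + ind (inV? x′ w ×-dec ¬? (v ~? w))) + ind (w ∈? e)) + z₁ y
          ≡⟨ cong (_+ z₁ y) (≡.trans (∑-+ L _ _) (cong (_+ count (_∈? e) L) (≡.trans (∑-+ L _ _) (cong (count (Q? x′) L +_) (∑-+ L _ _))))) ⟩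
        count (Q? x′) L + (missed u x′ + missed v x′) + count (_∈? e) L + z₁ y
          ≤⟨ +-monoˡ-≤ (z₁ y) (+-mono-≤ (+-mono-≤ (≤-reflexive (sym (length-filter≡count (Q? x′) L)))
               (+-mono-≤ (fu (proj₁ (∈-rest⁻ x′∈)) (proj₂ (∈-rest⁻ x′∈))) (fv (proj₁ (∈-rest⁻ x′∈)) (proj₂ (∈-rest⁻ x′∈)))))
               (≤-trans (count-∈≤ e L uL) (≤-reflexive (uniform G e (proj₁ t))))) ⟩
        length (filter (Q? x′) L) + (z₂ y + z₂ y) + r + z₁ y
          ≡⟨ shuffle (length (filter (Q? x′) L)) (z₂ y + z₂ y) r (z₁ y) ⟩
        z₁ y + (z₂ y + z₂ y) + r + length (filter (Q? x′) L)      ∎))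
        where
        shuffle : ∀ a b c d → a + b + c + d ≡ d + b + c + a
        shuffle = solve-∀
        pt : ∀ w → InV x′ w → Dec (u ~ w) → Dec (v ~ w) → Dec (w Sub.∈ e) →
          1 ≤ ind (Q? x′ w) + (ind (inV? x′ w ×-dec ¬? (u ~? w)) + ind (inV? x′ w ×-dec ¬? (v ~? w))) + ind (w ∈? e)
        pt w h (no a) _ _ = ≤-trans (≤-trans (≤-trans (1≤ind (inV? x′ w ×-dec ¬? (u ~? w)) (h , a)) (m≤m+n _ _)) (m≤n+m _ (ind (Q? x′ w)))) (m≤m+n _ _)
        pt w h _ (no b) _ = ≤-trans (≤-trans (≤-trans (1≤ind (inV? x′ w ×-dec ¬? (v ~? w)) (h , b)) (m≤n+m _ _)) (m≤n+m _ (ind (Q? x′ w)))) (m≤m+n _ _)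
        pt w h _ _ (yes c) = ≤-trans (1≤ind (w ∈? e) c) (m≤n+m _ _)
        pt w h (yes a) (yes b) (no c) = ≤-trans (≤-trans (1≤ind (Q? x′ w) (h , a , b , c)) (m≤m+n _ _)) (m≤m+n _ _)

    Core : V → Set
    Core u = Any (λ x → InV x u) xs

    abstract
      core? : Decidable Core
      core? u = any? (λ x → inV? x u) xs

    -- The ℓ classes are disjoint and each has at least p - z₁ vertices, while ℓ·p ≥ m.
    few-coreless : count (¬? ∘ core?) L ≤ (2 + l) * z₁ y
    few-coreless = +-cancelˡ-≤ m _ _ (begin
      m + cR                                                   ≤⟨ +-monoˡ-≤ cR m≤pℓ ⟩
      p * (2 + l) + cR
        ≡⟨ cong (_+ cR) (≡.trans (∑-const xs p) (≡.trans (cong (_* p) xs-length) (*-comm (2 + l) p))) ⟨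
      ∑ xs (const p) + cR                                      ≤⟨ +-monoˡ-≤ cR (∑-mono xs class-lower) ⟩
      ∑ xs (λ x → count (inV? x) L + z₁ y) + cR
        ≡⟨ cong (_+ cR) (≡.trans (∑-+ xs _ _) (cong (∑ xs (λ x → count (inV? x) L) +_) (≡.trans (∑-const xs (z₁ y)) (cong (_* z₁ y) xs-length)))) ⟩
      ∑ xs (λ x → count (inV? x) L) + (2 + l) * z₁ y + cR
        ≡⟨ shuffle (∑ xs (λ x → count (inV? x) L)) _ cR ⟩
      ∑ xs (λ x → count (inV? x) L) + cR + (2 + l) * z₁ y
        ≡⟨ cong (λ w → w + cR + (2 + l) * z₁ y) (∑-swap xs L (λ x u → ind (inV? x u))) ⟩
      ∑ L (λ u → count (λ x → inV? x u) xs) + cR + (2 + l) * z₁ y   ≡⟨ cong (_+ (2 + l) * z₁ y) (∑-+ L _ _) ⟨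
      ∑ L (λ u → count (λ x → inV? x u) xs + ind (¬? (core? u))) + (2 + l) * z₁ y
        ≤⟨ +-monoˡ-≤ ((2 + l) * z₁ y) (∑-mono L λ {u} _ → pt u (core? u)) ⟩
      ∑ L (const 1) + (2 + l) * z₁ y
        ≡⟨ cong (_+ (2 + l) * z₁ y) (≡.trans (∑-const L 1) (≡.trans (*-identityʳ _) len)) ⟩
      m + (2 + l) * z₁ y                                       ∎)
      where
      open ≤-Reasoning
      cR = count (¬? ∘ core?) L
      shuffle : ∀ a b c → a + b + c ≡ a + c + b
      shuffle = solve-∀
      pt : ∀ u (d : Dec (Core u)) → count (λ x → inV? x u) xs + ind (¬? d) ≤ 1
      pt u (yes _) = ≤-trans (≤-reflexive (+-identityʳ _)) (count≤1 (λ x → inV? x u) xs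
        (unique⇒AllPairs xs xs-unique λ x∈ x′∈ ne (h , h′) → ne (inV-disjoint x′∈ h h′)))
      pt u (no ¬c) = +-monoˡ-≤ 1 (≤-reflexive (≡.trans
        (∑-cong xs λ {x} x∈ → ind-no (inV? x u) λ h → ¬c (lose x∈ h)) (≡.trans (∑-const xs 0) (*-zeroʳ (length xs)))))

    -- The first listed vertex to which `u` is not joined; a vertex joined to all keeps itself as
    -- colour. On a class it is the core vertex naming the class.
    colour : List V → V → V
    colour []       u = u
    colour (x ∷ ks) u with u ~? x
    ... | yes _ = colour ks u
    ... | no  _ = x

    colour-spec : ∀ {u x} ks → x ∈ ks → ¬ (u ~ x) → (∀ {x′} → x′ ∈ ks → x′ ≢ x → u ~ x′) → colour ks u ≡ x
    colour-spec {u} {x} (k₀ ∷ ks) x∈ u≁x h with u ~? k₀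
    colour-spec {u} {x} (k₀ ∷ ks) (here ≡.refl) u≁x h | yes u~x = contradiction u~x u≁x
    colour-spec {u} {x} (k₀ ∷ ks) (there x∈)    u≁x h | yes _   = colour-spec ks x∈ u≁x (h ∘ there)
    ... | no u≁k₀ with k₀ Fin.≟ x
    ... | yes e = e
    ... | no ne = contradiction (h (here ≡.refl) ne) u≁k₀

    inV-colour : ∀ {x u} → x ∈ xs → InV x u → colour xs u ≡ x
    inV-colour x∈ (_ , u≁x , h) = colour-spec xs x∈ u≁x (All.lookup h)

    -- Attaching an arbitrary vertex to a class

    module _ {u₀ : V} (u₀∈ : u₀ ∈ L) where

      Nbr : V → V → Set
      Nbr x w = InV x w × u₀ ~ w

      abstract
        nbr? : ∀ x → Decidable (Nbr x)
        nbr? x w = inV? x w ×-dec (u₀ ~? w)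

      -- Otherwise u₀ would extend to a clique with one vertex from every class.
      abstract
        poor-class : ∃ λ x → x ∈ xs × length (filter (nbr? x) L) ≤ (2 + l) * z y
        poor-class = go (any? (λ x → length (filter (nbr? x) L) ≤? (2 + l) * z y) xs)
          where
          Poor : V → Set
          Poor x = length (filter (nbr? x) L) ≤ (2 + l) * z y
          go : Dec (Any Poor xs) → ∃ λ x → x ∈ xs × Poor x
          go (yes a) = find a
          go (no ¬a) = absurd-clique (classes-transversal {Q = Nbr} nbr? proj₁ (2 + l) xs id xs-unique xs-length
              (λ {x} x∈ → ≰⇒> {length (filter (nbr? x) L)} {(2 + l) * z y} λ le → ¬a (lose {P = Poor} x∈ le)))
            where
            absurd-clique : (∃ λ ys → AllPairs _~_ ys × length ys ≡ 2 + l × All (λ w → ∃ λ x → Nbr x w) ys) → ∃ λ x → x ∈ xs × Poor x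
            absurd-clique (ys , cl , leny , mem) = contradiction (cong suc leny) (no-clique (u₀ ∷ ys) (All.map (λ q → proj₂ (proj₂ q)) mem ∷ cl))

      module _ {x : V} (x∈ : x ∈ xs) (poor : length (filter (nbr? x) L) ≤ (2 + l) * z y) where

        Waste : V → Set
        Waste u = ¬ Core u ⊎ Nbr x u

        abstract
          waste? : Decidable Waste
          waste? u = ¬? (core? u) ⊎-dec nbr? x u

        Useful : V → Set
        Useful u = u₀ ~ u × Any (λ x′ → x′ ≢ x × InV x′ u) xs

        abstract
          useful? : Decidable Useful
          useful? u = (u₀ ~? u) ×-dec any? (λ x′ → ¬? (x′ Fin.≟ x) ×-dec inV? x′ u) xs

        module MP = Multipartite (Fin._≟_ {n}) (colour xs)

        L′ = L ∖ u₀

        useful-free : MP.CliqueFree (suc l) (filter useful? L′)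
        useful-free = subst (λ t → MP.CliqueFree t (filter useful? L′)) (rest-length x∈)
          (MP.colours⇒free (xs ∖ x) (filter useful? L′) λ {u} u∈ →
            let _ , _ , a = ∈-filter⁻ useful? {xs = L′} u∈
                x′ , x′∈ , ne , h = find a
            in ∈-filter⁺ (λ w → ¬? (w Fin.≟ x)) (subst (_∈ xs) (sym (inV-colour x′∈ h)) x′∈)
                 (λ e → ne (≡.trans (sym (inV-colour x′∈ h)) e)))

        -- Pairs inside the copy may be light. Two vertices of one class are excluded by
        -- `separated`, since a copy has an edge through any two of its vertices.
        copy-transversal : ∀ {S} → Unique (u₀ ∷ S) → length S ≡ 2 + s → (∀ {u} → u ∈ S → u ∈ L) → IsCopy (u₀ ∷ S) →
          All Useful S → AllPairs (λ u v → colour xs u ≢ colour xs v) S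
        copy-transversal {S} uS lenS S⊆ cp us = unique⇒AllPairs S (AllPairs.tail uS) λ {u} {v} u∈ v∈ u≢v eq →
          let _ , au = All.lookup us u∈
              _ , av = All.lookup us v∈
              x₁ , x₁∈ , _ , h₁ = find au
              x₂ , x₂∈ , _ , h₂ = find av
              x₁≡x₂ = ≡.trans (sym (inV-colour x₁∈ h₁)) (≡.trans eq (inV-colour x₂∈ h₂))
              e , t , _ = copy-edge uS (cong suc lenS) cp (there u∈) (there v∈) u≢v
          in separated x₁∈ (inV-fits (S⊆ u∈) x₁∈ h₁)
               (inV-fits (S⊆ v∈) x₁∈ (subst (λ w → InV w v) (sym x₁≡x₂) h₂)) u≢v t

        -- A copy through `u₀` has a light pair at `u₀`, or a wasted vertex, or is transversal on
        -- useful vertices.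
        f₁ f₂ f₃ : List V → ℕ
        f₁ S = ∑ (picks S) (λ (u , N) → count (lightCover? u₀ u) N)
        f₂ S = count waste? S
        f₃ S = ind (all? useful? S) * MP.isClique S

        copies-split : ∀ {S} → S ⊆ L′ → length S ≡ 2 + s → ind (isCopy? (u₀ ∷ S)) ≤ f₁ S + f₂ S + f₃ S
        copies-split {S} S⊆ lenS = ind-elim (isCopy? (u₀ ∷ S)) λ cp → go cp (any? (¬? ∘ (u₀ ~?_)) S) (any? waste? S)
          where
          in-L : ∀ {u} → u ∈ S → u ∈ L × u ≢ u₀
          in-L u∈ = ∈-filter⁻ (λ w → ¬? (w Fin.≟ u₀)) (Sublist.lookup S⊆ u∈)
          uS : Unique (u₀ ∷ S)
          uS = All.tabulate (λ u∈ e → proj₂ (in-L u∈) (sym e)) ∷ Unique-⊆ S⊆ (filter⁺ (λ w → ¬? (w Fin.≟ u₀)) uL)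
          go : IsCopy (u₀ ∷ S) → Dec (Any (λ u → ¬ (u₀ ~ u)) S) → Dec (Any Waste S) → 1 ≤ f₁ S + f₂ S + f₃ S
          go cp (yes a) _ = let u , u∈ , ne = find a in
            ≤-trans (≤-trans (lightPair-witness uS lenS cp u∈ ne) (m≤m+n _ _)) (m≤m+n _ _)
          go cp _ (yes a) = let u , u∈ , w = find a in
            ≤-trans (≤-trans (∈⇒count>0 waste? u∈ w) (m≤n+m _ (f₁ S))) (m≤m+n _ _)
          go cp (no ¬a) (no ¬w) = ≤-trans (≤-reflexive (sym (cong₂ _*_ (ind-yes (all? useful? S) us)
              (ind-yes (allPairs? (λ u v → ¬? (colour xs u Fin.≟ colour xs v)) S) (copy-transversal uS lenS (proj₁ ∘ in-L) cp us))))) (m≤n+m _ _)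
            where
            us : All Useful S
            us = All.tabulate λ {u} u∈ → useful u u∈ (u₀ ~? u) (core? u)
              where
              useful : ∀ u → u ∈ S → Dec (u₀ ~ u) → Dec (Core u) → Useful u
              useful u u∈ (no ne)  _        = contradiction (lose u∈ ne) ¬a
              useful u u∈ _        (no ¬c)  = contradiction (lose u∈ (inj₁ ¬c)) ¬w
              useful u u∈ (yes nb) (yes c)  = let x′ , x′∈ , h = find c in
                nb , lose x′∈ ((λ { ≡.refl → ¬w (lose u∈ (inj₂ (h , nb))) }) , h)

        L′≤m : length L′ ≤ m
        L′≤m = ≤-trans (length-filter (λ w → ¬? (w Fin.≟ u₀)) L) (≤-reflexive len)

        cU = count useful? L

        few-wasted : count waste? L′ ≤ (2 + l) * z₁ y + (2 + l) * z y
        few-wasted = ≤-trans (count-filter≤ (λ w → ¬? (w Fin.≟ u₀)) waste? L) (≤-trans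
          (count-⊎ waste? (¬? ∘ core?) (nbr? x) L (λ _ → id))
          (+-mono-≤ few-coreless (≤-trans (≤-reflexive (sym (length-filter≡count (nbr? x) L))) poor)))

        -- The transversal copies are bounded by Zykov's theorem with l + 1 colours. The three terms
        -- of `e y` pay for light pairs at `u₀`, vertices in no class, and neighbours in the poor
        -- class.
        useful-lower : D ≤ cU + e y * α
        useful-lower = deg-bound m₀ cU (e y) m-big (begin
          τ (suc l) (2 + s) D                                       ≤⟨ deg u₀∈ ⟩
          subsum (2 + s) L′ (λ S → ind (isCopy? (u₀ ∷ S)))          ≤⟨ subsum-mono (2 + s) L′ copies-split ⟩
          subsum (2 + s) L′ (λ S → f₁ S + f₂ S + f₃ S)
            ≡⟨ ≡.trans (subsum-+ (2 + s) L′ (λ S → f₁ S + f₂ S) f₃) (cong (_+ subsum (2 + s) L′ f₃) (subsum-+ (2 + s) L′ f₁ f₂)) ⟩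
          subsum (2 + s) L′ f₁ + subsum (2 + s) L′ f₂ + subsum (2 + s) L′ f₃
            ≤⟨ +-mono-≤ (+-mono-≤ bound₁ bound₂) bound₃ ⟩
          k * r * M + w * M + τ (suc l) (2 + s) cU
            ≡⟨ ≡.trans (cong (_+ τ (suc l) (2 + s) cU) (≡.trans (sym (*-distribʳ-+ M (k * r) w)) (cong (_* M) (sym (e-def y))))) (+-comm (e y * M) _) ⟩
          τ (suc l) (2 + s) cU + e y * M                            ∎)
          where
          open ≤-Reasoning
          w = (2 + l) * z₁ y + (2 + l) * z y
          bound₁ : subsum (2 + s) L′ f₁ ≤ k * r * M
          bound₁ = begin
            subsum (2 + s) L′ f₁
              ≤⟨ lightPairs-at u₀ L′ (filter⁺ (λ w → ¬? (w Fin.≟ u₀)) uL) ⟩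
            length L′ * (k * r * length L′ ^ s)
              ≤⟨ *-mono-≤ L′≤m (*-monoʳ-≤ (k * r) (^-monoˡ-≤ s L′≤m)) ⟩
            m * (k * r * m ^ s)                         ≡⟨ shuffle m (k * r) (m ^ s) ⟩
            k * r * M                                   ∎
            where
            shuffle : ∀ a b c → a * (b * c) ≡ b * (a * c)
            shuffle = solve-∀
          bound₂ : subsum (2 + s) L′ f₂ ≤ w * M
          bound₂ = ≤-trans (subsum-∑≤ (suc s) L′ (ind ∘ waste?)) (*-mono-≤ few-wasted (^-monoˡ-≤ (suc s) L′≤m))
          bound₃ : subsum (2 + s) L′ f₃ ≤ τ (suc l) (2 + s) cU
          bound₃ = begin
            subsum (2 + s) L′ f₃                             ≡⟨ subsum-filter useful? (2 + s) L′ MP.isClique ⟨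
            subsum (2 + s) (filter useful? L′) MP.isClique
              ≤⟨ MP.zykov (suc l) (2 + s) (filter useful? L′) useful-free ⟩
            τ (suc l) (2 + s) (length (filter useful? L′))
              ≤⟨ τ-mono (suc l) (2 + s) (≤-trans (≤-reflexive (length-filter≡count useful? L′))
                                                                  (count-filter≤ (λ w → ¬? (w Fin.≟ u₀)) useful? L)) ⟩
            τ (suc l) (2 + s) cU                             ∎

        -- The useful vertices, the class of `x` and the missed vertices of another class are
        -- disjoint, and the first two already fill all but `z₂ y` of `L`.
        poor-fits : Fits x u₀
        poor-fits {x′} x′∈ x′≢x = +-cancelˡ-≤ m _ _ (begin
          m + missed u₀ x′                                       ≡⟨ cong (_+ missed u₀ x′) D+p≡m ⟨
          D + p + missed u₀ x′
            ≤⟨ +-monoˡ-≤ (missed u₀ x′) (+-mono-≤ useful-lower (class-lower x∈)) ⟩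
          cU + e y * α + (count (inV? x) L + z₁ y) + missed u₀ x′
            ≡⟨ ≡.trans (shuffle cU (e y * α) (count (inV? x) L) (z₁ y) (missed u₀ x′)) (cong (missed u₀ x′ + cU + count (inV? x) L +_) (sym (z₂-def y))) ⟩
          missed u₀ x′ + cU + count (inV? x) L + z₂ y
            ≤⟨ +-monoˡ-≤ (z₂ y) (+-monoˡ-≤ (count (inV? x) L)
               (count-disjoint (λ w → inV? x′ w ×-dec ¬? (u₀ ~? w)) useful? (λ w → ¬? (inV? x w)) L
                 (λ _ (h , _) h′ → x′≢x (inV-disjoint x∈ h h′))
                 (λ _ (_ , a) h′ → let _ , _ , ne , h = find a in ne (inV-disjoint x∈ h h′))
                 (λ _ (_ , ne) (nb , _) → ne nb))) ⟩
          count (λ w → ¬? (inV? x w)) L + count (inV? x) L + z₂ y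
            ≡⟨ cong (_+ z₂ y) (≡.trans (+-comm _ (count (inV? x) L)) (≡.trans (count-compl (inV? x) L) len)) ⟩
          m + z₂ y                                               ∎)
          where
          open ≤-Reasoning
          shuffle : ∀ a b c d f → a + b + (c + d) + f ≡ f + a + c + (b + d)
          shuffle = solve-∀

      abstract
        fits-some : ∃ λ x → x ∈ xs × Fits x u₀
        fits-some = let x , x∈ , poor = poor-class in x , x∈ , poor-fits x∈ poor

    φ′ : ∀ u → Dec (u ∈ L) → V
    φ′ u (yes u∈) = proj₁ (fits-some u∈)
    -- A default value; copies are counted inside `L` only.
    φ′ u (no _)   = u

    φ : V → V
    φ u = φ′ u (any? (u Fin.≟_) L)

    φ-spec : ∀ {u} → u ∈ L → φ u ∈ xs × Fits (φ u) u
    φ-spec {u} u∈ = go (any? (u Fin.≟_) L)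
      where
      go : (d : Dec (u ∈ L)) → φ′ u d ∈ xs × Fits (φ′ u d) u
      go (yes p) = proj₂ (fits-some p)
      go (no ¬p) = contradiction u∈ ¬p

    -- By `separated` every copy is a clique of the complete multipartite graph of `φ`, which has
    -- only ℓ colours.
    dense-bound : subsum (3 + s) L (λ S → ind (isCopy? S)) ≤ τ (2 + l) (3 + s) (suc m₀)
    dense-bound = begin
      subsum (3 + s) L (λ S → ind (isCopy? S))
        ≤⟨ subsum-mono (3 + s) L (λ {S} S⊆ lenS → ind-elim (isCopy? S) λ cp →
           1≤ind (allPairs? (λ u v → ¬? (φ u Fin.≟ φ v)) S) (transversal S⊆ lenS cp)) ⟩
      subsum (3 + s) L Φ.isClique
        ≤⟨ Φ.zykov (2 + l) (3 + s) L (subst (λ t → Φ.CliqueFree t L) xs-length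
                                                      (Φ.colours⇒free xs L (proj₁ ∘ φ-spec))) ⟩
      τ (2 + l) (3 + s) (length L)               ≡⟨ cong (τ (2 + l) (3 + s)) len ⟩
      τ (2 + l) (3 + s) (suc m₀)                 ∎
      where
      open ≤-Reasoning
      module Φ = Multipartite (Fin._≟_ {n}) φ
      transversal : ∀ {S} → S ⊆ L → length S ≡ 3 + s → IsCopy S → AllPairs (λ u v → φ u ≢ φ v) S
      transversal {S} S⊆ lenS cp = unique⇒AllPairs S uS λ {u} {v} u∈ v∈ u≢v eq →
        let e , t , _ = copy-edge uS lenS cp u∈ v∈ u≢v
            φu∈ , fu = φ-spec (Sublist.lookup S⊆ u∈)
            _ , fv = φ-spec (Sublist.lookup S⊆ v∈)
        in separated φu∈ fu (subst (λ w → Fits w v) (sym eq) fv) u≢v t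
        where uS = Unique-⊆ S⊆ uL

-- Progressive induction

module Threshold (r l s : ℕ) (3≤r : 3 ≤ r) (r≤s : r ≤ 3 + s) (k : ℕ)
  (k-big : 3 + l + suc ((3 + l) * (3 + l)) * r < k)
  (α β : ℕ) (deg-bound : DegreeBound l s α β) where

  open Scales l α (k * r)

  classScale : ℕ → ℕ
  classScale y = z₁ y + (z₂ y + z₂ y) + r + (2 + l) * z y

  abstract
    -- The two conditions of `Dense` that are linear in `y`, namely `m-big` and `p-big`, are added
    -- up into a single bound by `m₀`; the factor `2 + l` clears the division in `p`.
    scale : ∃ λ N₀ → ∀ m₀ → N₀ ≤ m₀ → ∃ λ y → 1 ≤ y ×
      β * suc (e y * α) + classScale y * (2 + l) ≤ m₀ × (3 + s) * (k * r) * suc m₀ ≤ y * y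
    scale = intermediate-scale
      (lin-+ (lin-*ˡ β (lin-+ (lin-const 1) (lin-*ʳ α lin-e)))
             (lin-*ʳ (2 + l) (lin-+ (lin-+ (lin-+ lin-z₁ (lin-+ lin-z₂ lin-z₂)) (lin-const r)) (lin-*ˡ (2 + l) lin-z))))
      ((3 + s) * (k * r))

  N₀ : ℕ
  N₀ = proj₁ scale

  -- On N₀ + 1 vertices there are at most (N₀ + 1)^(3+s) copies, and each deletion on the way down
  -- raises the excess by at least one, so an excess on `N` or more vertices is impossible.
  N : ℕ
  N = suc (N₀ + suc N₀ ^ (3 + s))

  module _ {n} (G : RGraph r n) (free : ¬ ContainsExpansion G (3 + l)) where

    open Extremal G l s k 3≤r r≤s k-big free

    copies : List V → ℕ
    copies L = subsum (3 + s) L (λ S → ind (isCopy? S))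

    dense : ∀ m₀ L → Unique L → length L ≡ suc m₀ → N₀ ≤ m₀ →
      (∀ {v} → v ∈ L → minDegree m₀ ≤ degree L v) → copies L ≤ τ (2 + l) (3 + s) (suc m₀)
    dense m₀ L uL len big deg with proj₂ scale m₀ big
    ... | y , 1≤y , f≤ , y² = Dense.dense-bound G l s k 3≤r r≤s k-big free α β deg-bound L uL m₀ len y 1≤y y²
      (≤-trans (m≤m+n _ (classScale y * (2 + l))) (≤-trans f≤ (n≤1+n m₀)))
      (s≤s (m*n≤o⇒m≤o/n (classScale y) (2 + l) m₀ (≤-trans (m≤n+m _ (β * suc (e y * α))) f≤)))
      deg

    -- Deleting a vertex of small degree raises the excess over the Turán number, which is bounded at N₀.
    progressive : ∀ m₀ L → Unique L → length L ≡ suc m₀ → N₀ ≤ m₀ →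
      copies L ≤ τ (2 + l) (3 + s) (suc m₀) ⊎
      copies L + m₀ ≤ τ (2 + l) (3 + s) (suc m₀) + (N₀ + suc N₀ ^ (3 + s))
    progressive m₀ L uL len big with N₀ ≟ m₀
    ... | yes ≡.refl = inj₂ (begin
      copies L + N₀
        ≤⟨ +-monoˡ-≤ N₀ (subsum-mono (3 + s) L λ {S} _ _ → ind≤1 (isCopy? S)) ⟩
      subsum (3 + s) L (const 1) + N₀     ≤⟨ +-monoˡ-≤ N₀ (subsum-1≤^ (3 + s) L) ⟩
      length L ^ (3 + s) + N₀             ≡⟨ cong (λ x → x ^ (3 + s) + N₀) len ⟩
      suc N₀ ^ (3 + s) + N₀               ≡⟨ +-comm (suc N₀ ^ (3 + s)) N₀ ⟩
      N₀ + suc N₀ ^ (3 + s)               ≤⟨ m≤n+m _ (τ (2 + l) (3 + s) (suc N₀)) ⟩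
      τ (2 + l) (3 + s) (suc N₀) + (N₀ + suc N₀ ^ (3 + s)) ∎)
      where open ≤-Reasoning
    progressive zero     L uL len big | no ne = contradiction (n≤0⇒n≡0 big) ne
    progressive (suc m₁) L uL len big | no ne = go (any? (λ v → degree L v <? minDegree (suc m₁)) L)
      where
      open ≤-Reasoning
      Sparse : V → Set
      Sparse v = degree L v < minDegree (suc m₁)
      T = τ (2 + l) (3 + s)
      go : Dec (Any Sparse L) → copies L ≤ T (2 + m₁) ⊎ copies L + suc m₁ ≤ T (2 + m₁) + (N₀ + suc N₀ ^ (3 + s))
      go (no ¬a) = inj₁ (dense (suc m₁) L uL len big λ v∈ → ≮⇒≥ λ lt → ¬a (lose v∈ lt))
      go (yes a) = Sum.map below above
        (progressive m₁ (L ∖ v) (filter⁺ (λ u → ¬? (u Fin.≟ v)) uL)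
          (suc-injective (≡.trans (sym (↭-length (∖-↭ uL v∈))) len)) (s≤s⁻¹ (≤∧≢⇒< big ne)))
        where
        v  = proj₁ (find a)
        v∈ = proj₁ (proj₂ (find a))
        lt = proj₂ (proj₂ (find a))
        split : copies L ≡ copies (L ∖ v) + degree L v
        split = subsum-↭ (3 + s) isCopy-↭ (∖-↭ uL v∈)
        below : copies (L ∖ v) ≤ T (suc m₁) → copies L ≤ T (2 + m₁)
        below le = ≤-trans (≤-reflexive split) (+-mono-≤ le (<⇒≤ lt))
        above : copies (L ∖ v) + m₁ ≤ T (suc m₁) + (N₀ + suc N₀ ^ (3 + s)) →
          copies L + suc m₁ ≤ T (2 + m₁) + (N₀ + suc N₀ ^ (3 + s))
        above le = begin
          copies L + suc m₁                               ≡⟨ cong (_+ suc m₁) split ⟩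
          copies (L ∖ v) + degree L v + suc m₁            ≡⟨ shuffle (copies (L ∖ v)) (degree L v) m₁ ⟩
          copies (L ∖ v) + m₁ + suc (degree L v)          ≤⟨ +-mono-≤ le lt ⟩
          T (suc m₁) + (N₀ + suc N₀ ^ (3 + s)) + minDegree (suc m₁)
            ≡⟨ shuffle′ (T (suc m₁)) (N₀ + suc N₀ ^ (3 + s)) (minDegree (suc m₁)) ⟩
          T (2 + m₁) + (N₀ + suc N₀ ^ (3 + s))            ∎
          where
          shuffle : ∀ a b c → a + b + suc c ≡ a + c + suc b
          shuffle = solve-∀
          shuffle′ : ∀ a b c → a + b + c ≡ a + c + b
          shuffle′ = solve-∀

    copies≤τ : ∀ m₀ L → Unique L → length L ≡ suc m₀ → N ≤ suc m₀ → copies L ≤ τ (2 + l) (3 + s) (suc m₀)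
    copies≤τ m₀ L uL len (s≤s big) with progressive m₀ L uL len (≤-trans (m≤m+n N₀ _) big)
    ... | inj₁ le = le
    -- Here `m₀` is at least the additive constant, so the second alternative implies the bound too.
    ... | inj₂ le = +-cancelʳ-≤ m₀ _ _ (≤-trans le (+-monoʳ-≤ (τ (2 + l) (3 + s) (suc m₀)) big))

    copiesK≡ : copiesK (3 + s) G ≡ copies (allFin n)
    copiesK≡ = ≡.trans (count-subsets n (3 + s) (spansClique? G))
      (subsum-cong (3 + s) (allFin n) λ {S} _ _ → ind-⇔ (spansClique? G (toSub S)) (isCopy? S) id id)

  upper-bound : ∀ n → N ≤ n → (G : RGraph r n) → ¬ ContainsExpansion G (3 + l) → copiesK (3 + s) G ≤ τ (2 + l) (3 + s) n
  upper-bound (suc m₀) big G free = ≤-trans (≤-reflexive (copiesK≡ G free))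
    (copies≤τ G free m₀ (allFin (suc m₀)) (allFin⁺ (suc m₀)) (length-tabulate id) big)

theorem2p2 : (ℓ s r : ℕ) → 3 ≤ r → r ≤ s → s ≤ ℓ →
    Σ ℕ λ N → ∀ n → N ≤ n →
    ((G : RGraph r n) → ¬ ContainsExpansion G (suc ℓ) →
    copiesK s G ≤ copiesK s (turan r n ℓ))
    × (Σ (RGraph r n) λ G → ¬ ContainsExpansion G (suc ℓ) ×
    copiesK s G ≡ copiesK s (turan r n ℓ))
theorem2p2 zero                s                 r 3≤r r≤s s≤ℓ = contradiction (≤-trans 3≤r (≤-trans r≤s s≤ℓ)) λ ()
theorem2p2 (suc zero)          s                 r 3≤r r≤s s≤ℓ = contradiction (≤-trans 3≤r (≤-trans r≤s s≤ℓ)) λ { (s≤s ()) }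
theorem2p2 (suc (suc l))       zero              r 3≤r r≤s s≤ℓ = contradiction (≤-trans 3≤r r≤s) λ ()
theorem2p2 (suc (suc l))       (suc zero)        r 3≤r r≤s s≤ℓ = contradiction (≤-trans 3≤r r≤s) λ { (s≤s ()) }
theorem2p2 (suc (suc l))       (suc (suc zero))  r 3≤r r≤s s≤ℓ = contradiction (≤-trans 3≤r r≤s) λ { (s≤s (s≤s ())) }
theorem2p2 (suc (suc l)) (suc (suc (suc s))) r 3≤r r≤s (s≤s (s≤s s≤l)) = N , λ n big →
  (λ G free → ≤-trans (upper-bound n big G free) (turan-lower r n (suc l) (3 + s))) ,
  turan r n (2 + l) , turan-free r n (suc l) , ≡.refl
  -- `≤-refl` fixes `k` as the least number above the size bound of the greedy embedding.
  where open Threshold r l s 3≤r r≤s _ ≤-refl (loss s) (upperScale s) (degree-bound l s s≤l)
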